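{- Let $p,q\geq 5$ be two distinct primes. Then there is no $(p+q)\times(p+q)$ circulant complex Hadamard matrix all of whose entries are $pq$-th roots of unity, i.e. $C^{circ}_{p+q}(pq)=\emptyset$.
   Context: A complex Hadamard matrix of order $n$ is a matrix $H\in M_n(\mathbb C)$ with $|H_{ij}|=1$ for all $i,j$ and pairwise orthogonal rows. A matrix $H=(H_{ij})_{i,j=0}^{n-1}$ is circulant if $H_{ij}$ depends only on $j-i$ modulo $n$. $C^{circ}_n(l)$ denotes the set of $n\times n$ circulant complex Hadamard matrices whose entries are all $l$-th roots of unity. -}

module Defs where

open import Level using (0ℓ)
open import Algebra.Bundles using (RawRing)
import Algebra.Definitions.RawSemiring as RawSemiringDefs
open import Data.Fin.Base using (Fin; toℕ)
import Data.Integer.Base as ℤ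
import Data.Integer.Divisibility as ℤ
open import Data.Nat.Base as ℕ using (ℕ)
import Data.Nat.Properties as ℕ
open import Data.Product.Base using (_×_; _,_; ∃-syntax)
open import Data.Rational.Base
open import Data.Rational.Properties
open import Data.Rational.Solver using (module +-*-Solver)
open import Data.Vec.Functional using (Vector)
open import Relation.Binary.PropositionalEquality
  using (_≡_; _≢_; refl; sym; cong; cong₂; trans; subst)

IsCauchy : (ℕ → ℚ) → Set
IsCauchy x = ∀ ε → 0ℚ < ε →
  ∃[ N ] ∀ m n → N ℕ.≤ m → N ℕ.≤ n → ∣ x m - x n ∣ < ε

private
  open module Solver = +-*-Solver using (solve; _:=_; _:+_; _:*_; _:-_)

abstract

  private

    +-interchange : ∀ a b c d → (a + b) - (c + d) ≡ (a - c) + (b - d)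
    +-interchange = solve 4 (λ a b c d →
      (a :+ b) :- (c :+ d) := (a :- c) :+ (b :- d)) refl

    *-telescope : ∀ a b c d → a * b - c * d ≡ (a - c) * b + (b - d) * c
    *-telescope = solve 4 (λ a b c d →
      a :* b :- c :* d := (a :- c) :* b :+ (b :- d) :* c) refl

    b+[a-b] : ∀ a b → a ≡ b + (a - b)
    b+[a-b] = solve 2 (λ a b → a := b :+ (a :- b)) refl

    half-pos : ∀ ε → 0ℚ < ε → 0ℚ < ½ * ε
    half-pos ε 0<ε = positive⁻¹ (½ * ε)
      {{pos*pos⇒pos ½ ε {{positive 0<ε}}}}

    half+half : ∀ ε → ½ * ε + ½ * ε ≡ ε
    half+half ε = trans (sym (*-distribʳ-+ ε ½ ½)) (*-identityˡ ε)

    scale : ∀ B ε → 0ℚ < B → 0ℚ < ε → ∃[ δ ] (0ℚ < δ) × (δ * B ≡ ε)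
    scale B ε 0<B 0<ε = ε * 1/B , positive⁻¹ (ε * 1/B) {{ε/B>0}} , ε/B*B≡ε
      where
      B>0 : Positive B
      B>0 = positive 0<B
      B≢0 : NonZero B
      B≢0 = pos⇒nonZero B {{B>0}}
      1/B : ℚ
      1/B = (1/ B) {{B≢0}}
      ε/B>0 : Positive (ε * 1/B)
      ε/B>0 = pos*pos⇒pos ε {{positive 0<ε}} 1/B {{1/pos⇒pos B {{B>0}}}}
      ε/B*B≡ε : (ε * 1/B) * B ≡ ε
      ε/B*B≡ε = trans (*-assoc ε 1/B B)
        (trans (cong (ε *_) (*-inverseˡ B {{B≢0}})) (*-identityʳ ε))

    *-mono-≤-< : ∀ {a b c d} → 0ℚ ≤ a → 0ℚ < d → a < b → c ≤ d → a * c < b * d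
    *-mono-≤-< {a} {b} {c} {d} 0≤a 0<d a<b c≤d = ≤-<-trans
      (*-monoˡ-≤-nonNeg a {{nonNegative 0≤a}} c≤d)
      (*-monoˡ-<-pos d {{positive 0<d}} a<b)

    *-estimate : ∀ a b c d {δ η B C e} → 0ℚ < B → 0ℚ < C →
      ∣ a - c ∣ < δ → ∣ b ∣ ≤ C → ∣ b - d ∣ < η → ∣ c ∣ ≤ B →
      δ * C ≡ e → η * B ≡ e → ∣ a * b - c * d ∣ < e + e
    *-estimate a b c d {δ} {η} {B} {C} {e} 0<B 0<C hδ hC hη hB δC ηB = begin-strict
      ∣ a * b - c * d ∣
        ≡⟨ cong ∣_∣ (*-telescope a b c d) ⟩
      ∣ (a - c) * b + (b - d) * c ∣
        ≤⟨ ∣p+q∣≤∣p∣+∣q∣ ((a - c) * b) ((b - d) * c) ⟩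
      ∣ (a - c) * b ∣ + ∣ (b - d) * c ∣
        ≡⟨ cong₂ _+_ (∣p*q∣≡∣p∣*∣q∣ (a - c) b) (∣p*q∣≡∣p∣*∣q∣ (b - d) c) ⟩
      ∣ a - c ∣ * ∣ b ∣ + ∣ b - d ∣ * ∣ c ∣
        <⟨ +-mono-< (*-mono-≤-< (0≤∣p∣ (a - c)) 0<C hδ hC)
                    (*-mono-≤-< (0≤∣p∣ (b - d)) 0<B hη hB) ⟩
      δ * C + η * B
        ≡⟨ cong₂ _+_ δC ηB ⟩
      e + e ∎
      where open ≤-Reasoning

  const-cauchy : ∀ r → IsCauchy (λ _ → r)
  const-cauchy r ε 0<ε =
    0 , λ _ _ _ _ → subst (λ s → ∣ s ∣ < ε) (sym (+-inverseʳ r)) 0<ε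

  +-cauchy : ∀ x y → IsCauchy x → IsCauchy y → IsCauchy (λ n → x n + y n)
  +-cauchy x y cx cy ε 0<ε
    with cx (½ * ε) (half-pos ε 0<ε) | cy (½ * ε) (half-pos ε 0<ε)
  ... | M , hM | N , hN = M ℕ.⊔ N , λ m n m≥ n≥ → begin-strict
      ∣ (x m + y m) - (x n + y n) ∣
        ≡⟨ cong ∣_∣ (+-interchange (x m) (y m) (x n) (y n)) ⟩
      ∣ (x m - x n) + (y m - y n) ∣
        ≤⟨ ∣p+q∣≤∣p∣+∣q∣ (x m - x n) (y m - y n) ⟩
      ∣ x m - x n ∣ + ∣ y m - y n ∣
        <⟨ +-mono-<
             (hM m n (ℕ.m⊔n≤o⇒m≤o M N m≥) (ℕ.m⊔n≤o⇒m≤o M N n≥))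
             (hN m n (ℕ.m⊔n≤o⇒n≤o M N m≥) (ℕ.m⊔n≤o⇒n≤o M N n≥)) ⟩
      ½ * ε + ½ * ε
        ≡⟨ half+half ε ⟩
      ε ∎
    where
    open ≤-Reasoning

  neg-cauchy : ∀ x → IsCauchy x → IsCauchy (λ n → - x n)
  neg-cauchy x cx ε 0<ε with cx ε 0<ε
  ... | N , hN = N , λ m n m≥ n≥ → subst (_< ε)
        (trans (sym (∣-p∣≡∣p∣ (x m - x n)))
               (cong ∣_∣ (neg-distrib-+ (x m) (- x n))))
        (hN m n m≥ n≥)

  private
    eventually-bounded : ∀ x → IsCauchy x →
      ∃[ B ] (0ℚ < B) × ∃[ N ] ∀ n → N ℕ.≤ n → ∣ x n ∣ ≤ B
    eventually-bounded x cx with cx 1ℚ (positive⁻¹ 1ℚ)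
    ... | N , hN = ∣ x N ∣ + 1ℚ
      , +-mono-≤-< (0≤∣p∣ (x N)) (positive⁻¹ 1ℚ)
      , N , λ n n≥ → begin
          ∣ x n ∣
            ≡⟨ cong ∣_∣ (b+[a-b] (x n) (x N)) ⟩
          ∣ x N + (x n - x N) ∣
            ≤⟨ ∣p+q∣≤∣p∣+∣q∣ (x N) (x n - x N) ⟩
          ∣ x N ∣ + ∣ x n - x N ∣
            ≤⟨ +-monoʳ-≤ ∣ x N ∣ (<⇒≤ (hN n N n≥ ℕ.≤-refl)) ⟩
          ∣ x N ∣ + 1ℚ ∎
      where
      open ≤-Reasoning

  -- Helper functions instead of `with`, which would normalise the goal.
  *-cauchy : ∀ x y → IsCauchy x → IsCauchy y → IsCauchy (λ n → x n * y n)
  *-cauchy x y cx cy ε 0<ε =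
    bound (eventually-bounded x cx) (eventually-bounded y cy)
    where
    Bounded : (ℕ → ℚ) → Set
    Bounded z = ∃[ B ] (0ℚ < B) × ∃[ N ] ∀ n → N ℕ.≤ n → ∣ z n ∣ ≤ B

    Goal : Set
    Goal = ∃[ N ] ∀ m n → N ℕ.≤ m → N ℕ.≤ n → ∣ x m * y m - x n * y n ∣ < ε

    bound : Bounded x → Bounded y → Goal
    bound (B , 0<B , K , hK) (C , 0<C , L , hL) =
      choose (scale C (½ * ε) 0<C (half-pos ε 0<ε))
             (scale B (½ * ε) 0<B (half-pos ε 0<ε))
      where
      choose : ∃[ δ ] (0ℚ < δ) × (δ * C ≡ ½ * ε) →
               ∃[ η ] (0ℚ < η) × (η * B ≡ ½ * ε) → Goal
      choose (δ , 0<δ , δC) (η , 0<η , ηB) = finish (cx δ 0<δ) (cy η 0<η)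
        where
        finish : (∃[ M ] ∀ m n → M ℕ.≤ m → M ℕ.≤ n → ∣ x m - x n ∣ < δ) →
                 (∃[ N ] ∀ m n → N ℕ.≤ m → N ℕ.≤ n → ∣ y m - y n ∣ < η) → Goal
        finish (M , hM) (N , hN) = (K ℕ.⊔ L) ℕ.⊔ (M ℕ.⊔ N) , λ m n m≥ n≥ →
          subst (∣ x m * y m - x n * y n ∣ <_) (half+half ε)
            (*-estimate (x m) (y m) (x n) (y n) 0<B 0<C
              (hM m n (toM m≥) (toM n≥)) (hL m (toL m≥))
              (hN m n (toN m≥) (toN n≥)) (hK n (toK n≥)) δC ηB)
          where
          toK : ∀ {n} → (K ℕ.⊔ L) ℕ.⊔ (M ℕ.⊔ N) ℕ.≤ n → K ℕ.≤ n
          toK h = ℕ.m⊔n≤o⇒m≤o K L (ℕ.m⊔n≤o⇒m≤o (K ℕ.⊔ L) (M ℕ.⊔ N) h)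
          toL : ∀ {n} → (K ℕ.⊔ L) ℕ.⊔ (M ℕ.⊔ N) ℕ.≤ n → L ℕ.≤ n
          toL h = ℕ.m⊔n≤o⇒n≤o K L (ℕ.m⊔n≤o⇒m≤o (K ℕ.⊔ L) (M ℕ.⊔ N) h)
          toM : ∀ {n} → (K ℕ.⊔ L) ℕ.⊔ (M ℕ.⊔ N) ℕ.≤ n → M ℕ.≤ n
          toM h = ℕ.m⊔n≤o⇒m≤o M N (ℕ.m⊔n≤o⇒n≤o (K ℕ.⊔ L) (M ℕ.⊔ N) h)
          toN : ∀ {n} → (K ℕ.⊔ L) ℕ.⊔ (M ℕ.⊔ N) ℕ.≤ n → N ℕ.≤ n
          toN h = ℕ.m⊔n≤o⇒n≤o M N (ℕ.m⊔n≤o⇒n≤o (K ℕ.⊔ L) (M ℕ.⊔ N) h)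

-- The real numbers: Cauchy sequences of rationals, considered up to the
-- equivalence _≈ℝ_ ("the difference tends to 0").

record ℝ : Set where
  constructor mkℝ
  field
    seq    : ℕ → ℚ
    cauchy : IsCauchy seq

open ℝ public

infix  4 _≈ℝ_ _≤ℝ_
infixl 6 _+ℝ_
infixl 7 _*ℝ_
infix  8 -ℝ_

_≈ℝ_ : ℝ → ℝ → Set
x ≈ℝ y = ∀ ε → 0ℚ < ε →
  ∃[ N ] ∀ n → N ℕ.≤ n → ∣ seq x n - seq y n ∣ < ε

-- An inequality between limits only gives the terms' inequality up to ε.
_≤ℝ_ : ℝ → ℝ → Set
x ≤ℝ y = ∀ ε → 0ℚ < ε →
  ∃[ N ] ∀ n → N ℕ.≤ n → seq x n < seq y n + ε

fromℚ : ℚ → ℝ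
fromℚ r = mkℝ (λ _ → r) (const-cauchy r)

0ℝ 1ℝ : ℝ
0ℝ = fromℚ 0ℚ
1ℝ = fromℚ 1ℚ

_+ℝ_ _*ℝ_ : ℝ → ℝ → ℝ
x +ℝ y = mkℝ (λ n → seq x n + seq y n) (+-cauchy (seq x) (seq y) (cauchy x) (cauchy y))
x *ℝ y = mkℝ (λ n → seq x n * seq y n) (*-cauchy (seq x) (seq y) (cauchy x) (cauchy y))

-ℝ_ : ℝ → ℝ
-ℝ x = mkℝ (λ n → - seq x n) (neg-cauchy (seq x) (cauchy x))

infixl 6 _+i_

record ℂ : Set where
  constructor _+i_
  field
    re im : ℝ

open ℂ public

ℂ-rawRing : RawRing 0ℓ 0ℓ
ℂ-rawRing = record
  { Carrier = ℂ
  ; _≈_     = λ z w → (re z ≈ℝ re w) × (im z ≈ℝ im w)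
  ; _+_     = λ z w → (re z +ℝ re w) +i (im z +ℝ im w)
  ; _*_     = λ z w → (re z *ℝ re w +ℝ -ℝ (im z *ℝ im w))
                   +i (re z *ℝ im w +ℝ im z *ℝ re w)
  ; -_      = λ z → (-ℝ re z) +i (-ℝ im z)
  ; 0#      = 0ℝ +i 0ℝ
  ; 1#      = 1ℝ +i 0ℝ
  }

open RawRing ℂ-rawRing public
  using ()
  renaming ( _≈_ to _≈ℂ_; _+_ to _+ℂ_; _*_ to _*ℂ_; -_ to -ℂ_
           ; 0# to 0ℂ; 1# to 1ℂ )

open RawSemiringDefs (RawRing.rawSemiring ℂ-rawRing) public
  using ()
  renaming ( sum to sumℂ; _^_ to _^ℂ_ )

conj : ℂ → ℂ
conj z = re z +i (-ℝ im z)

-- ∣ z ∣ℂ≈ r says |z| = r, i.e. r is the nonnegative square root of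
-- re z ² + im z ².
∣_∣ℂ≈_ : ℂ → ℝ → Set
∣ z ∣ℂ≈ r = (0ℝ ≤ℝ r) × (r *ℝ r ≈ℝ re z *ℝ re z +ℝ im z *ℝ im z)

IsRootOfUnity : ℕ → ℂ → Set
IsRootOfUnity l z = z ^ℂ l ≈ℂ 1ℂ

Matrix : ℕ → Set
Matrix n = Fin n → Fin n → ℂ

⟨_,_⟩ : ∀ {n} → Vector ℂ n → Vector ℂ n → ℂ
⟨ u , v ⟩ = sumℂ (λ k → u k *ℂ conj (v k))

record IsComplexHadamard {n} (H : Matrix n) : Set where
  field
    unimodular : ∀ i j → ∣ H i j ∣ℂ≈ 1ℝ
    orthogonal : ∀ i j → i ≢ j → ⟨ H i , H j ⟩ ≈ℂ 0ℂ

IsCirculant : ∀ {n} → Matrix n → Set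
IsCirculant {n} H = ∀ i j k l →
  ℤ.+ n ℤ.∣ (ι j ℤ.- ι i) ℤ.- (ι l ℤ.- ι k) → H i j ≈ℂ H k l
  where
  ι : Fin n → ℤ.ℤ
  ι i = ℤ.+ toℕ i

record C-circ (n l : ℕ) (H : Matrix n) : Set where
  field
    isComplexHadamard : IsComplexHadamard H
    isCirculant       : IsCirculant H
    rootsOfUnity      : ∀ i j → IsRootOfUnity l (H i j)

-- Write each entry of the first row as ζ ^ a * η ^ b with ζ ^ p = 1 and
-- η ^ q = 1.  The orthogonality of two rows is a vanishing sum of p + q terms
-- η ^ Y c * ζ ^ X c.  The powers of η satisfy no linear relation over ℤ but the
-- obvious one, p is unramified in ℤ[η], and ζ ≡ 1 modulo the prime above p; so
-- the sums Σ η ^ Y c and Σ X c * η ^ Y c lie in p ℤ[η].  Hence the fibres of Y,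
-- and the sums of X over them, are constant modulo p.  Since there are only
-- p + q terms, each fibre has one element except for one with p + 1; since ΣX and
-- ΣY vanish modulo p and q, the large fibre lies over 0, and X = 0 off it.
-- So two distinct entries of a row share their p-part or their q-part, which
-- forces one of the two parts to be constant.  Then a sum of p + q roots of unity
-- of the other prime order vanishes, so that prime divides p + q.
-- ℂ enters only as an integral domain of characteristic 0 with stable equality.
module Submission where

open import Algebra.Bundles using (CommutativeRing; CommutativeSemiring)
import Algebra.Definitions.RawMonoid as RawMonoidDefs
import Algebra.Properties.CommutativeSemigroup as CommutativeSemigroupProperties
import Algebra.Properties.CommutativeSemiring.Binomial as Binomial
import Algebra.Properties.CommutativeSemiring.Exp as CommutativeExp
import Algebra.Properties.Ring as RingProperties
import Algebra.Properties.Semiring.Exp as Exp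
import Algebra.Properties.Semiring.Mult as Mult
import Algebra.Properties.Semiring.Mult.TCOptimised as Mult′
import Algebra.Properties.Semiring.Sum as SemiringSum
import Algebra.Solver.Ring as RingSolver
open import Algebra.Solver.Ring.AlmostCommutativeRing
  using (fromCommutativeRing; _-Raw-AlmostCommutative⟶_)
open import Data.Empty using (⊥)
open import Data.Fin.Base as Fin using (Fin; toℕ; fromℕ<)
import Data.Fin.Properties as Fin
open import Data.Integer.Base as ℤ using (ℤ; +_; -[1+_])
import Data.Integer.Divisibility.Signed as ℤ
import Data.Integer.Properties as ℤ
open import Data.Integer.Solver using () renaming (module +-*-Solver to ℤ-Solver)
open import Data.List.Base using (List; []; _∷_; length; map; foldr; applyUpTo)
import Data.List.Properties as List
open import Data.List.Relation.Unary.All as All using (All; []; _∷_)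
import Data.List.Relation.Unary.All.Properties as All
open import Data.Maybe.Base as Maybe using (Maybe)
open import Data.Nat.Base as ℕ using (ℕ; zero; suc; z≤n; s≤s; _!)
open import Data.Nat.Combinatorics using (_C_; k![n∸k]!∣n!; nCn≡1; nC1≡n)
open import Data.Nat.Combinatorics.Specification using (nCk≡n!/k![n-k]!)
open import Data.Nat.Coprimality using (Coprime; coprime-Bézout)
import Data.Nat.Divisibility as ℕ
open import Data.Nat.DivMod
  using (_%_; _/_; m≡m%n+[m/n]*n; m%n<n; m%n%n≡m%n; [m+n]%n≡m%n; m<n⇒m%n≡m; m/n*n≡m; m*[n/m]≡n)
open import Data.Nat.GCD using (module Bézout)
open import Data.Nat.Primality
  using (Prime; euclidsLemma; prime⇒nonTrivial; prime⇒nonZero; prime⇒irreducible)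
import Data.Nat.Properties as ℕ
open import Data.Nat.Solver using () renaming (module +-*-Solver to ℕ-Solver)
open import Data.Product.Base using (_×_; _,_; Σ-syntax; ∃-syntax; proj₁; proj₂)
import Data.Rational.Base as ℚ
import Data.Rational.Properties as ℚ
open import Data.Rational.Solver using () renaming (module +-*-Solver to ℚ-Solver)
open import Data.Sum.Base using (_⊎_; inj₁; inj₂)
open import Function.Base using (_∘_; id)
open import Level using (0ℓ)
open import Relation.Binary.Definitions using (tri<; tri≈; tri>)
open import Relation.Binary.PropositionalEquality as ≡ using (_≡_; _≢_)
open import Relation.Nullary using (¬_; contradiction; yes; no)
open import Relation.Nullary.Decidable using (dec⇒maybe; decidable-stable)

-- Circulance enters twice. Every other row is a cyclic shift of the first, so its entry in column c
-- is the entry c + k of the first row: comparing two rows compares two entries of one row, and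
-- every pair of entries arises for some k. Moreover a shift only rearranges the entries, so the
-- quotients of two rows multiply to 1; this is why ΣX and ΣY vanish. Oddness enters because 0 + ...
-- + (q - 1) is a multiple of q only then, which places the large fibre at 0; the analogue for p is
-- used for the sums of X. Put f(x) = Σ η ^ Y c * x ^ X c. The two divisibilities concern f(1) and
-- f′(1): the first gives the fibre sizes, the second turns a fibre of size one into X c ≡ 0.
-- Ideals, minimal polynomials and automorphisms are avoided, since equality in ℂ is undecidable.
-- Polynomials are functions with coefficients in a subring given by a predicate, reduction modulo
-- the prime above p becomes evaluation at 1, and conjugation becomes a statement about integral
-- relations.

-- Primes, factorials and binomial coefficients.

prime>1 : ∀ {p} → Prime p → 1 ℕ.< p
prime>1 pp = ℕ.nonTrivial⇒n>1 _ {{prime⇒nonTrivial pp}}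

prime∤⇒coprime : ∀ {p a} → Prime p → ¬ p ℕ.∣ a → Coprime a p
prime∤⇒coprime pp p∤a (d∣a , d∣p) with prime⇒irreducible pp d∣p
... | inj₁ d≡1 = d≡1
... | inj₂ ≡.refl = contradiction d∣a p∤a

inverse-mod : ∀ {p} a → Prime p → ¬ p ℕ.∣ a → ∃[ b ] ∃[ e ] a ℕ.* b ≡ 1 ℕ.+ e ℕ.* p
inverse-mod {p} a pp p∤a with coprime-Bézout (prime∤⇒coprime pp p∤a)
... | Bézout.+- x y eq = x , y , ≡.trans (ℕ.*-comm a x) (≡.sym eq)
... | Bézout.-+ x zero eq = contradiction eq λ ()
... | Bézout.-+ x (suc y) eq with p | prime>1 pp
...   | suc zero | s≤s ()
-- Here `x` times `a` is -1 modulo `p`; multiplying by p - 1, that is `suc r`, changes the sign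
-- within the natural numbers.
...   | suc (suc r) | _ = x ℕ.* suc r , r ℕ.+ y ℕ.* suc r ,
  ℕ.+-cancelˡ-≡ (suc r) _ _ (begin
    suc r ℕ.+ a ℕ.* (x ℕ.* suc r)
      ≡⟨ solve 3 (λ a x s → s :+ a :* (x :* s) := (con 1 :+ x :* a) :* s) ≡.refl a x (suc r) ⟩
    (1 ℕ.+ x ℕ.* a) ℕ.* suc r
      ≡⟨ ≡.cong (ℕ._* suc r) eq ⟩
    suc y ℕ.* suc (suc r) ℕ.* suc r
      ≡⟨ solve 2 (λ y r → (con 1 :+ y) :* (con 2 :+ r) :* (con 1 :+ r)
           := (con 1 :+ r) :+ (con 1 :+ (r :+ y :* (con 1 :+ r)) :* (con 2 :+ r))) ≡.refl y r ⟩
    suc r ℕ.+ (1 ℕ.+ (r ℕ.+ y ℕ.* suc r) ℕ.* suc (suc r)) ∎)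
  where
  open ℕ-Solver
  open ≡.≡-Reasoning

prime∣^⇒∣ : ∀ {p a} n → Prime p → p ℕ.∣ a ℕ.^ n → p ℕ.∣ a
prime∣^⇒∣ zero pp p∣1 = contradiction p∣1 (ℕ.>⇒∤ (prime>1 pp))
prime∣^⇒∣ {a = a} (suc n) pp p∣ with euclidsLemma a (a ℕ.^ n) pp p∣
... | inj₁ p∣a = p∣a
... | inj₂ p∣aⁿ = prime∣^⇒∣ n pp p∣aⁿ

prime∣!⇒≤ : ∀ {p} n → Prime p → p ℕ.∣ n ! → p ℕ.≤ n
prime∣!⇒≤ zero pp p∣1 = contradiction p∣1 (ℕ.>⇒∤ (prime>1 pp))
prime∣!⇒≤ (suc n) pp p∣ with euclidsLemma (suc n) (n !) pp p∣
... | inj₁ p∣1+n = ℕ.∣⇒≤ p∣1+n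
... | inj₂ p∣n! = ℕ.m≤n⇒m≤1+n (prime∣!⇒≤ n pp p∣n!)

nCk*k!*[n∸k]!≡n! : ∀ {n k} → k ℕ.≤ n → (n C k) ℕ.* (k ! ℕ.* (n ℕ.∸ k) !) ≡ n !
nCk*k!*[n∸k]!≡n! {n} {k} k≤n = ≡.trans
  (≡.cong (ℕ._* (k ! ℕ.* (n ℕ.∸ k) !)) (nCk≡n!/k![n-k]! k≤n))
  (m/n*n≡m {{ℕ._!*_!≢0 k (n ℕ.∸ k)}} (k![n∸k]!∣n! k≤n))
  where
  instance _ = ℕ._!*_!≢0 k (n ℕ.∸ k)

prime∣! : ∀ {p} → Prime p → p ℕ.∣ p !
prime∣! {zero} pp = contradiction (prime>1 pp) λ ()
prime∣! {suc n} pp = ℕ.m∣m*n (n !)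

prime∣binomial : ∀ {p} k → Prime p → 0 ℕ.< k → k ℕ.< p → p ℕ.∣ p C k
prime∣binomial {p} k pp 0<k k<p
  with euclidsLemma (p C k) (k ! ℕ.* (p ℕ.∸ k) !) pp
         (≡.subst (p ℕ.∣_) (≡.sym (nCk*k!*[n∸k]!≡n! (ℕ.<⇒≤ k<p))) (prime∣! pp))
... | inj₁ p∣C = p∣C
... | inj₂ p∣k!l! with euclidsLemma (k !) ((p ℕ.∸ k) !) pp p∣k!l!
...   | inj₁ p∣k! = contradiction (prime∣!⇒≤ k pp p∣k!) (ℕ.<⇒≱ k<p)
...   | inj₂ p∣l! = contradiction (prime∣!⇒≤ (p ℕ.∸ k) pp p∣l!)
                      (ℕ.<⇒≱ (ℕ.∸-monoʳ-< {p} {k} {0} 0<k (ℕ.<⇒≤ k<p)))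

-- Finite sums in a commutative semiring.

module Sums {c ℓ} (S : CommutativeSemiring c ℓ) where

  open CommutativeSemiring S
  open SemiringSum semiring using (sum)
  open CommutativeSemigroupProperties +-commutativeSemigroup using (interchange)
  open import Relation.Binary.Reasoning.Setoid setoid

  ∑< : ℕ → (ℕ → Carrier) → Carrier
  ∑< zero    f = 0#
  ∑< (suc n) f = f 0 + ∑< n (f ∘ suc)

  sum≡∑< : ∀ n f → sum {n} (f ∘ toℕ) ≡ ∑< n f
  sum≡∑< zero f = ≡.refl
  sum≡∑< (suc n) f = ≡.cong (λ s → f 0 + s) (sum≡∑< n (f ∘ suc))

  ∑-cong : ∀ n {f g} → (∀ i → i ℕ.< n → f i ≈ g i) → ∑< n f ≈ ∑< n g
  ∑-cong zero f≈g = refl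
  ∑-cong (suc n) f≈g =
    +-cong (f≈g 0 (s≤s z≤n)) (∑-cong n (λ i i<n → f≈g (suc i) (s≤s i<n)))

  ∑-zero : ∀ n {f} → (∀ i → i ℕ.< n → f i ≈ 0#) → ∑< n f ≈ 0#
  ∑-zero zero f≈0 = refl
  ∑-zero (suc n) f≈0 = trans
    (+-cong (f≈0 0 (s≤s z≤n)) (∑-zero n (λ i i<n → f≈0 (suc i) (s≤s i<n))))
    (+-identityˡ 0#)

  ∑-+ : ∀ n f g → ∑< n (λ i → f i + g i) ≈ ∑< n f + ∑< n g
  ∑-+ zero f g = sym (+-identityˡ 0#)
  ∑-+ (suc n) f g = trans (+-congˡ (∑-+ n (f ∘ suc) (g ∘ suc))) (interchange _ _ _ _)

  ∑-*ˡ : ∀ n x f → x * ∑< n f ≈ ∑< n (λ i → x * f i)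
  ∑-*ˡ zero x f = zeroʳ x
  ∑-*ˡ (suc n) x f = trans (distribˡ x _ _) (+-congˡ (∑-*ˡ n x (f ∘ suc)))

  ∑-swap : ∀ m n (f : ℕ → ℕ → Carrier) →
           ∑< m (λ i → ∑< n (λ j → f i j)) ≈ ∑< n (λ j → ∑< m (λ i → f i j))
  ∑-swap zero n f = sym (∑-zero n (λ _ _ → refl))
  ∑-swap (suc m) n f =
    trans (+-congˡ (∑-swap m n (f ∘ suc))) (sym (∑-+ n (f 0) _))

  ∑-last : ∀ n f → ∑< (suc n) f ≈ ∑< n f + f n
  ∑-last zero f = +-comm (f 0) 0#
  ∑-last (suc n) f = trans (+-congˡ (∑-last n (f ∘ suc))) (sym (+-assoc _ _ _))

  -- Shifting by one drops the first term and adds the term at `n`, which equals it by periodicity.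
  -- Two shifted rows thus have the same sum of exponents.
  ∑-rotate : ∀ n k f → (∀ i → f (i ℕ.+ n) ≈ f i) → ∑< n (λ i → f (i ℕ.+ k)) ≈ ∑< n f
  ∑-rotate n zero f per = ∑-cong n (λ i _ → reflexive (≡.cong f (ℕ.+-identityʳ i)))
  ∑-rotate n (suc k) f per = trans
    (∑-cong n (λ i _ → reflexive (≡.cong f (ℕ.+-suc i k))))
    (trans (step n (λ i → f (i ℕ.+ k)) (trans (reflexive (≡.cong f (ℕ.+-comm n k))) (per k)))
           (∑-rotate n k f per))
    where
    step : ∀ n g → g n ≈ g 0 → ∑< n (g ∘ suc) ≈ ∑< n g
    step zero g _ = refl
    step (suc n) g gn≈g0 = begin
      ∑< (suc n) (g ∘ suc)            ≈⟨ ∑-last n (g ∘ suc) ⟩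
      ∑< n (g ∘ suc) + g (suc n)      ≈⟨ +-comm _ _ ⟩
      g (suc n) + ∑< n (g ∘ suc)      ≈⟨ +-congʳ gn≈g0 ⟩
      g 0 + ∑< n (g ∘ suc)            ∎

  δ : ℕ → ℕ → Carrier
  δ zero    zero    = 1#
  δ zero    (suc j) = 0#
  δ (suc i) zero    = 0#
  δ (suc i) (suc j) = δ i j

  δ-diag : ∀ i → δ i i ≡ 1#
  δ-diag zero = ≡.refl
  δ-diag (suc i) = δ-diag i

  δ-off : ∀ {i j} → i ≢ j → δ i j ≡ 0#
  δ-off {zero} {zero} i≢j = contradiction ≡.refl i≢j
  δ-off {zero} {suc j} _ = ≡.refl
  δ-off {suc i} {zero} _ = ≡.refl
  δ-off {suc i} {suc j} i≢j = δ-off (i≢j ∘ ≡.cong suc)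

  ∑-δ : ∀ {q i} → i ℕ.< q → ∀ (g : ℕ → Carrier) → ∑< q (λ j → δ i j * g j) ≈ g i
  ∑-δ {suc q} {zero} _ g = begin
    1# * g 0 + ∑< q (λ j → 0# * g (suc j)) ≈⟨ +-cong (*-identityˡ _) (∑-zero q {λ j → 0# * g (suc j)} (λ j _ → zeroˡ (g (suc j)))) ⟩
    g 0 + 0#                               ≈⟨ +-identityʳ _ ⟩
    g 0                                    ∎
  ∑-δ {suc q} {suc i} (s≤s i<q) g = begin
    0# * g 0 + ∑< q (λ j → δ i j * g (suc j)) ≈⟨ +-cong (zeroˡ _) (∑-δ i<q (g ∘ suc)) ⟩
    0# + g (suc i)                            ≈⟨ +-identityˡ _ ⟩
    g (suc i)                                 ∎

-- Counting: the fibres of `Y` and the sums of `X` over them.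

module Counting where

  open ≡.≡-Reasoning
  open Sums ℕ.+-*-commutativeSemiring

  -- Restricted to an odd number of terms, for which the sum is a multiple of that number.
  gauss : ∀ m → ∑< (1 ℕ.+ 2 ℕ.* m) id ≡ (1 ℕ.+ 2 ℕ.* m) ℕ.* m
  gauss zero = ≡.refl
  gauss (suc m) = begin
    ∑< (1 ℕ.+ 2 ℕ.* suc m) id
      ≡⟨ ≡.cong (λ k → ∑< k id) 2[1+m]≡ ⟩
    ∑< (suc (suc s)) id
      ≡⟨ ≡.trans (∑-last (suc s) id) (≡.cong (ℕ._+ suc s) (∑-last s id)) ⟩
    ∑< s id ℕ.+ s ℕ.+ suc s
      ≡⟨ ≡.cong (λ t → t ℕ.+ s ℕ.+ suc s) (gauss m) ⟩
    s ℕ.* m ℕ.+ s ℕ.+ suc s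
      ≡⟨ solve 1 (λ m → (con 1 :+ con 2 :* m) :* m :+ (con 1 :+ con 2 :* m) :+ (con 1 :+ (con 1 :+ con 2 :* m))
           := (con 1 :+ con 2 :* (con 1 :+ m)) :* (con 1 :+ m)) ≡.refl m ⟩
    (1 ℕ.+ 2 ℕ.* suc m) ℕ.* suc m ∎
    where
    open ℕ-Solver
    s = 1 ℕ.+ 2 ℕ.* m
    2[1+m]≡ : 1 ℕ.+ 2 ℕ.* suc m ≡ suc (suc s)
    2[1+m]≡ = solve 1 (λ m → con 1 :+ con 2 :* (con 1 :+ m) := con 2 :+ (con 1 :+ con 2 :* m)) ≡.refl m

  ∑≡0⇒≡0 : ∀ n {f} → ∑< n f ≡ 0 → ∀ {i} → i ℕ.< n → f i ≡ 0
  ∑≡0⇒≡0 (suc n) {f} eq {zero} _ = ℕ.m+n≡0⇒m≡0 (f 0) eq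
  ∑≡0⇒≡0 (suc n) {f} eq {suc i} (s≤s i<n) = ∑≡0⇒≡0 n (ℕ.m+n≡0⇒n≡0 (f 0) eq) i<n

  ∑≡1⇒δ : ∀ n {f} → ∑< n f ≡ 1 → ∃[ i₀ ] i₀ ℕ.< n × (∀ {i} → i ℕ.< n → f i ≡ δ i₀ i)
  ∑≡1⇒δ (suc n) {f} eq with f 0 in f0
  ... | zero = let i₀ , i₀<n , f≡δ = ∑≡1⇒δ n eq in
    suc i₀ , s≤s i₀<n , λ { {zero} _ → f0 ; {suc i} (s≤s i<n) → f≡δ i<n }
  ... | suc zero = 0 , s≤s z≤n ,
    λ { {zero} _ → f0 ; {suc i} (s≤s i<n) → ∑≡0⇒≡0 n (ℕ.suc-injective eq) i<n }
  ... | suc (suc _) = contradiction (ℕ.suc-injective eq) λ ()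

  ∑-mod : ∀ n (f : ℕ → ℕ) {d b} → (∀ {i} → i ℕ.< n → d ℤ.∣ + f i ℤ.- b) →
          d ℤ.∣ + ∑< n f ℤ.- + n ℤ.* b
  ∑-mod zero f {d} {b} _ = ℤ.divides (+ 0) ≡.refl
  ∑-mod (suc n) f {d} {b} d∣ = ≡.subst (d ℤ.∣_)
    (solve 4 (λ a s n b → (a :- b) :+ (s :- n :* b) := (a :+ s) :- (con (+ 1) :+ n) :* b)
      ≡.refl (+ f 0) (+ ∑< n (f ∘ suc)) (+ n) b)
    (ℤ.∣m∣n⇒∣m+n (d∣ {0} (s≤s z≤n)) (∑-mod n (f ∘ suc) (λ i<n → d∣ (s≤s i<n))))
    where open ℤ-Solver

  -- These are the coefficients of Σ r c * η ^ Y c after equal powers of η are collected. Weight 1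
  -- gives the size of a fibre, weight `X` its moment.
  fibre : ℕ → (ℕ → ℕ) → (ℕ → ℕ) → ℕ → ℕ
  fibre n Y r y = ∑< n (λ c → δ (Y c) y ℕ.* r c)

  ∑-fibre : ∀ n {q} (Y r g : ℕ → ℕ) → (∀ c → Y c ℕ.< q) →
            ∑< q (λ y → g y ℕ.* fibre n Y r y) ≡ ∑< n (λ c → r c ℕ.* g (Y c))
  ∑-fibre n {q} Y r g Y<q = begin
    ∑< q (λ y → g y ℕ.* fibre n Y r y)
      ≡⟨ ∑-cong q (λ y _ → ∑-*ˡ n (g y) _) ⟩
    ∑< q (λ y → ∑< n (λ c → g y ℕ.* (δ (Y c) y ℕ.* r c)))
      ≡⟨ ∑-swap q n _ ⟩
    ∑< n (λ c → ∑< q (λ y → g y ℕ.* (δ (Y c) y ℕ.* r c)))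
      ≡⟨ ∑-cong n (λ c _ → ∑-cong q (λ y _ →
           solve 3 (λ a b c → a :* (b :* c) := b :* (c :* a)) ≡.refl (g y) (δ (Y c) y) (r c))) ⟩
    ∑< n (λ c → ∑< q (λ y → δ (Y c) y ℕ.* (r c ℕ.* g y)))
      ≡⟨ ∑-cong n (λ c _ → ∑-δ (Y<q c) (λ y → r c ℕ.* g y)) ⟩
    ∑< n (λ c → r c ℕ.* g (Y c)) ∎
    where open ℕ-Solver

  fibre-singleton : ∀ n Y r {c} → c ℕ.< n →
                    fibre n Y (λ _ → 1) (Y c) ≡ 1 → fibre n Y r (Y c) ≡ r c
  fibre-singleton n Y r {c} c<n eq = collapse (∑≡1⇒δ n eq)
    where
    δ≡1⇒≡ : ∀ i j → δ i j ≡ 1 → i ≡ j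
    δ≡1⇒≡ zero zero _ = ≡.refl
    δ≡1⇒≡ (suc i) (suc j) eq = ≡.cong suc (δ≡1⇒≡ i j eq)
    collapse : (∃[ c₀ ] c₀ ℕ.< n × (∀ {i} → i ℕ.< n → δ (Y i) (Y c) ℕ.* 1 ≡ δ c₀ i)) →
               fibre n Y r (Y c) ≡ r c
    collapse (c₀ , c₀<n , χ≡δ) = begin
      ∑< n (λ i → δ (Y i) (Y c) ℕ.* r i)
        ≡⟨ ∑-cong n (λ i i<n → ≡.cong (ℕ._* r i) (≡.trans (≡.sym (ℕ.*-identityʳ (δ (Y i) (Y c)))) (χ≡δ i<n))) ⟩
      ∑< n (λ i → δ c₀ i ℕ.* r i)
        ≡⟨ ∑-δ c₀<n r ⟩
      r c₀
        ≡⟨ ≡.cong r (δ≡1⇒≡ c₀ c (≡.trans (≡.sym (χ≡δ c<n))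
             (≡.trans (ℕ.*-identityʳ _) (δ-diag (Y c))))) ⟩
      r c ∎

  ∣∑-% : ∀ n q .{{_ : ℕ.NonZero q}} f → q ℕ.∣ ∑< n f → q ℕ.∣ ∑< n (λ c → f c % q)
  ∣∑-% n q f q∣ = ℕ.∣m+n∣m⇒∣n
    (≡.subst (q ℕ.∣_) (begin
      ∑< n f
        ≡⟨ ∑-cong n (λ c _ → ≡.trans (m≡m%n+[m/n]*n (f c) q)
             (≡.trans (ℕ.+-comm (f c % q) _) (≡.cong (ℕ._+ f c % q) (ℕ.*-comm (f c / q) q)))) ⟩
      ∑< n (λ c → q ℕ.* (f c / q) ℕ.+ f c % q)
        ≡⟨ ∑-+ n _ _ ⟩
      ∑< n (λ c → q ℕ.* (f c / q)) ℕ.+ ∑< n (λ c → f c % q)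
        ≡⟨ ≡.cong (ℕ._+ ∑< n (λ c → f c % q)) (∑-*ˡ n q (λ c → f c / q)) ⟨
      q ℕ.* ∑< n (λ c → f c / q) ℕ.+ ∑< n (λ c → f c % q) ∎) q∣)
    (ℕ.m∣m*n _)

  module _ {p q} (pp : Prime p) (qp : Prime q) (p∤q : ¬ p ℕ.∣ q) (q∤p : ¬ q ℕ.∣ p)
    (X Y : ℕ → ℕ) (Y<q : ∀ c → Y c ℕ.< q)
    (columns : ∀ {y} → y ℕ.< q → (+ p) ℤ.∣
      + fibre (p ℕ.+ q) Y (λ _ → 1) y ℤ.- + fibre (p ℕ.+ q) Y (λ _ → 1) (ℕ.pred q))
    (moments : ∀ {y} → y ℕ.< q → (+ p) ℤ.∣
      + fibre (p ℕ.+ q) Y X y ℤ.- + fibre (p ℕ.+ q) Y X (ℕ.pred q))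
    (p∣∑X : p ℕ.∣ ∑< (p ℕ.+ q) X) (q∣∑Y : q ℕ.∣ ∑< (p ℕ.+ q) Y)
    (m : ℕ) (q-odd : q ≡ 1 ℕ.+ 2 ℕ.* m) where

    private
      instance _ = prime⇒nonZero pp
      n = p ℕ.+ q
      F M : ℕ → ℕ
      F = fibre n Y (λ _ → 1)
      M = fibre n Y X
      open ℤ-Solver

      ∑fibre : ∀ r → ∑< q (fibre n Y r) ≡ ∑< n r
      ∑fibre r = ≡.trans (∑-cong q (λ y _ → ≡.sym (ℕ.*-identityˡ _)))
        (≡.trans (∑-fibre n Y r (λ _ → 1) Y<q) (∑-cong n (λ c _ → ℕ.*-identityʳ (r c))))

      ∑1 : ∀ k → ∑< k (λ _ → 1) ≡ k
      ∑1 zero = ≡.refl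
      ∑1 (suc k) = ≡.cong suc (∑1 k)

      p∣q*⇒∣ : ∀ i → (+ p) ℤ.∣ + q ℤ.* i → (+ p) ℤ.∣ i
      p∣q*⇒∣ i d with euclidsLemma q ℤ.∣ i ∣ pp (≡.subst (p ℕ.∣_) (ℤ.abs-* (+ q) i) (ℤ.∣⇒∣ᵤ d))
      ... | inj₁ p∣q = contradiction p∣q p∤q
      ... | inj₂ p∣i = ℤ.∣ᵤ⇒∣ p∣i

      -- Modulo `p` the `q` fibre sizes share one residue F₀; their sum p + q gives q F₀ ≡ q, and
      -- `q` cancels.
      p∣F-1 : ∀ {y} → y ℕ.< q → (+ p) ℤ.∣ + F y ℤ.- + 1
      p∣F-1 {y} y<q = ≡.subst ((+ p) ℤ.∣_)
        (solve 2 (λ a b → (a :- b) :+ (b :- con (+ 1)) := a :- con (+ 1)) ≡.refl (+ F y) F₀)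
        (ℤ.∣m∣n⇒∣m+n (columns y<q) (p∣q*⇒∣ (F₀ ℤ.- + 1) (≡.subst ((+ p) ℤ.∣_)
          (≡.trans
            (≡.cong (λ s → + p ℤ.- (+ s ℤ.- + q ℤ.* F₀)) (≡.trans (∑fibre (λ _ → 1)) (∑1 n)))
            (solve 3 (λ p q f → p :- ((p :+ q) :- q :* f) := q :* (f :- con (+ 1))) ≡.refl (+ p) (+ q) F₀))
          (ℤ.∣m∣n⇒∣m-n ℤ.∣-refl (∑-mod q F {+ p} {F₀} columns)))))
        where F₀ = + F (ℕ.pred q)

      -- The same averaging: `q` times the common residue is the sum of `X`, which is 0 modulo `p`.
      p∣M : ∀ {y} → y ℕ.< q → p ℕ.∣ M y
      p∣M {y} y<q = ℤ.∣⇒∣ᵤ (≡.subst ((+ p) ℤ.∣_)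
        (solve 2 (λ a b → (a :- b) :+ b := a) ≡.refl (+ M y) M₀)
        (ℤ.∣m∣n⇒∣m+n (moments y<q) (p∣q*⇒∣ M₀ (≡.subst ((+ p) ℤ.∣_)
          (solve 2 (λ s t → s :- (s :- t) := t) ≡.refl (+ ∑< q M) (+ q ℤ.* M₀))
          (ℤ.∣m∣n⇒∣m-n (ℤ.∣ᵤ⇒∣ {+ p} {+ ∑< q M} (≡.subst (p ℕ.∣_) (≡.sym (∑fibre X)) p∣∑X)) (∑-mod q M {+ p} {M₀} moments))))))
        where M₀ = + M (ℕ.pred q)

      excess : ∀ {k} → (+ p) ℤ.∣ + k ℤ.- + 1 → k ≡ 1 ℕ.+ p ℕ.* (ℕ.pred k / p)
      -- No fibre is empty, since 0 ≡ 1 modulo `p` is impossible.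
      excess {zero} d = contradiction (ℤ.∣⇒∣ᵤ d) (ℕ.>⇒∤ (prime>1 pp))
      excess {suc k} d = ≡.cong suc (≡.sym (m*[n/m]≡n (ℤ.∣⇒∣ᵤ d)))

      g : ℕ → ℕ
      g y = ℕ.pred (F y) / p

      F≡ : ∀ y → y ℕ.< q → F y ≡ 1 ℕ.+ p ℕ.* g y
      F≡ y y<q = excess (p∣F-1 y<q)

      -- The fibre sizes 1 + p * g y add up to p + q, which leaves room for exactly one surplus of
      -- `p`.
      ∑g≡1 : ∑< q g ≡ 1
      ∑g≡1 = ℕ.*-cancelˡ-≡ _ _ p (ℕ.+-cancelˡ-≡ q _ _ (begin
        q ℕ.+ p ℕ.* ∑< q g
          ≡⟨ ≡.cong₂ ℕ._+_ (≡.sym (∑1 q)) (∑-*ˡ q p g) ⟩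
        ∑< q (λ _ → 1) ℕ.+ ∑< q (λ y → p ℕ.* g y)
          ≡⟨ ∑-+ q _ _ ⟨
        ∑< q (λ y → 1 ℕ.+ p ℕ.* g y)
          ≡⟨ ∑-cong q F≡ ⟨
        ∑< q F
          ≡⟨ ≡.trans (∑fibre (λ _ → 1)) (∑1 n) ⟩
        p ℕ.+ q
          ≡⟨ ≡.trans (ℕ.+-comm p q) (≡.cong (q ℕ.+_) (≡.sym (ℕ.*-identityʳ p))) ⟩
        q ℕ.+ p ℕ.* 1 ∎))

      g≡δ : ∃[ y₀ ] y₀ ℕ.< q × (∀ {y} → y ℕ.< q → g y ≡ δ y₀ y)
      g≡δ = ∑≡1⇒δ q ∑g≡1

      y₀ = proj₁ g≡δ

      -- Each value below `q` is taken once, and `y₀` another `p` times. Modulo `q` only p * y₀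
      -- survives, so that the divisibility of the sum determines `y₀`.
      ∑Y≡ : ∑< n Y ≡ q ℕ.* m ℕ.+ p ℕ.* y₀
      ∑Y≡ = begin
        ∑< n Y
          ≡⟨ ∑-cong n (λ c _ → ℕ.*-identityˡ (Y c)) ⟨
        ∑< n (λ c → 1 ℕ.* Y c)
          ≡⟨ ∑-fibre n Y (λ _ → 1) id Y<q ⟨
        ∑< q (λ y → y ℕ.* F y)
          ≡⟨ ∑-cong q (λ y y<q → ≡.trans
               (≡.cong (y ℕ.*_) (≡.trans (F≡ y y<q) (≡.cong (λ k → 1 ℕ.+ p ℕ.* k) (proj₂ (proj₂ g≡δ) y<q))))
               (solveℕ 3 (λ y p d → y ⊛ (κ 1 ⊕ p ⊛ d) ≔ y ⊕ p ⊛ (d ⊛ y)) ≡.refl y p (δ y₀ y))) ⟩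
        ∑< q (λ y → y ℕ.+ p ℕ.* (δ y₀ y ℕ.* y))
          ≡⟨ ∑-+ q id _ ⟩
        ∑< q id ℕ.+ ∑< q (λ y → p ℕ.* (δ y₀ y ℕ.* y))
          ≡⟨ ≡.cong₂ ℕ._+_ (≡.subst (λ k → ∑< k id ≡ k ℕ.* m) (≡.sym q-odd) (gauss m))
               (≡.trans (≡.sym (∑-*ˡ q p (λ y → δ y₀ y ℕ.* y))) (≡.cong (p ℕ.*_) (∑-δ (proj₁ (proj₂ g≡δ)) id))) ⟩
        q ℕ.* m ℕ.+ p ℕ.* y₀ ∎
        where
        open ℕ-Solver using () renaming (solve to solveℕ; _:+_ to _⊕_; _:*_ to _⊛_; _:=_ to _≔_; con to κ)

      y₀≡0 : y₀ ≡ 0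
      y₀≡0 = small y₀ (proj₁ (proj₂ g≡δ))
        (euclidsLemma p y₀ qp (ℕ.∣m+n∣m⇒∣n (≡.subst (q ℕ.∣_) ∑Y≡ q∣∑Y) (ℕ.m∣m*n m)))
        where
        small : ∀ y → y ℕ.< q → q ℕ.∣ p ⊎ q ℕ.∣ y → y ≡ 0
        small zero _ _ = ≡.refl
        small (suc y) _ (inj₁ q∣p) = contradiction q∣p q∤p
        small (suc y) y<q (inj₂ q∣y) = contradiction q∣y (ℕ.>⇒∤ y<q)

      F≡1 : ∀ {y} → y ℕ.< q → y ≢ 0 → F y ≡ 1
      F≡1 {y} y<q y≢0 = begin
        F y                     ≡⟨ F≡ y y<q ⟩
        1 ℕ.+ p ℕ.* g y         ≡⟨ ≡.cong (λ k → 1 ℕ.+ p ℕ.* k) (proj₂ (proj₂ g≡δ) y<q) ⟩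
        1 ℕ.+ p ℕ.* δ y₀ y      ≡⟨ ≡.cong (λ k → 1 ℕ.+ p ℕ.* k) (δ-off {y₀} {y} (λ y₀≡y → y≢0 (≡.trans (≡.sym y₀≡y) y₀≡0))) ⟩
        1 ℕ.+ p ℕ.* 0           ≡⟨ ≡.cong suc (ℕ.*-zeroʳ p) ⟩
        1                       ∎

    -- Every column sum is 1, except for one that is p + 1; the sum of Y puts
    -- the exceptional column at 0.
    off-column⇒∣ : ∀ c → c ℕ.< n → Y c ≢ 0 → p ℕ.∣ X c
    off-column⇒∣ c c<n Yc≢0 = ≡.subst (p ℕ.∣_)
      (fibre-singleton n Y X c<n (F≡1 (Y<q c) Yc≢0)) (p∣M (Y<q c))

-- Subrings, polynomial functions and divisibility in a commutative ring.

module Subrings (K : CommutativeRing 0ℓ 0ℓ) where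

  open CommutativeRing K hiding (zero)
  open RingProperties ring using (-0#≈0#; -‿+-comm; -‿distribˡ-*; -‿distribʳ-*; -‿involutive)
  open Exp semiring using (_^_; ^-congˡ; ^-congʳ; ^-homo-*; ^-assocʳ)
  open import Relation.Binary.Reasoning.Setoid setoid
  open Sums commutativeSemiring

  module M = Mult semiring
  module M′ = Mult′ semiring

  -- The multiples are taken in the form in which `ι (+ 1)` computes to `1#`; the solver's constants
  -- then agree with the ring's own unit.
  ι : ℤ → Carrier
  ι (+ n)    = n M′.× 1#
  ι -[1+ n ] = - (suc n M′.× 1#)

  ι-neg : ∀ i → ι (ℤ.- i) ≈ - ι i
  ι-neg (+ zero)    = sym -0#≈0#
  ι-neg (+ (suc n)) = refl
  ι-neg -[1+ n ]    = sym (-‿involutive _)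

  ι-⊖ : ∀ m n → ι (m ℤ.⊖ n) ≈ ι (+ m) + - ι (+ n)
  ι-⊖ m zero = sym (trans (+-congˡ -0#≈0#) (+-identityʳ _))
  ι-⊖ zero (suc n) = sym (+-identityˡ _)
  ι-⊖ (suc m) (suc n) = begin
    ι (suc m ℤ.⊖ suc n)                       ≡⟨ ≡.cong ι (ℤ.[1+m]⊖[1+n]≡m⊖n m n) ⟩
    ι (m ℤ.⊖ n)                               ≈⟨ ι-⊖ m n ⟩
    ι (+ m) + - ι (+ n)                       ≈⟨ +-congʳ (+-identityˡ _) ⟨
    0# + ι (+ m) + - ι (+ n)                  ≈⟨ +-congʳ (+-congʳ (-‿inverseʳ 1#)) ⟨
    1# + - 1# + ι (+ m) + - ι (+ n)           ≈⟨ +-congʳ (trans (+-assoc _ _ _) (trans (+-congˡ (+-comm _ _)) (sym (+-assoc _ _ _)))) ⟩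
    1# + ι (+ m) + - 1# + - ι (+ n)           ≈⟨ +-assoc _ _ _ ⟩
    1# + ι (+ m) + (- 1# + - ι (+ n))         ≈⟨ +-congˡ (-‿+-comm _ _) ⟩
    1# + ι (+ m) + - (1# + ι (+ n))           ≈⟨ +-cong (sym (M′.1+× m 1#)) (-‿cong (sym (M′.1+× n 1#))) ⟩
    ι (+ suc m) + - ι (+ suc n)               ∎

  ι-+ : ∀ i j → ι (i ℤ.+ j) ≈ ι i + ι j
  ι-+ (+ m)    (+ n)    = M′.×-homo-+ 1# m n
  ι-+ (+ m)    -[1+ n ] = ι-⊖ m (suc n)
  ι-+ -[1+ m ] (+ n)    = trans (ι-⊖ n (suc m)) (+-comm _ _)
  ι-+ -[1+ m ] -[1+ n ] = begin
    - ι (+ (suc (suc (m ℕ.+ n))))   ≡⟨ ≡.cong (λ k → - ι (+ suc k)) (ℕ.+-suc m n) ⟨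
    - ι (+ (suc m ℕ.+ suc n))       ≈⟨ -‿cong (M′.×-homo-+ 1# (suc m) (suc n)) ⟩
    - (ι (+ suc m) + ι (+ suc n))   ≈⟨ -‿+-comm _ _ ⟨
    - ι (+ suc m) + - ι (+ suc n)   ∎

  ι-*⁺ : ∀ m j → ι (+ m ℤ.* j) ≈ ι (+ m) * ι j
  ι-*⁺ m (+ n) = trans (reflexive (≡.cong ι (≡.sym (ℤ.pos-* m n)))) (M′.×1-homo-* m n)
  ι-*⁺ m -[1+ n ] = begin
    ι (+ m ℤ.* -[1+ n ])           ≡⟨ ≡.cong ι (ℤ.neg-distribʳ-* (+ m) (+ suc n)) ⟨
    ι (ℤ.- (+ m ℤ.* + suc n))      ≈⟨ ι-neg (+ m ℤ.* + suc n) ⟩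
    - ι (+ m ℤ.* + suc n)          ≈⟨ -‿cong (ι-*⁺ m (+ suc n)) ⟩
    - (ι (+ m) * ι (+ suc n))      ≈⟨ -‿distribʳ-* _ _ ⟩
    ι (+ m) * ι -[1+ n ]           ∎

  ι-* : ∀ i j → ι (i ℤ.* j) ≈ ι i * ι j
  ι-* (+ m) j = ι-*⁺ m j
  ι-* -[1+ m ] j = begin
    ι (-[1+ m ] ℤ.* j)       ≡⟨ ≡.cong ι (ℤ.neg-distribˡ-* (+ suc m) j) ⟨
    ι (ℤ.- (+ suc m ℤ.* j))  ≈⟨ ι-neg (+ suc m ℤ.* j) ⟩
    - ι (+ suc m ℤ.* j)      ≈⟨ -‿cong (ι-*⁺ (suc m) j) ⟩
    - (ι (+ suc m) * ι j)    ≈⟨ -‿distribˡ-* _ _ ⟩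
    ι -[1+ m ] * ι j         ∎

  ι-morphism : ℤ.+-*-rawRing -Raw-AlmostCommutative⟶ fromCommutativeRing K
  ι-morphism = record
    { ⟦_⟧ = ι ; +-homo = ι-+ ; *-homo = ι-* ; -‿homo = ι-neg ; 0-homo = refl ; 1-homo = refl }

  ι-≟ : ∀ i j → Maybe (ι i ≈ ι j)
  ι-≟ i j = Maybe.map (reflexive ∘ ≡.cong ι) (dec⇒maybe (i ℤ.≟ j))

  open RingSolver ℤ.+-*-rawRing (fromCommutativeRing K) ι-morphism ι-≟ public
    using (solve; _:=_; _:+_; _:*_; _:-_; :-_; con)

  ι-^ : ∀ i n → ι (i ℤ.^ n) ≈ ι i ^ n
  ι-^ i zero = refl
  ι-^ i (suc n) = trans (ι-* i (i ℤ.^ n)) (*-congˡ (ι-^ i n))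

  ×≈ι* : ∀ n x → n M.× x ≈ ι (+ n) * x
  ×≈ι* n x = begin
    n M.× x            ≈⟨ M.×-congʳ n (*-identityˡ x) ⟨
    n M.× (1# * x)     ≈⟨ M.×-assoc-* n 1# x ⟨
    (n M.× 1#) * x     ≈⟨ *-congʳ (M′.×ᵤ≈× n 1#) ⟩
    ι (+ n) * x        ∎

  ι-suc : ∀ n → ι (+ suc n) ≈ 1# + ι (+ n)
  ι-suc n = M′.1+× n 1#

  1^n≈1 : ∀ n → 1# ^ n ≈ 1#
  1^n≈1 zero = refl
  1^n≈1 (suc n) = trans (*-identityˡ _) (1^n≈1 n)

  ^-comm : ∀ x m n → (x ^ m) ^ n ≈ (x ^ n) ^ m
  ^-comm x m n = trans (^-assocʳ x m n)
    (trans (^-congʳ x (ℕ.*-comm m n)) (sym (^-assocʳ x n m)))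

  ∑-const : ∀ n x → ∑< n (λ _ → x) ≈ ι (+ n) * x
  ∑-const zero x = sym (zeroˡ x)
  ∑-const (suc n) x = begin
    x + ∑< n (λ _ → x)     ≈⟨ +-cong (sym (*-identityˡ x)) (∑-const n x) ⟩
    1# * x + ι (+ n) * x   ≈⟨ distribʳ x 1# _ ⟨
    (1# + ι (+ n)) * x     ≈⟨ *-congʳ (ι-suc n) ⟨
    ι (+ suc n) * x        ∎

  binomial-theorem : ∀ n x y →
    (x + y) ^ n ≈ ∑< (suc n) (λ k → (n C k) M.× (x ^ k * y ^ (n ℕ.∸ k)))
  binomial-theorem n x y = trans (Binomial.theorem commutativeSemiring n x y)
    (reflexive (sum≡∑< (suc n) (λ k → (n C k) M.× (x ^ k * y ^ (n ℕ.∸ k)))))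

  record IsSubring (R : Carrier → Set) : Set where
    field
      resp : ∀ {x y} → x ≈ y → R x → R y
      1∈   : R 1#
      +∈   : ∀ {x y} → R x → R y → R (x + y)
      *∈   : ∀ {x y} → R x → R y → R (x * y)
      -∈   : ∀ {x} → R x → R (- x)

    0∈ : R 0#
    0∈ = resp (-‿inverseʳ 1#) (+∈ 1∈ (-∈ 1∈))

    ×∈ : ∀ n → R (ι (+ n))
    ×∈ zero = 0∈
    ×∈ (suc n) = resp (sym (ι-suc n)) (+∈ 1∈ (×∈ n))

    ι∈ : ∀ i → R (ι i)
    ι∈ (+ n) = ×∈ n
    ι∈ -[1+ n ] = -∈ (×∈ (suc n))

    ^∈ : ∀ {x} n → R x → R (x ^ n)
    ^∈ zero x∈ = 1∈
    ^∈ (suc n) x∈ = *∈ x∈ (^∈ n x∈)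

  Integral : Carrier → Set
  Integral x = ∃[ i ] x ≈ ι i

  integral-subring : IsSubring Integral
  integral-subring = record
    { resp = λ x≈y (i , x≈i) → i , trans (sym x≈y) x≈i
    ; 1∈ = + 1 , refl
    ; +∈ = λ (i , x≈i) (j , y≈j) → i ℤ.+ j , trans (+-cong x≈i y≈j) (sym (ι-+ i j))
    ; *∈ = λ (i , x≈i) (j , y≈j) → i ℤ.* j , trans (*-cong x≈i y≈j) (sym (ι-* i j))
    ; -∈ = λ (i , x≈i) → ℤ.- i , trans (-‿cong x≈i) (sym (ι-neg i))
    }

  -- Polynomial functions: only their values and closure properties are needed.
  data Poly (R : Carrier → Set) : (Carrier → Carrier) → Set where
    mono : ∀ {f} r → R r → ∀ j → (∀ x → f x ≈ r * x ^ j) → Poly R f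
    plus : ∀ {f g h} → Poly R f → Poly R g → (∀ x → h x ≈ f x + g x) → Poly R h

  module Polynomials {R : Carrier → Set} (S : IsSubring R) where

    open IsSubring S

    poly-resp : ∀ {f g} → (∀ x → f x ≈ g x) → Poly R f → Poly R g
    poly-resp f≈g (mono r r∈ j eq) = mono r r∈ j (λ x → trans (sym (f≈g x)) (eq x))
    poly-resp f≈g (plus P Q eq) = plus P Q (λ x → trans (sym (f≈g x)) (eq x))

    poly-cong : ∀ {f} → Poly R f → ∀ {x y} → x ≈ y → f x ≈ f y
    poly-cong (mono r _ j eq) x≈y =
      trans (eq _) (trans (*-congˡ (^-congˡ j x≈y)) (sym (eq _)))
    poly-cong (plus P Q eq) x≈y =
      trans (eq _) (trans (+-cong (poly-cong P x≈y) (poly-cong Q x≈y)) (sym (eq _)))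

    poly-const : ∀ {r} → R r → Poly R (λ _ → r)
    poly-const r∈ = mono _ r∈ 0 (λ x → sym (*-identityʳ _))

    poly-^ : ∀ j → Poly R (λ x → x ^ j)
    poly-^ j = mono 1# 1∈ j (λ x → sym (*-identityˡ _))

    poly-var : Poly R (λ x → x)
    poly-var = mono 1# 1∈ 1 (λ x → sym (trans (*-identityˡ _) (*-identityʳ x)))

    poly-+ : ∀ {f g} → Poly R f → Poly R g → Poly R (λ x → f x + g x)
    poly-+ P Q = plus P Q (λ _ → refl)

    poly-* : ∀ {f g} → Poly R f → Poly R g → Poly R (λ x → f x * g x)
    poly-* (mono r r∈ j f≈) (mono s s∈ k g≈) = mono (r * s) (*∈ r∈ s∈) (j ℕ.+ k) λ x → begin
      _                           ≈⟨ *-cong (f≈ x) (g≈ x) ⟩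
      r * x ^ j * (s * x ^ k)     ≈⟨ solve 4 (λ r a s b → r :* a :* (s :* b) := r :* s :* (a :* b)) refl r (x ^ j) s (x ^ k) ⟩
      r * s * (x ^ j * x ^ k)     ≈⟨ *-congˡ (^-homo-* x j k) ⟨
      r * s * x ^ (j ℕ.+ k)       ∎
    poly-* P@(mono _ _ _ _) (plus Q Q′ eq) = plus (poly-* P Q) (poly-* P Q′)
      (λ x → trans (*-congˡ (eq x)) (distribˡ _ _ _))
    poly-* (plus P P′ eq) Q = plus (poly-* P Q) (poly-* P′ Q)
      (λ x → trans (*-congʳ (eq x)) (distribʳ _ _ _))

    poly-neg : ∀ {f} → Poly R f → Poly R (λ x → - f x)
    poly-neg P = poly-resp (λ x → trans (sym (-‿distribˡ-* 1# _)) (-‿cong (*-identityˡ _)))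
      (poly-* (poly-const (-∈ 1∈)) P)

    poly-∘^ : ∀ {f} a → Poly R f → Poly R (λ x → f (x ^ a))
    poly-∘^ a (mono r r∈ j eq) =
      mono r r∈ (a ℕ.* j) (λ x → trans (eq _) (*-congˡ (^-assocʳ x a j)))
    poly-∘^ a (plus P Q eq) = plus (poly-∘^ a P) (poly-∘^ a Q) (λ x → eq _)

    poly-∑ : ∀ n {f : ℕ → Carrier → Carrier} → (∀ i → i ℕ.< n → Poly R (f i)) →
             Poly R (λ x → ∑< n (λ i → f i x))
    poly-∑ zero P = poly-const 0∈
    poly-∑ (suc n) P = poly-+ (P 0 (s≤s z≤n)) (poly-∑ n (λ i i<n → P (suc i) (s≤s i<n)))

    poly-∈ : ∀ {f x} → R x → Poly R f → R (f x)
    poly-∈ x∈ (mono r r∈ j eq) = resp (sym (eq _)) (*∈ r∈ (^∈ j x∈))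
    poly-∈ x∈ (plus P Q eq) = resp (sym (eq _)) (+∈ (poly-∈ x∈ P) (poly-∈ x∈ Q))

  module Adjoin (η : Carrier) where

    open Polynomials integral-subring

    -- The witness is a polynomial and not just a value, because reduction of exponents and
    -- conjugation act on the polynomial.
    ℤ[η] : Carrier → Set
    ℤ[η] x = ∃[ f ] Poly Integral f × x ≈ f η

    subring : IsSubring ℤ[η]
    subring = record
      { resp = λ x≈y (f , P , x≈f) → f , P , trans (sym x≈y) x≈f
      ; 1∈ = _ , poly-const (IsSubring.1∈ integral-subring) , refl
      ; +∈ = λ (f , P , x≈f) (g , Q , y≈g) → _ , poly-+ P Q , +-cong x≈f y≈g
      ; *∈ = λ (f , P , x≈f) (g , Q , y≈g) → _ , poly-* P Q , *-cong x≈f y≈g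
      ; -∈ = λ (f , P , x≈f) → _ , poly-neg P , -‿cong x≈f
      }

    η^∈ : ∀ j → ℤ[η] (η ^ j)
    η^∈ j = _ , poly-^ j , refl

    η∈ : ℤ[η] η
    η∈ = _ , poly-var , refl

  infix 4 _∣_within_
  -- The quotient has to lie in `R`: in a field such as ℂ, divisibility without this condition says
  -- nothing.
  _∣_within_ : Carrier → Carrier → (Carrier → Set) → Set
  a ∣ x within R = ∃[ w ] R w × x ≈ a * w

  module Divisibility {R : Carrier → Set} (S : IsSubring R) where

    open IsSubring S

    ∣-resp : ∀ {a x y} → x ≈ y → a ∣ x within R → a ∣ y within R
    ∣-resp x≈y (w , w∈ , x≈) = w , w∈ , trans (sym x≈y) x≈

    ∣-* : ∀ {a x} → R x → a ∣ a * x within R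
    ∣-* x∈ = _ , x∈ , refl

    ∣-+ : ∀ {a x y} → a ∣ x within R → a ∣ y within R → a ∣ x + y within R
    ∣-+ (w , w∈ , x≈) (v , v∈ , y≈) =
      w + v , +∈ w∈ v∈ , trans (+-cong x≈ y≈) (sym (distribˡ _ w v))

    ∣-neg : ∀ {a x} → a ∣ x within R → a ∣ - x within R
    ∣-neg (w , w∈ , x≈) = - w , -∈ w∈ , trans (-‿cong x≈) (-‿distribʳ-* _ w)

    ∣-*ʳ : ∀ {a x y} → a ∣ x within R → R y → a ∣ x * y within R
    ∣-*ʳ (w , w∈ , x≈) y∈ = _ , *∈ w∈ y∈ , trans (*-congʳ x≈) (*-assoc _ _ _)

    ∣-0 : ∀ {a} → a ∣ 0# within R
    ∣-0 = 0# , 0∈ , sym (zeroʳ _)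

    ∣-trans : ∀ {a b x} → a ∣ b within R → b ∣ x within R → a ∣ x within R
    ∣-trans a∣b (v , v∈ , x≈) = ∣-resp (sym x≈) (∣-*ʳ a∣b v∈)

    binomialTerm-∣ : ∀ {p x} k → Prime p → 0 ℕ.< k → k ℕ.< p →
                     ∃[ c ] (p C k) M.× x ≈ ι (+ p) * (ι (+ c) * x)
    binomialTerm-∣ {p} {x} k pp 0<k k<p with prime∣binomial k pp 0<k k<p
    ... | ℕ.divides c eq = c , (begin
      (p C k) M.× x              ≈⟨ ×≈ι* (p C k) x ⟩
      ι (+ (p C k)) * x          ≡⟨ ≡.cong (λ n → ι n * x) (≡.trans (≡.cong +_ (≡.trans eq (ℕ.*-comm c p))) (ℤ.pos-* p c)) ⟩
      ι (+ p ℤ.* + c) * x        ≈⟨ *-congʳ (ι-* (+ p) (+ c)) ⟩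
      ι (+ p) * ι (+ c) * x      ≈⟨ *-assoc _ _ _ ⟩
      ι (+ p) * (ι (+ c) * x)    ∎)

    ∑∣ : ∀ n {a f} → (∀ i → i ℕ.< n → a ∣ f i within R) → a ∣ ∑< n f within R
    ∑∣ zero a∣f = ∣-0
    ∑∣ (suc n) a∣f = ∣-+ (a∣f 0 (s≤s z≤n)) (∑∣ n (λ i i<n → a∣f (suc i) (s≤s i<n)))

    frobenius-+ : ∀ {p x y} → Prime p → R x → R y →
                  ι (+ p) ∣ (x + y) ^ p - (x ^ p + y ^ p) within R
    frobenius-+ {zero} pp with prime>1 pp
    ... | ()
    frobenius-+ {suc m} {x} {y} pp x∈ y∈ =
      ∣-resp (begin
          ∑< m (T ∘ suc)
            ≈⟨ solve 3 (λ a b c → c := (b :+ (c :+ a)) :- (a :+ b)) refl _ _ _ ⟩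
          y ^ p + (∑< m (T ∘ suc) + x ^ p) - (x ^ p + y ^ p)
            ≈⟨ +-congʳ (+-cong T0 (+-congˡ Tp)) ⟨
          T 0 + (∑< m (T ∘ suc) + T p) - (x ^ p + y ^ p)
            ≈⟨ +-congʳ (+-congˡ (∑-last m (T ∘ suc))) ⟨
          T 0 + ∑< p (T ∘ suc) - (x ^ p + y ^ p)
            ≈⟨ +-congʳ (binomial-theorem p x y) ⟨
          (x + y) ^ p - (x ^ p + y ^ p) ∎)
        (∑∣ m λ i i<m → let c , eq = binomialTerm-∣ (suc i) pp (s≤s z≤n) (s≤s i<m) in
          _ , *∈ (×∈ c) (*∈ (^∈ (suc i) x∈) (^∈ (p ℕ.∸ suc i) y∈)) , eq)
      where
      p = suc m
      T : ℕ → Carrier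
      T k = (p C k) M.× (x ^ k * y ^ (p ℕ.∸ k))
      T0 : T 0 ≈ y ^ p
      T0 = trans (+-identityʳ _) (*-identityˡ _)
      Tp : T p ≈ x ^ p
      Tp = begin
        (p C p) M.× (x ^ p * y ^ (p ℕ.∸ p))
          ≡⟨ ≡.cong₂ (λ k l → k M.× (x ^ p * y ^ l)) (nCn≡1 p) (ℕ.n∸n≡0 p) ⟩
        x ^ p * 1# + 0#
          ≈⟨ trans (+-identityʳ _) (*-identityʳ _) ⟩
        x ^ p ∎

    -- All inner binomial terms carry p x, and those beyond the linear one a further factor x. Taken
    -- at x = η - 1 with the order of η as exponent, this shows how that order factors in ℤ[η].
    [1+x]^p : ∀ {p x} → Prime p → R x →
              ∃[ w ] R w × (1# + x) ^ p ≈ 1# + ι (+ p) * (x * (1# + x * w)) + x ^ p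
    [1+x]^p {zero} pp with prime>1 pp
    ... | ()
    [1+x]^p {suc zero} pp with prime>1 pp
    ... | s≤s ()
    [1+x]^p {suc (suc m)} {x} pp x∈ =
      let
        w , w∈ , rest = ∑∣ m {ι (+ p) * (x * x)} {T ∘ suc ∘ suc} λ i i<m →
          let c , eq = binomialTerm-∣ (suc (suc i)) pp (s≤s z≤n) (s≤s (s≤s i<m)) in
          _ , *∈ (×∈ c) (*∈ (^∈ i x∈) (^∈ (p ℕ.∸ suc (suc i)) 1∈)) , (begin
            T (suc (suc i))
              ≈⟨ eq ⟩
            ι (+ p) * (ι (+ c) * (x * (x * x ^ i) * 1# ^ (p ℕ.∸ suc (suc i))))
              ≈⟨ solve 5 (λ P c x a b → P :* (c :* (x :* (x :* a) :* b))
                   := P :* (x :* x) :* (c :* (a :* b))) refl (ι (+ p)) (ι (+ c)) x (x ^ i) _ ⟩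
            ι (+ p) * (x * x) * (ι (+ c) * (x ^ i * 1# ^ (p ℕ.∸ suc (suc i)))) ∎)
      in w , w∈ , (begin
        (1# + x) ^ p
          ≈⟨ ^-congˡ p (+-comm 1# x) ⟩
        (x + 1#) ^ p
          ≈⟨ binomial-theorem p x 1# ⟩
        T 0 + (T 1 + ∑< (suc m) (T ∘ suc ∘ suc))
          ≈⟨ +-cong T0 (+-cong T1 (trans (∑-last m (T ∘ suc ∘ suc)) (+-cong rest Tp))) ⟩
        1# + (ι (+ p) * x + (ι (+ p) * (x * x) * w + x ^ p))
          ≈⟨ solve 4 (λ P x w z → con (+ 1) :+ (P :* x :+ (P :* (x :* x) :* w :+ z))
               := con (+ 1) :+ P :* (x :* (con (+ 1) :+ x :* w)) :+ z) refl (ι (+ p)) x w (x ^ p) ⟩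
        1# + ι (+ p) * (x * (1# + x * w)) + x ^ p ∎)
      where
      p = suc (suc m)
      T : ℕ → Carrier
      T k = (p C k) M.× (x ^ k * 1# ^ (p ℕ.∸ k))
      T0 : T 0 ≈ 1#
      T0 = trans (+-identityʳ _) (trans (*-identityˡ _) (1^n≈1 p))
      T1 : T 1 ≈ ι (+ p) * x
      T1 = begin
        (p C 1) M.× (x * 1# * 1# ^ suc m)  ≡⟨ ≡.cong (M._× (x * 1# * 1# ^ suc m)) (nC1≡n p) ⟩
        p M.× (x * 1# * 1# ^ suc m)        ≈⟨ ×≈ι* p _ ⟩
        ι (+ p) * (x * 1# * 1# ^ suc m)    ≈⟨ *-congˡ (trans (*-cong (*-identityʳ x) (1^n≈1 (suc m))) (*-identityʳ x)) ⟩
        ι (+ p) * x                        ∎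
      Tp : T p ≈ x ^ p
      Tp = begin
        (p C p) M.× (x ^ p * 1# ^ (p ℕ.∸ p))
          ≡⟨ ≡.cong₂ (λ k l → k M.× (x ^ p * 1# ^ l)) (nCn≡1 p) (ℕ.n∸n≡0 p) ⟩
        x ^ p * 1# + 0#
          ≈⟨ trans (+-identityʳ _) (*-identityʳ _) ⟩
        x ^ p ∎

  -- Equality on ℂ is not decidable; that it is ¬¬-stable suffices, as the goal is
  -- a contradiction.
  record IsCharZeroDomain : Set where
    field
      stable   : ∀ {x y} → ¬ ¬ (x ≈ y) → x ≈ y
      *-cancel : ∀ {x y} → x * y ≈ 0# → ¬ (x ≈ 0#) → y ≈ 0#
      char0    : ∀ n → n M.× 1# ≈ 0# → n ≡ 0

-- Roots of unity of prime order in a domain of characteristic 0.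

module RootsOfUnity (K : CommutativeRing 0ℓ 0ℓ) (D : Subrings.IsCharZeroDomain K) where

  open Counting using (fibre)
  open Subrings K hiding (IsCharZeroDomain)
  open Subrings.IsCharZeroDomain D
  open CommutativeRing K hiding (zero)
  open RingProperties ring using (-0#≈0#; -‿involutive; x∙y⁻¹≈ε⇒x≈y; x≈y⇒x∙y⁻¹≈ε)
  open Exp semiring using (_^_; ^-congˡ; ^-congʳ; ^-homo-*; ^-assocʳ)
  open CommutativeExp commutativeSemiring using (^-distrib-*)
  open import Relation.Binary.Reasoning.Setoid setoid
  open Sums commutativeSemiring

  ι≈0⇒≡0 : ∀ i → ι i ≈ 0# → i ≡ + 0
  ι≈0⇒≡0 (+ n) eq = ≡.cong +_ (char0 n (trans (M′.×ᵤ≈× n 1#) eq))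
  ι≈0⇒≡0 -[1+ n ] eq = contradiction
    (char0 (suc n) (trans (M′.×ᵤ≈× (suc n) 1#)
      (trans (sym (-‿involutive _)) (trans (-‿cong eq) -0#≈0#))))
    λ ()

  ι-injective : ∀ {i j} → ι i ≈ ι j → i ≡ j
  ι-injective {i} {j} eq = ℤ.i-j≡0⇒i≡j i j (ι≈0⇒≡0 (i ℤ.- j)
    (trans (ι-+ i (ℤ.- j)) (trans (+-congˡ (ι-neg j)) (x≈y⇒x∙y⁻¹≈ε eq))))

  *-cancelˡ : ∀ {a x y} → ¬ (a ≈ 0#) → a * x ≈ a * y → x ≈ y
  *-cancelˡ {a} {x} {y} a≉0 eq = x∙y⁻¹≈ε⇒x≈y x y (*-cancel
    (trans (solve 3 (λ a x y → a :* (x :- y) := a :* x :- a :* y) refl a x y) (x≈y⇒x∙y⁻¹≈ε eq)) a≉0)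

  prime≉0 : ∀ {p} → Prime p → ¬ (ι (+ p) ≈ 0#)
  prime≉0 {p} pp eq with ≡.refl ← ℤ.+-injective (ι≈0⇒≡0 (+ p) eq) = contradiction (prime>1 pp) λ ()

  ∣m^n⇒∣m : ∀ {p} m n → Prime p → (+ p) ℤ.∣ m ℤ.^ n → (+ p) ℤ.∣ m
  ∣m^n⇒∣m {p} m n pp p∣ = ℤ.∣ᵤ⇒∣ (prime∣^⇒∣ n pp (≡.subst (p ℕ.∣_) (∣m^n∣≡ n) (ℤ.∣⇒∣ᵤ p∣)))
    where
    ∣m^n∣≡ : ∀ n → ℤ.∣ m ℤ.^ n ∣ ≡ ℤ.∣ m ∣ ℕ.^ n
    ∣m^n∣≡ zero = ≡.refl
    ∣m^n∣≡ (suc n) = ≡.trans (ℤ.abs-* m (m ℤ.^ n)) (≡.cong (ℤ.∣ m ∣ ℕ.*_) (∣m^n∣≡ n))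

  geometric : ∀ x n → (x - 1#) * ∑< n (x ^_) ≈ x ^ n - 1#
  geometric x zero = trans (zeroʳ _) (sym (-‿inverseʳ 1#))
  geometric x (suc n) = begin
    (x - 1#) * ∑< (suc n) (x ^_)
      ≈⟨ *-congˡ (∑-last n (x ^_)) ⟩
    (x - 1#) * (∑< n (x ^_) + x ^ n)
      ≈⟨ distribˡ _ _ _ ⟩
    (x - 1#) * ∑< n (x ^_) + (x - 1#) * x ^ n
      ≈⟨ +-congʳ (geometric x n) ⟩
    x ^ n - 1# + (x - 1#) * x ^ n
      ≈⟨ solve 2 (λ x a → a :- con (+ 1) :+ (x :- con (+ 1)) :* a := x :* a :- con (+ 1)) refl x (x ^ n) ⟩
    x ^ suc n - 1# ∎

  root-^ : ∀ {x} n k → x ^ n ≈ 1# → (x ^ k) ^ n ≈ 1#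
  root-^ {x} n k eq = trans (^-comm x k n) (trans (^-congˡ k eq) (1^n≈1 k))

  root-* : ∀ {x y} n → x ^ n ≈ 1# → y ^ n ≈ 1# → (x * y) ^ n ≈ 1#
  root-* {x} {y} n eq eq′ = trans (^-distrib-* x y n) (trans (*-cong eq eq′) (*-identityˡ 1#))

  ^-+* : ∀ {x n} i k → x ^ n ≈ 1# → x ^ (i ℕ.+ k ℕ.* n) ≈ x ^ i
  ^-+* {x} {n} i k eq = begin
    x ^ (i ℕ.+ k ℕ.* n)     ≈⟨ ^-homo-* x i (k ℕ.* n) ⟩
    x ^ i * x ^ (k ℕ.* n)   ≈⟨ *-congˡ (^-assocʳ x k n) ⟨
    x ^ i * (x ^ k) ^ n     ≈⟨ *-congˡ (root-^ n k eq) ⟩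
    x ^ i * 1#              ≈⟨ *-identityʳ _ ⟩
    x ^ i                   ∎

  ^-% : ∀ {x} n .{{_ : ℕ.NonZero n}} i → x ^ n ≈ 1# → x ^ i ≈ x ^ (i % n)
  ^-% {x} n i eq = trans (^-congʳ x (m≡m%n+[m/n]*n i n)) (^-+* (i % n) (i / n) eq)

  ^-∣ : ∀ {x n i} → x ^ n ≈ 1# → n ℕ.∣ i → x ^ i ≈ 1#
  ^-∣ eq (ℕ.divides k ≡.refl) = ^-+* 0 k eq

  ∑-roots : ∀ {x} n → x ^ n ≈ 1# → ¬ (x ≈ 1#) → ∑< n (x ^_) ≈ 0#
  ∑-roots {x} n eq x≉1 =
    *-cancel (trans (geometric x n) (x≈y⇒x∙y⁻¹≈ε eq)) (x≉1 ∘ x∙y⁻¹≈ε⇒x≈y x 1#)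

  module PrimitiveRoot {p} (pp : Prime p) {ζ : Carrier} (ζ^p≈1 : ζ ^ p ≈ 1#) (ζ≉1 : ¬ (ζ ≈ 1#)) where

    private instance _ = prime⇒nonZero pp

    ζ^≉1 : ∀ {j} → ¬ p ℕ.∣ j → ¬ (ζ ^ j ≈ 1#)
    ζ^≉1 {j} p∤j eq with b , e , jb≡1+ep ← inverse-mod j pp p∤j = ζ≉1 (begin
      ζ                     ≈⟨ *-identityʳ ζ ⟨
      ζ ^ 1                 ≈⟨ ^-+* 1 e ζ^p≈1 ⟨
      ζ ^ (1 ℕ.+ e ℕ.* p)   ≈⟨ ^-congʳ ζ jb≡1+ep ⟨
      ζ ^ (j ℕ.* b)         ≈⟨ ^-assocʳ ζ j b ⟨
      (ζ ^ j) ^ b           ≈⟨ ^-congˡ b eq ⟩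
      1# ^ b                ≈⟨ 1^n≈1 b ⟩
      1#                    ∎)

    -- Orthogonality of characters. The case distinction is on divisibility of `j` by `p`, so
    -- equality in `K` need not be decided.
    ∑-powers : ∀ j → ∑< p (λ a → (ζ ^ a) ^ j) ≈ ι (+ p) ⊎ ∑< p (λ a → (ζ ^ a) ^ j) ≈ 0#
    ∑-powers j with p ℕ.∣? j
    ... | yes p∣j = inj₁ (begin
      ∑< p (λ a → (ζ ^ a) ^ j)  ≈⟨ ∑-cong p (λ a _ → trans (^-comm ζ a j) (trans (^-congˡ a (^-∣ ζ^p≈1 p∣j)) (1^n≈1 a))) ⟩
      ∑< p (λ _ → 1#)           ≈⟨ ∑-const p 1# ⟩
      ι (+ p) * 1#              ≈⟨ *-identityʳ _ ⟩
      ι (+ p)                   ∎)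
    ... | no p∤j = inj₂ (trans (∑-cong p (λ a _ → ^-comm ζ a j))
                          (∑-roots p (root-^ p j ζ^p≈1) (ζ^≉1 p∤j)))

    -- The sum of (u * ζ ^ a) ^ j over `a` and `j` below `p` is computed in both orders. If `u` is
    -- no power of ζ, then no u * ζ ^ a is 1, and every sum over `j` vanishes; in the other order
    -- only j = 0 contributes, and it gives `p`. The argument only refutes, hence the double
    -- negation.
    discrete-log : ∀ {u} → u ^ p ≈ 1# → ¬ ¬ (∃[ a ] u ≈ ζ ^ a)
    discrete-log {u} u^p≈1 none = prime≉0 pp (begin
      ι (+ p)
        ≈⟨ *-identityʳ _ ⟨
      ι (+ p) * 1#
        ≈⟨ ∑-const p 1# ⟨
      ∑< p (λ _ → 1#)
        ≈⟨ ∑-cong p (λ a _ → sym (*-identityˡ _)) ⟩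
      ∑< p (λ a → 1# * (ζ ^ a) ^ 0)
        ≈⟨ +-identityʳ _ ⟨
      ∑< p (λ a → u ^ 0 * (ζ ^ a) ^ 0) + 0#
        ≈⟨ +-congˡ (sym (∑-zero n (λ j j<n → nonconstant j j<n))) ⟩
      ∑< (suc n) (λ j → ∑< p (λ a → u ^ j * (ζ ^ a) ^ j))
        ≡⟨ ≡.cong (λ k → ∑< k (λ j → ∑< p (λ a → u ^ j * (ζ ^ a) ^ j))) (ℕ.suc-pred p) ⟩
      ∑< p (λ j → ∑< p (λ a → u ^ j * (ζ ^ a) ^ j))
        ≈⟨ ∑-swap p p (λ j a → u ^ j * (ζ ^ a) ^ j) ⟩
      ∑< p (λ a → ∑< p (λ j → u ^ j * (ζ ^ a) ^ j))
        ≈⟨ ∑-cong p (λ a _ → ∑-cong p (λ j _ → sym (^-distrib-* u (ζ ^ a) j))) ⟩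
      ∑< p (λ a → ∑< p (λ j → (u * ζ ^ a) ^ j))
        ≈⟨ ∑-zero p (λ a _ → ∑-roots p (root-* p u^p≈1 (root-^ p a ζ^p≈1)) (uζ^a≉1 a)) ⟩
      0# ∎)
      where
      n = ℕ.pred p
      uζ^a≉1 : ∀ a → ¬ (u * ζ ^ a ≈ 1#)
      -- Since u * ζ ^ a = 1, `u` is the inverse of ζ ^ a, whose exponent is a * (p - 1).
      uζ^a≉1 a eq = none (a ℕ.* n , (begin
        u                        ≈⟨ *-identityʳ u ⟨
        u * 1#                   ≈⟨ *-congˡ (root-^ p a ζ^p≈1) ⟨
        u * (ζ ^ a) ^ p          ≡⟨ ≡.cong (λ k → u * (ζ ^ a) ^ k) (ℕ.suc-pred p) ⟨
        u * (ζ ^ a * (ζ ^ a) ^ n) ≈⟨ *-assoc _ _ _ ⟨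
        u * ζ ^ a * (ζ ^ a) ^ n  ≈⟨ *-congʳ eq ⟩
        1# * (ζ ^ a) ^ n         ≈⟨ *-identityˡ _ ⟩
        (ζ ^ a) ^ n              ≈⟨ ^-assocʳ ζ a n ⟩
        ζ ^ (a ℕ.* n)            ∎))
      nonconstant : ∀ j → j ℕ.< n → ∑< p (λ a → u ^ suc j * (ζ ^ a) ^ suc j) ≈ 0#
      nonconstant j j<n = begin
        ∑< p (λ a → u ^ suc j * (ζ ^ a) ^ suc j)    ≈⟨ ∑-*ˡ p (u ^ suc j) _ ⟨
        u ^ suc j * ∑< p (λ a → (ζ ^ a) ^ suc j)    ≈⟨ *-congˡ (trans (∑-cong p (λ a _ → ^-comm ζ a (suc j)))
                                                         (∑-roots p (root-^ p (suc j) ζ^p≈1) (ζ^≉1 (ℕ.>⇒∤ 1+j<p)))) ⟩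
        u ^ suc j * 0#                              ≈⟨ zeroʳ _ ⟩
        0#                                          ∎
        where
        1+j<p : suc j ℕ.< p
        1+j<p = ≡.subst (suc j ℕ.<_) (ℕ.suc-pred p) (s≤s j<n)

    module _ {R : Carrier → Set} (S : IsSubring R) where

      open IsSubring S
      open Polynomials S
      open Divisibility S

      -- By orthogonality a monomial contributes `p` times its coefficient or nothing.
      ∑-poly-∣ : ∀ {g} → Poly R g → ι (+ p) ∣ ∑< p (λ a → g (ζ ^ a)) within R
      ∑-poly-∣ (plus P Q eq) = ∣-resp
        (trans (sym (∑-+ p _ _)) (∑-cong p (λ a _ → sym (eq (ζ ^ a)))))
        (∣-+ (∑-poly-∣ P) (∑-poly-∣ Q))
      ∑-poly-∣ {g} (mono r r∈ j eq) = ∣-resp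
        (trans (∑-*ˡ p r _) (∑-cong p (λ a _ → sym (eq (ζ ^ a)))))
        (case (∑-powers j))
        where
        case : ∑< p (λ a → (ζ ^ a) ^ j) ≈ ι (+ p) ⊎ ∑< p (λ a → (ζ ^ a) ^ j) ≈ 0# →
               ι (+ p) ∣ r * ∑< p (λ a → (ζ ^ a) ^ j) within R
        case (inj₁ ≈p) = r , r∈ , trans (*-congˡ ≈p) (*-comm _ _)
        case (inj₂ ≈0) = ∣-resp (sym (trans (*-congˡ ≈0) (zeroʳ _))) ∣-0

      -- For n = p - 1 and x = ζ this is the product of the conjugates of f ζ. It stays a function
      -- of `x` because it is compared at all powers of ζ, including 1.
      norm : (Carrier → Carrier) → ℕ → Carrier → Carrier
      norm f zero x = 1#
      norm f (suc n) x = f (x ^ suc n) * norm f n x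

      norm-poly : ∀ {f} n → Poly R f → Poly R (norm f n)
      norm-poly zero P = poly-const 1∈
      norm-poly (suc n) P = poly-* (poly-∘^ (suc n) P) (norm-poly n P)

      norm-1 : ∀ {f} n → Poly R f → norm f n 1# ≈ f 1# ^ n
      norm-1 zero P = refl
      norm-1 (suc n) P = *-cong (poly-cong P (1^n≈1 (suc n))) (norm-1 n P)

      norm-0 : ∀ {f x} n a → 0 ℕ.< a → a ℕ.≤ n → f (x ^ a) ≈ 0# → norm f n x ≈ 0#
      norm-0 zero a 0<a a≤0 _ = contradiction (ℕ.≤-trans 0<a a≤0) λ ()
      norm-0 (suc n) a 0<a a≤1+n eq with ℕ.m≤n⇒m<n∨m≡n a≤1+n
      ... | inj₁ (s≤s a≤n) = trans (*-congˡ (norm-0 n a 0<a a≤n eq)) (zeroʳ _)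
      ... | inj₂ ≡.refl = trans (*-congʳ eq) (zeroˡ _)

      -- The product of all f (x ^ a), 0 < a < p, vanishes at every ζ ^ b with
      -- 0 < b < p, so its sum over all p-th roots of unity is its value at 1.
      poly-root⇒∣ : ∀ {f} → Poly R f → f ζ ≈ 0# → ι (+ p) ∣ f 1# ^ ℕ.pred p within R
      poly-root⇒∣ {f} P fζ≈0 = ∣-resp (begin
          ∑< p (λ b → norm f n (ζ ^ b))
            ≡⟨ ≡.cong (λ k → ∑< k (λ b → norm f n (ζ ^ b))) (ℕ.suc-pred p) ⟨
          norm f n 1# + ∑< n (λ b → norm f n (ζ ^ suc b))
            ≈⟨ +-cong (norm-1 n P) (∑-zero n vanish) ⟩
          f 1# ^ n + 0#
            ≈⟨ +-identityʳ _ ⟩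
          f 1# ^ n ∎)
        (∑-poly-∣ (norm-poly n P))
        where
        n = ℕ.pred p
        vanish : ∀ b → b ℕ.< n → norm f n (ζ ^ suc b) ≈ 0#
        vanish b b<n =
          -- `a` inverts the exponent 1 + b, so the factor of index `a % p` is f ζ. The index must
          -- be shown positive, as the product starts at 1.
          let a , e , ab≡1+ep = inverse-mod (suc b) pp p∤1+b
          in norm-0 n (a % p) (a%p>0 a e ab≡1+ep) (ℕ.<⇒≤pred (m%n<n a p)) (begin
            f ((ζ ^ suc b) ^ (a % p))   ≈⟨ poly-cong P (^-% p a (root-^ p (suc b) ζ^p≈1)) ⟨
            f ((ζ ^ suc b) ^ a)         ≈⟨ poly-cong P (^-assocʳ ζ (suc b) a) ⟩
            f (ζ ^ (suc b ℕ.* a))       ≈⟨ poly-cong P (^-congʳ ζ ab≡1+ep) ⟩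
            f (ζ ^ (1 ℕ.+ e ℕ.* p))     ≈⟨ poly-cong P (trans (^-+* 1 e ζ^p≈1) (*-identityʳ ζ)) ⟩
            f ζ                         ≈⟨ fζ≈0 ⟩
            0#                          ∎)
          where
          p∤1+b : ¬ p ℕ.∣ suc b
          p∤1+b = ℕ.>⇒∤ (≡.subst (suc b ℕ.<_) (ℕ.suc-pred p) (s≤s b<n))
          a%p>0 : ∀ a e → suc b ℕ.* a ≡ 1 ℕ.+ e ℕ.* p → 0 ℕ.< a % p
          a%p>0 a e eq = ℕ.n≢0⇒n>0 λ a%p≡0 → ℕ.>⇒∤ (prime>1 pp)
            (ℕ.∣m+n∣m⇒∣n (≡.subst (p ℕ.∣_) (≡.trans eq (ℕ.+-comm 1 _)) (ℕ.∣n⇒∣m*n (suc b) (ℕ.m%n≡0⇒n∣m a p a%p≡0)))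
              (ℕ.n∣m*n e))

    integral-poly-root⇒∣ : ∀ {f m} → Poly Integral f → f ζ ≈ 0# → f 1# ≈ ι m → (+ p) ℤ.∣ m
    integral-poly-root⇒∣ {f} {m} P fζ≈0 f1≈m
      with _ , (k , w≈k) , eq ← poly-root⇒∣ integral-subring P fζ≈0 =
      ∣m^n⇒∣m m (ℕ.pred p) pp (ℤ.divides k (ι-injective (begin
        ι (m ℤ.^ ℕ.pred p)   ≈⟨ ι-^ m (ℕ.pred p) ⟩
        ι m ^ ℕ.pred p       ≈⟨ ^-congˡ (ℕ.pred p) f1≈m ⟨
        f 1# ^ ℕ.pred p      ≈⟨ eq ⟩
        ι (+ p) * _          ≈⟨ *-congˡ w≈k ⟩
        ι (+ p) * ι k        ≈⟨ *-comm _ _ ⟩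
        ι k * ι (+ p)        ≈⟨ ι-* k (+ p) ⟨
        ι (k ℤ.* + p)        ∎)))

    ∑ζ^≈0⇒∣ : ∀ n (X : ℕ → ℕ) → ∑< n (λ c → ζ ^ X c) ≈ 0# → p ℕ.∣ n
    ∑ζ^≈0⇒∣ n X eq = ℤ.∣⇒∣ᵤ (integral-poly-root⇒∣ {m = + n}
      (poly-∑ n {λ c x → x ^ X c} (λ c _ → poly-^ (X c))) eq
      (trans (∑-cong n (λ c _ → 1^n≈1 (X c))) (trans (∑-const n 1#) (*-identityʳ _))))
      where open Polynomials integral-subring

  module ℕΣ = Sums ℕ.+-*-commutativeSemiring

  ι-∑ : ∀ n (f : ℕ → ℕ) → ι (+ ℕΣ.∑< n f) ≈ ∑< n (λ i → ι (+ f i))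
  ι-∑ zero f = refl
  ι-∑ (suc n) f = trans (ι-+ (+ f 0) (+ ℕΣ.∑< n (f ∘ suc))) (+-congˡ (ι-∑ n (f ∘ suc)))

  ι-δ : ∀ i j → ι (+ ℕΣ.δ i j) ≈ δ i j
  ι-δ zero zero = refl
  ι-δ zero (suc j) = refl
  ι-δ (suc i) zero = refl
  ι-δ (suc i) (suc j) = ι-δ i j

  n<m^n : ∀ {m} → 1 ℕ.< m → ∀ n → n ℕ.< m ℕ.^ n
  n<m^n 1<m zero = s≤s z≤n
  n<m^n {m} 1<m (suc n) = ℕ.≤-<-trans (n<m^n 1<m n)
    (ℕ.^-monoʳ-< m 1<m (ℕ.n<1+n n))

  -- Integral relations between the powers of a root of unity of prime order.

  sumℤ : List ℤ → ℤ
  sumℤ = foldr ℤ._+_ (+ 0)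

  -- Synthetic division: applied to the coefficients after the constant one, this lists the
  -- coefficients of the quotient by x - 1.
  suffixSums : List ℤ → List ℤ
  suffixSums [] = []
  suffixSums (a ∷ as) = sumℤ (a ∷ as) ∷ suffixSums as

  length-suffixSums : ∀ as → length (suffixSums as) ≡ length as
  length-suffixSums [] = ≡.refl
  length-suffixSums (a ∷ as) = ≡.cong suc (length-suffixSums as)

  -- Consecutive suffix sums differ by one coefficient.
  ∣-suffixSums : ∀ {d} a as → d ℤ.∣ sumℤ (a ∷ as) → All (d ℤ.∣_) (suffixSums as) →
                 All (d ℤ.∣_) (a ∷ as)
  ∣-suffixSums a [] d∣ [] = ≡.subst (_ ℤ.∣_) (ℤ.+-identityʳ a) d∣ ∷ []
  ∣-suffixSums a (b ∷ bs) d∣ (d∣s ∷ rest) =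
    ℤ.∣m+n∣n⇒∣m d∣ d∣s ∷ ∣-suffixSums b bs d∣s rest

  eval : List ℤ → Carrier → Carrier
  eval [] x = 0#
  eval (a ∷ as) x = ι a + x * eval as x

  eval-quotient : ∀ a as x →
    eval (a ∷ as) x ≈ ι (sumℤ (a ∷ as)) + (x - 1#) * eval (suffixSums as) x
  eval-quotient a [] x = begin
    ι a + x * 0#                     ≈⟨ solve 2 (λ a x → a :+ x :* con (+ 0) := a :+ con (+ 0) :+ (x :- con (+ 1)) :* con (+ 0)) refl (ι a) x ⟩
    ι a + 0# + (x - 1#) * 0#         ≈⟨ +-congʳ (ι-+ a (+ 0)) ⟨
    ι (a ℤ.+ + 0) + (x - 1#) * 0#    ∎
  eval-quotient a (b ∷ bs) x = begin
    ι a + x * eval (b ∷ bs) x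
      ≈⟨ +-congˡ (*-congˡ (eval-quotient b bs x)) ⟩
    ι a + x * (ι S + (x - 1#) * Q)
      ≈⟨ solve 4 (λ a x s q → a :+ x :* (s :+ (x :- con (+ 1)) :* q)
           := a :+ s :+ (x :- con (+ 1)) :* (s :+ x :* q)) refl (ι a) x (ι S) Q ⟩
    ι a + ι S + (x - 1#) * (ι S + x * Q)
      ≈⟨ +-congʳ (ι-+ a S) ⟨
    ι (a ℤ.+ S) + (x - 1#) * (ι S + x * Q) ∎
    where
    S = sumℤ (b ∷ bs)
    Q = eval (suffixSums bs) x

  eval-applyUpTo : ∀ f n x → eval (applyUpTo f n) x ≈ ∑< n (λ i → ι (f i) * x ^ i)
  eval-applyUpTo f zero x = refl
  eval-applyUpTo f (suc n) x = +-cong (sym (*-identityʳ _)) (begin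
    x * eval (applyUpTo (f ∘ suc) n) x               ≈⟨ *-congˡ (eval-applyUpTo (f ∘ suc) n x) ⟩
    x * ∑< n (λ i → ι (f (suc i)) * x ^ i)           ≈⟨ ∑-*ˡ n x _ ⟩
    ∑< n (λ i → x * (ι (f (suc i)) * x ^ i))         ≈⟨ ∑-cong n (λ i _ → solve 3 (λ x a b → x :* (a :* b) := a :* (x :* b)) refl x (ι (f (suc i))) (x ^ i)) ⟩
    ∑< n (λ i → ι (f (suc i)) * x ^ suc i)           ∎)

  eval-scale : ∀ d as x → eval (map (d ℤ.*_) as) x ≈ ι d * eval as x
  eval-scale d [] x = sym (zeroʳ _)
  eval-scale d (a ∷ as) x = begin
    ι (d ℤ.* a) + x * eval (map (d ℤ.*_) as) x   ≈⟨ +-cong (ι-* d a) (*-congˡ (eval-scale d as x)) ⟩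
    ι d * ι a + x * (ι d * eval as x)            ≈⟨ solve 4 (λ d a x e → d :* a :+ x :* (d :* e) := d :* (a :+ x :* e)) refl (ι d) (ι a) x (eval as x) ⟩
    ι d * (ι a + x * eval as x)                  ∎

  All-∣⇒map : ∀ {d} as → All (d ℤ.∣_) as → ∃[ bs ] as ≡ map (d ℤ.*_) bs
  All-∣⇒map [] [] = [] , ≡.refl
  All-∣⇒map {d} (a ∷ as) (ℤ.divides b eq ∷ d∣as) with bs , eq′ ← All-∣⇒map as d∣as =
    b ∷ bs , ≡.cong₂ _∷_ (≡.trans eq (ℤ.*-comm b d)) eq′

  module Cyclotomic {q} (qp : Prime q) {η : Carrier} (η^q≈1 : η ^ q ≈ 1#) (η≉1 : ¬ (η ≈ 1#)) where

    private instance _ = prime⇒nonZero qp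

    open Adjoin η public
    open PrimitiveRoot qp η^q≈1 η≉1
    open IsSubring subring
    open Divisibility subring
    private module P = Polynomials integral-subring

    π : Carrier
    π = η - 1#

    π∈ : ℤ[η] π
    π∈ = +∈ η∈ (-∈ 1∈)

    π≉0 : ¬ (π ≈ 0#)
    π≉0 = η≉1 ∘ x∙y⁻¹≈ε⇒x≈y η 1#

    eval∈ : ∀ as → ℤ[η] (eval as η)
    eval∈ [] = 0∈
    eval∈ (a ∷ as) = +∈ (ι∈ a) (*∈ η∈ (eval∈ as))

    -- If m = π * W η, the integral polynomial m - (x - 1) * W x has the root η and the value m at
    -- 1.
    π∣ι⇒∣ : ∀ {m} → π ∣ ι m within ℤ[η] → (+ q) ℤ.∣ m
    π∣ι⇒∣ {m} (w , (W , PW , w≈W) , eq) = integral-poly-root⇒∣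
      (P.poly-+ (P.poly-const (IsSubring.ι∈ integral-subring m))
        (P.poly-neg (P.poly-* (P.poly-+ P.poly-var (P.poly-const (IsSubring.ι∈ integral-subring (ℤ.- (+ 1))))) PW)))
      (x≈y⇒x∙y⁻¹≈ε (trans eq (*-congˡ w≈W)))
      (begin
        ι m - (1# - 1#) * W 1#   ≈⟨ solve 2 (λ a b → a :- (con (+ 1) :- con (+ 1)) :* b := a) refl (ι m) (W 1#) ⟩
        ι m                      ∎)

    -- From (1 + π) ^ q = 1: up to multiples of q π, the number q is - π ^ (q - 1).
    π^∣q : ∀ k → k ℕ.< q → π ^ k ∣ ι (+ q) within ℤ[η]
    π^∣q zero _ = _ , ×∈ q , sym (*-identityˡ _)
    π^∣q (suc k) 1+k<q with w , w∈ , expand ← [1+x]^p qp π∈ = ∣-resp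
      (begin
        - (ι (+ q) * (π * w) + π ^ n)
          ≈⟨ +-identityʳ _ ⟨
        - (ι (+ q) * (π * w) + π ^ n) + 0#
          ≈⟨ +-congˡ relation ⟨
        - (ι (+ q) * (π * w) + π ^ n) + (ι (+ q) * (1# + π * w) + π ^ n)
          ≈⟨ solve 4 (λ Q x w z → :- (Q :* (x :* w) :+ z) :+ (Q :* (con (+ 1) :+ x :* w) :+ z) := Q)
               refl (ι (+ q)) π w (π ^ n) ⟩
        ι (+ q) ∎)
      (∣-neg (∣-+ step high))
      where
      n = ℕ.pred q
      relation : ι (+ q) * (1# + π * w) + π ^ n ≈ 0#
      relation = *-cancel (begin
        π * (ι (+ q) * (1# + π * w) + π ^ n)
          ≈⟨ solve 4 (λ Q x w z → x :* (Q :* (con (+ 1) :+ x :* w) :+ z)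
               := con (+ 1) :+ Q :* (x :* (con (+ 1) :+ x :* w)) :+ x :* z :- con (+ 1)) refl (ι (+ q)) π w (π ^ n) ⟩
        1# + ι (+ q) * (π * (1# + π * w)) + π ^ suc n - 1#
          ≡⟨ ≡.cong (λ k → 1# + ι (+ q) * (π * (1# + π * w)) + π ^ k - 1#) (ℕ.suc-pred q) ⟩
        1# + ι (+ q) * (π * (1# + π * w)) + π ^ q - 1#
          ≈⟨ +-congʳ expand ⟨
        (1# + π) ^ q - 1#
          ≈⟨ x≈y⇒x∙y⁻¹≈ε (trans (^-congˡ q (solve 1 (λ x → con (+ 1) :+ (x :- con (+ 1)) := x) refl η)) η^q≈1) ⟩
        0# ∎) π≉0
      -- The factor π beside `q` improves the divisibility of `q` by one power, until the exponent
      -- reaches q - 1.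
      step : π ^ suc k ∣ ι (+ q) * (π * w) within ℤ[η]
      step = let v , v∈ , eq = π^∣q k (ℕ.<-trans (ℕ.n<1+n k) 1+k<q) in v * w , *∈ v∈ w∈ , (begin
        ι (+ q) * (π * w)       ≈⟨ *-congʳ eq ⟩
        π ^ k * v * (π * w)     ≈⟨ solve 4 (λ a v x w → a :* v :* (x :* w) := x :* a :* (v :* w)) refl (π ^ k) v π w ⟩
        π ^ suc k * (v * w)     ∎)
      high : π ^ suc k ∣ π ^ n within ℤ[η]
      high = π ^ (n ℕ.∸ suc k) , ^∈ (n ℕ.∸ suc k) π∈ ,
        trans (^-congʳ π (≡.sym (ℕ.m+[n∸m]≡n (ℕ.<⇒≤pred 1+k<q)))) (^-homo-* π (suc k) _)

    -- The value is S + π * Q with S the sum of the coefficients. Divisibility by π gives q | S; as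
    -- π ^ k divides `q` for k < q, it divides S as well and hence π * Q. Cancelling one π leaves Q,
    -- which has one coefficient fewer.
    π^∣eval⇒q∣ : ∀ k as → length as ≡ k → k ℕ.< q → π ^ k ∣ eval as η within ℤ[η] →
                All ((+ q) ℤ.∣_) as
    π^∣eval⇒q∣ _ [] _ _ _ = []
    π^∣eval⇒q∣ (suc k) (a ∷ as) |as| k<q π^∣ = ∣-suffixSums a as q∣S
      (π^∣eval⇒q∣ k (suffixSums as) (≡.trans (length-suffixSums as) (ℕ.suc-injective |as|))
        (ℕ.<-trans (ℕ.n<1+n k) k<q) π^∣Q)
      where
      S = sumℤ (a ∷ as)
      Q = eval (suffixSums as) η
      ιS≈ : ι S ≈ eval (a ∷ as) η - π * Q
      ιS≈ = trans (solve 2 (λ s t → s := s :+ t :- t) refl (ι S) (π * Q))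
                  (+-congʳ (sym (eval-quotient a as η)))
      q∣S : (+ q) ℤ.∣ S
      q∣S = π∣ι⇒∣ (∣-resp (sym ιS≈) (∣-+
        (∣-trans (π ^ k , ^∈ k π∈ , refl) π^∣)
        (∣-neg (∣-* (eval∈ (suffixSums as))))))
      π^∣πQ : π ^ suc k ∣ π * Q within ℤ[η]
      π^∣πQ = let ℤ.divides m eq = q∣S in ∣-resp
        (begin
          eval (a ∷ as) η - ι (+ q) * ι m  ≈⟨ +-congˡ (-‿cong (trans (*-comm _ _) (trans (sym (ι-* m (+ q))) (reflexive (≡.cong ι (≡.sym eq)))))) ⟩
          eval (a ∷ as) η - ι S            ≈⟨ +-congʳ (eval-quotient a as η) ⟩
          ι S + π * Q - ι S                ≈⟨ solve 2 (λ s t → s :+ t :- s := t) refl (ι S) (π * Q) ⟩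
          π * Q                            ∎)
        (∣-+ π^∣ (∣-neg (∣-*ʳ (π^∣q (suc k) k<q) (ι∈ m))))
      π^∣Q : π ^ k ∣ Q within ℤ[η]
      π^∣Q = let w , w∈ , eq = π^∣πQ in w , w∈ , *-cancelˡ π≉0 (trans eq (*-assoc π (π ^ k) w))

    -- Infinite descent: 0 is divisible by every power of π, so `q` divides all coefficients, and
    -- dividing by `q` leaves a relation of the same length.
    eval≈0⇒^∣ : ∀ n as → length as ℕ.< q → eval as η ≈ 0# → All ((+ (q ℕ.^ n)) ℤ.∣_) as
    eval≈0⇒^∣ zero as _ _ = All.universal (λ a → ℤ.divides a (≡.sym (ℤ.*-identityʳ a))) as
    eval≈0⇒^∣ (suc n) as k<q eq
      with bs , ≡.refl ← All-∣⇒map as (π^∣eval⇒q∣ (length as) as ≡.refl k<q (∣-resp (sym eq) ∣-0)) =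
      All.map⁺ (All.map (λ {b} → lift {b}) (eval≈0⇒^∣ n bs (≡.subst (ℕ._< q) (List.length-map _ bs) k<q)
        (*-cancel (trans (sym (eval-scale (+ q) bs η)) eq) (prime≉0 qp))))
      where
      lift : ∀ {b} → (+ (q ℕ.^ n)) ℤ.∣ b → (+ (q ℕ.^ suc n)) ℤ.∣ + q ℤ.* b
      lift {b} d = ≡.subst (ℤ._∣ + q ℤ.* b) (≡.sym (ℤ.pos-* q (q ℕ.^ n))) (ℤ.*-monoʳ-∣ (+ q) d)

    -- For a coefficient a the descent is run |a| times, since q ^ |a| exceeds |a| and can divide it
    -- only if a = 0. The result takes the place of the irreducibility of the cyclotomic polynomial.
    eval≈0⇒≡0 : ∀ as → length as ℕ.< q → eval as η ≈ 0# → All (_≡ + 0) as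
    eval≈0⇒≡0 as k<q eq = All.tabulate λ {a} a∈as →
      zero-if a (ℤ.∣⇒∣ᵤ (All.lookup (eval≈0⇒^∣ ℤ.∣ a ∣ as k<q eq) a∈as))
      where
      zero-if : ∀ a → q ℕ.^ ℤ.∣ a ∣ ℕ.∣ ℤ.∣ a ∣ → a ≡ + 0
      zero-if (+ zero) _ = ≡.refl
      zero-if (+ suc n) d = contradiction d (ℕ.>⇒∤ (n<m^n (prime>1 qp) (suc n)))
      zero-if -[1+ n ] d = contradiction d (ℕ.>⇒∤ (n<m^n (prime>1 qp) (suc n)))

    -- Subtracting A (q - 1) times the vanishing sum 1 + η + ... + η ^ (q - 1) removes the last
    -- power, and the remaining q - 1 powers are independent.
    coefficients-constant : ∀ (A : ℕ → ℤ) → ∑< q (λ i → ι (A i) * η ^ i) ≈ 0# →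
                            ∀ {i} → i ℕ.< q → A i ≡ A (ℕ.pred q)
    coefficients-constant A eq {i} i<q with ℕ.m≤n⇒m<n∨m≡n (ℕ.<⇒≤pred i<q)
    ... | inj₂ ≡.refl = ≡.refl
    ... | inj₁ i<n = ℤ.i-j≡0⇒i≡j (A i) (A n) (All.applyUpTo⁻ B n (eval≈0⇒≡0 (applyUpTo B n)
          (≡.subst (ℕ._< q) (≡.sym (List.length-applyUpTo B n)) (≡.subst (n ℕ.<_) (ℕ.suc-pred q) (ℕ.n<1+n n))) (begin
            eval (applyUpTo B n) η
              ≈⟨ eval-applyUpTo B n η ⟩
            ∑< n (λ i → ι (B i) * η ^ i)
              ≈⟨ ∑-cong n (λ i _ → trans (*-congʳ (trans (ι-+ (A i) (ℤ.- A n)) (+-congˡ (ι-neg (A n)))))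
                   (solve 3 (λ a b x → (a :- b) :* x := a :* x :+ (:- b) :* x) refl (ι (A i)) (ι (A n)) (η ^ i))) ⟩
            ∑< n (λ i → ι (A i) * η ^ i + - ι (A n) * η ^ i)
              ≈⟨ ∑-+ n _ _ ⟩
            a + ∑< n (λ i → - ι (A n) * η ^ i)
              ≈⟨ +-congˡ (∑-*ˡ n (- ι (A n)) (η ^_)) ⟨
            a + - ι (A n) * b
              ≈⟨ solve 4 (λ a b c z → a :+ (:- c) :* b := (a :+ c :* z) :- c :* (b :+ z)) refl a b (ι (A n)) (η ^ n) ⟩
            (a + ι (A n) * η ^ n) - ι (A n) * (b + η ^ n)
              ≈⟨ +-cong (∑-last n _) (-‿cong (*-congˡ (∑-last n _))) ⟨
            ∑< (suc n) (λ i → ι (A i) * η ^ i) - ι (A n) * ∑< (suc n) (η ^_)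
              ≡⟨ ≡.cong (λ k → ∑< k (λ i → ι (A i) * η ^ i) - ι (A n) * ∑< k (η ^_)) (ℕ.suc-pred q) ⟩
            ∑< q (λ i → ι (A i) * η ^ i) - ι (A n) * ∑< q (η ^_)
              ≈⟨ +-cong eq (-‿cong (*-congˡ (∑-roots q η^q≈1 η≉1))) ⟩
            0# - ι (A n) * 0#
              ≈⟨ solve 1 (λ c → con (+ 0) :- c :* con (+ 0) := con (+ 0)) refl (ι (A n)) ⟩
            0# ∎)) i<n)
      where
      n = ℕ.pred q
      B : ℕ → ℤ
      B i = A i ℤ.- A n
      a = ∑< n (λ i → ι (A i) * η ^ i)
      b = ∑< n (η ^_)

    reduce : ∀ {f} → Poly Integral f →
             ∃[ A ] ∀ {x} → x ^ q ≈ 1# → f x ≈ ∑< q (λ i → ι (A i) * x ^ i)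
    reduce {f} (mono r (a , r≈a) j eq) = A , λ {x} x^q≈1 → begin
      f x
        ≈⟨ eq x ⟩
      r * x ^ j
        ≈⟨ *-cong r≈a (^-% q j x^q≈1) ⟩
      ι a * x ^ (j % q)
        ≈⟨ ∑-δ (m%n<n j q) (λ i → ι a * x ^ i) ⟨
      ∑< q (λ i → δ (j % q) i * (ι a * x ^ i))
        ≈⟨ ∑-cong q (λ i _ → trans (sym (*-assoc _ _ _))
             (*-congʳ (trans (*-congʳ (sym (ι-δ (j % q) i))) (sym (ι-* (+ ℕΣ.δ (j % q) i) a))))) ⟩
      ∑< q (λ i → ι (A i) * x ^ i) ∎
      where
      A : ℕ → ℤ
      A i = + ℕΣ.δ (j % q) i ℤ.* a
    reduce {h} (plus {f = f} {g = g} P Q eq) with A , f≈ ← reduce P | B , g≈ ← reduce Q =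
      (λ i → A i ℤ.+ B i) , λ {x} x^q≈1 → begin
        h x
          ≈⟨ eq x ⟩
        f x + g x
          ≈⟨ +-cong (f≈ x^q≈1) (g≈ x^q≈1) ⟩
        ∑< q (λ i → ι (A i) * x ^ i) + ∑< q (λ i → ι (B i) * x ^ i)
          ≈⟨ ∑-+ q _ _ ⟨
        ∑< q (λ i → ι (A i) * x ^ i + ι (B i) * x ^ i)
          ≈⟨ ∑-cong q (λ i _ → trans (sym (distribʳ _ _ _)) (*-congʳ (sym (ι-+ (A i) (B i))))) ⟩
        ∑< q (λ i → ι (A i ℤ.+ B i) * x ^ i) ∎

    -- With exponents reduced modulo `q`, all coefficients of the relation are equal, and 1 + x +
    -- ... + x ^ (q - 1) vanishes at `η ^ r` too. This stands in for the automorphism sending η to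
    -- `η ^ r`.
    conjugate : ∀ {f r} → Poly Integral f → f η ≈ 0# → ¬ q ℕ.∣ r → f (η ^ r) ≈ 0#
    conjugate {f} {r} P fη≈0 q∤r with A , f≈ ← reduce P = begin
      f (η ^ r)
        ≈⟨ f≈ (root-^ q r η^q≈1) ⟩
      ∑< q (λ i → ι (A i) * (η ^ r) ^ i)
        ≈⟨ ∑-cong q (λ i i<q → *-congʳ (reflexive (≡.cong ι
             (coefficients-constant A (trans (sym (f≈ η^q≈1)) fη≈0) i<q)))) ⟩
      ∑< q (λ i → ι (A (ℕ.pred q)) * (η ^ r) ^ i)
        ≈⟨ ∑-*ˡ q _ ((η ^ r) ^_) ⟨
      ι (A (ℕ.pred q)) * ∑< q ((η ^ r) ^_)
        ≈⟨ *-congˡ (∑-roots q (root-^ q r η^q≈1) (ζ^≉1 q∤r)) ⟩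
      ι (A (ℕ.pred q)) * 0#
        ≈⟨ zeroʳ _ ⟩
      0# ∎

  -- A second prime: congruences modulo `p` in ℤ[η] and vanishing sums of products.

  0^p≈0 : ∀ {p} → Prime p → 0# ^ p ≈ 0#
  0^p≈0 {zero} pp = contradiction (prime>1 pp) λ ()
  0^p≈0 {suc n} pp = zeroˡ _

  prime∤prime : ∀ {p q} → Prime p → Prime q → p ≢ q → ¬ q ℕ.∣ p
  prime∤prime pp qp p≢q q∣p with prime⇒irreducible pp q∣p
  ... | inj₁ ≡.refl = ℕ.<-irrefl ≡.refl (prime>1 qp)
  ... | inj₂ q≡p = p≢q (≡.sym q≡p)

  -- This is (x ^ j - 1) / (x - 1), with the value `j` at 1: dividing by x - 1 brings exponents down
  -- to coefficients.
  bracket : ℕ → Carrier → Carrier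
  bracket j x = ∑< j (x ^_)

  bracket-1 : ∀ j → bracket j 1# ≈ ι (+ j)
  bracket-1 j = trans (∑-cong j (λ i _ → 1^n≈1 i)) (trans (∑-const j 1#) (*-identityʳ _))

  module CoprimeCyclotomic {p q} (pp : Prime p) (qp : Prime q) (p≢q : p ≢ q)
    {η : Carrier} (η^q≈1 : η ^ q ≈ 1#) (η≉1 : ¬ (η ≈ 1#)) where

    open Cyclotomic qp η^q≈1 η≉1 public
    open IsSubring subring
    open Divisibility subring
    private
      module P = Polynomials integral-subring
      instance
        p-nonZero = prime⇒nonZero pp
        q-nonZero = prime⇒nonZero qp

    fermat⁺ : ∀ n → ι (+ p) ∣ ι (+ n) ^ p - ι (+ n) within ℤ[η]
    fermat⁺ zero = ∣-resp (sym (x≈y⇒x∙y⁻¹≈ε (0^p≈0 pp))) ∣-0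
    fermat⁺ (suc n) = ∣-resp
      (begin
        ((1# + N) ^ p - (1# ^ p + N ^ p)) + (N ^ p - N)
          ≈⟨ +-congʳ (+-congˡ (-‿cong (+-congʳ (1^n≈1 p)))) ⟩
        ((1# + N) ^ p - (1# + N ^ p)) + (N ^ p - N)
          ≈⟨ solve 3 (λ a b c → (a :- (con (+ 1) :+ b)) :+ (b :- c) := a :- (con (+ 1) :+ c)) refl ((1# + N) ^ p) (N ^ p) N ⟩
        (1# + N) ^ p - (1# + N)
          ≈⟨ +-cong (^-congˡ p (ι-suc n)) (-‿cong (ι-suc n)) ⟨
        ι (+ suc n) ^ p - ι (+ suc n) ∎)
      (∣-+ (frobenius-+ pp 1∈ (×∈ n)) (fermat⁺ n))
      where N = ι (+ n)
    fermat : ∀ i → ι (+ p) ∣ ι i ^ p - ι i within ℤ[η]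
    fermat (+ n) = fermat⁺ n
    -- Frobenius for N + (- N) = 0 settles the negative case without regard to the parity of `p`.
    fermat -[1+ n ] = ∣-resp
      (begin
        - ((N + - N) ^ p - (N ^ p + (- N) ^ p)) - (N ^ p - N)
          ≈⟨ +-congʳ (-‿cong (+-congʳ (trans (^-congˡ p (-‿inverseʳ N)) (0^p≈0 pp)))) ⟩
        - (0# - (N ^ p + (- N) ^ p)) - (N ^ p - N)
          ≈⟨ solve 3 (λ a b c → :- (con (+ 0) :- (a :+ b)) :- (a :- c) := b :- (:- c)) refl (N ^ p) ((- N) ^ p) N ⟩
        (- N) ^ p - (- N) ∎)
      (∣-+ (∣-neg (frobenius-+ pp (×∈ (suc n)) (-∈ (×∈ (suc n))))) (∣-neg (fermat⁺ (suc n))))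
      where N = ι (+ suc n)

    -- Additivity modulo `p` reduces this to monomials, where Fermat's little theorem treats the
    -- coefficient.
    frobenius : ∀ {f} → Poly Integral f → ι (+ p) ∣ f η ^ p - f (η ^ p) within ℤ[η]
    frobenius {f} (mono r (a , r≈a) j eq) = ∣-resp
      (begin
        (ι a ^ p - ι a) * (η ^ p) ^ j
          ≈⟨ solve 3 (λ u a b → (u :- a) :* b := u :* b :- a :* b) refl (ι a ^ p) (ι a) ((η ^ p) ^ j) ⟩
        ι a ^ p * (η ^ p) ^ j - ι a * (η ^ p) ^ j
          ≈⟨ +-congʳ (*-congˡ (^-comm η p j)) ⟩
        ι a ^ p * (η ^ j) ^ p - ι a * (η ^ p) ^ j
          ≈⟨ +-congʳ (^-distrib-* (ι a) (η ^ j) p) ⟨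
        (ι a * η ^ j) ^ p - ι a * (η ^ p) ^ j
          ≈⟨ +-cong (^-congˡ p (trans (eq η) (*-congʳ r≈a))) (-‿cong (trans (eq (η ^ p)) (*-congʳ r≈a))) ⟨
        f η ^ p - f (η ^ p) ∎)
      (∣-*ʳ (fermat a) (^∈ j (η^∈ p)))
    frobenius {h} (plus {f = f} {g = g} P Q eq) = ∣-resp
      (begin
        ((f η + g η) ^ p - (f η ^ p + g η ^ p)) + ((f η ^ p - f (η ^ p)) + (g η ^ p - g (η ^ p)))
          ≈⟨ solve 5 (λ s a b c d → (s :- (a :+ b)) :+ ((a :- c) :+ (b :- d)) := s :- (c :+ d))
               refl ((f η + g η) ^ p) (f η ^ p) (g η ^ p) (f (η ^ p)) (g (η ^ p)) ⟩
        (f η + g η) ^ p - (f (η ^ p) + g (η ^ p))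
          ≈⟨ +-cong (^-congˡ p (eq η)) (-‿cong (eq (η ^ p))) ⟨
        h η ^ p - h (η ^ p) ∎)
      (∣-+ (frobenius-+ pp (_ , P , refl) (_ , Q , refl)) (∣-+ (frobenius P) (frobenius Q)))

    -- p is unramified in ℤ[η]: Frobenius followed by the inverse conjugation
    -- recovers u from u ^ p modulo p.
    p-unramified : ∀ {u} → ℤ[η] u → ι (+ p) ∣ u ^ ℕ.pred p within ℤ[η] → ι (+ p) ∣ u within ℤ[η]
    p-unramified {u} (U , PU , u≈U) p∣uⁿ =
      let
        w , (V , PV , w≈V) , eq = ∣-resp
          (solve 2 (λ a b → a :- (a :- b) := b) refl (U η ^ p) (U (η ^ p)))
          (∣-+ p∣Uᵖ (∣-neg (frobenius PU)))
        r , e , pr≡1+eq = inverse-mod p qp (prime∤prime pp qp p≢q)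
        q∤r = λ (q∣r : q ℕ.∣ r) → ℕ.>⇒∤ (prime>1 qp) (ℕ.∣m+n∣m⇒∣n
          (≡.subst (q ℕ.∣_) (≡.trans pr≡1+eq (ℕ.+-comm 1 _)) (ℕ.∣n⇒∣m*n p q∣r)) (ℕ.n∣m*n e))
        -- U (x ^ p) - p * V x vanishes at η, hence also at `η ^ r`, where (η ^ r) ^ p is η again
        -- because `r` inverts `p` modulo `q`.
        diff = conjugate {λ x → U (x ^ p) - ι (+ p) * V x} {r}
          (P.poly-+ (P.poly-∘^ p PU) (P.poly-neg
            (P.poly-* (P.poly-const (IsSubring.ι∈ integral-subring (+ p))) PV)))
          (x≈y⇒x∙y⁻¹≈ε (trans eq (*-congˡ w≈V))) q∤r
        η^rp≈η = trans (^-assocʳ η r p) (trans (^-congʳ η (≡.trans (ℕ.*-comm r p) pr≡1+eq))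
          (trans (^-+* 1 e η^q≈1) (*-identityʳ η)))
      in V (η ^ r) , (_ , P.poly-∘^ r PV , refl) , (begin
        u                       ≈⟨ u≈U ⟩
        U η                     ≈⟨ P.poly-cong PU η^rp≈η ⟨
        U ((η ^ r) ^ p)         ≈⟨ x∙y⁻¹≈ε⇒x≈y _ _ diff ⟩
        ι (+ p) * V (η ^ r)     ∎)
      where
      p∣Uᵖ : ι (+ p) ∣ U η ^ p within ℤ[η]
      p∣Uᵖ = ∣-resp
        (begin
          u ^ ℕ.pred p * u       ≈⟨ *-comm _ _ ⟩
          u ^ suc (ℕ.pred p)     ≡⟨ ≡.cong (u ^_) (ℕ.suc-pred p) ⟩
          u ^ p                  ≈⟨ ^-congˡ p u≈U ⟩
          U η ^ p                ∎)
        (∣-*ʳ p∣uⁿ (U , PU , u≈U))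

    -- Expanding the quotient by `p` in powers of η gives a relation with coefficients M y - p * B
    -- y, which must all be equal. Hence only differences are controlled, here from the last fibre.
    coefficients-mod : ∀ n (r Y : ℕ → ℕ) → (∀ c → c ℕ.< n → Y c ℕ.< q) →
      ι (+ p) ∣ ∑< n (λ c → ι (+ r c) * η ^ Y c) within ℤ[η] →
      ∀ {y} → y ℕ.< q → (+ p) ℤ.∣ + fibre n Y r y ℤ.- + fibre n Y r (ℕ.pred q)
    coefficients-mod n r Y Y<q (w , (V , PV , w≈V) , eq) {y} y<q =
      let
        B , V≈ = reduce PV
        const = coefficients-constant (λ y → + M y ℤ.- + p ℤ.* B y) (begin
          ∑< q (λ y → ι (+ M y ℤ.- + p ℤ.* B y) * η ^ y)
            ≈⟨ ∑-cong q (λ y _ → trans (*-congʳ (trans (ι-+ (+ M y) (ℤ.- (+ p ℤ.* B y)))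
                 (+-congˡ (trans (ι-neg (+ p ℤ.* B y)) (-‿cong (ι-* (+ p) (B y)))))))
                 (solve 4 (λ m p b e → (m :- p :* b) :* e := m :* e :+ (:- p) :* (b :* e)) refl (ι (+ M y)) (ι (+ p)) (ι (B y)) (η ^ y))) ⟩
          ∑< q (λ y → ι (+ M y) * η ^ y + - ι (+ p) * (ι (B y) * η ^ y))
            ≈⟨ ∑-+ q _ _ ⟩
          ∑< q (λ y → ι (+ M y) * η ^ y) + ∑< q (λ y → - ι (+ p) * (ι (B y) * η ^ y))
            ≈⟨ +-cong (trans (sym collect) (trans eq (*-congˡ (trans w≈V (V≈ η^q≈1)))))
                 (sym (∑-*ˡ q (- ι (+ p)) _)) ⟩
          ι (+ p) * S B + - ι (+ p) * S B
            ≈⟨ solve 2 (λ p s → p :* s :+ (:- p) :* s := con (+ 0)) refl (ι (+ p)) (S B) ⟩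
          0# ∎) y<q
      in ℤ.divides (B y ℤ.- B (ℕ.pred q)) (difference (+ M y) (+ M (ℕ.pred q)) (+ p) (B y) (B (ℕ.pred q)) const)
      where
      M : ℕ → ℕ
      M = fibre n Y r
      S : (ℕ → ℤ) → Carrier
      S B = ∑< q (λ y → ι (B y) * η ^ y)
      collect : ∑< n (λ c → ι (+ r c) * η ^ Y c) ≈ ∑< q (λ y → ι (+ M y) * η ^ y)
      collect = begin
        ∑< n (λ c → ι (+ r c) * η ^ Y c)
          ≈⟨ ∑-cong n (λ c c<n → sym (∑-δ (Y<q c c<n) (λ y → ι (+ r c) * η ^ y))) ⟩
        ∑< n (λ c → ∑< q (λ y → δ (Y c) y * (ι (+ r c) * η ^ y)))
          ≈⟨ ∑-swap n q _ ⟩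
        ∑< q (λ y → ∑< n (λ c → δ (Y c) y * (ι (+ r c) * η ^ y)))
          ≈⟨ ∑-cong q (λ y _ → ∑-cong n (λ c _ → trans
               (solve 3 (λ a b c → a :* (b :* c) := c :* (a :* b)) refl (δ (Y c) y) (ι (+ r c)) (η ^ y))
               (*-congˡ (trans (*-congʳ (sym (ι-δ (Y c) y)))
                 (trans (sym (ι-* (+ ℕΣ.δ (Y c) y) (+ r c))) (reflexive (≡.cong ι (≡.sym (ℤ.pos-* (ℕΣ.δ (Y c) y) (r c)))))))))) ⟩
        ∑< q (λ y → ∑< n (λ c → η ^ y * ι (+ (ℕΣ.δ (Y c) y ℕ.* r c))))
          ≈⟨ ∑-cong q (λ y _ → trans (sym (∑-*ˡ n (η ^ y) _))
               (trans (*-comm _ _) (*-congʳ (sym (ι-∑ n _))))) ⟩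
        ∑< q (λ y → ι (+ M y) * η ^ y) ∎
      open ℤ-Solver using () renaming (solve to solveℤ; _:=_ to _:=ℤ_; _:+_ to _:+ℤ_; _:*_ to _:*ℤ_; _:-_ to _:-ℤ_)
      difference : ∀ m m′ p b b′ → m ℤ.- p ℤ.* b ≡ m′ ℤ.- p ℤ.* b′ →
                   m ℤ.- m′ ≡ (b ℤ.- b′) ℤ.* p
      difference m m′ p b b′ eq = ≡.trans
        (solveℤ 4 (λ m m′ p b → m :-ℤ m′ :=ℤ (m :-ℤ p :*ℤ b) :+ℤ (p :*ℤ b :-ℤ m′)) ≡.refl m m′ p b)
        (≡.trans (≡.cong (ℤ._+ (p ℤ.* b ℤ.- m′)) eq)
          (solveℤ 4 (λ m′ p b b′ → (m′ :-ℤ p :*ℤ b′) :+ℤ (p :*ℤ b :-ℤ m′) :=ℤ (b :-ℤ b′) :*ℤ p) ≡.refl m′ p b b′))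

    module _ {ζ : Carrier} (ζ^p≈1 : ζ ^ p ≈ 1#) (ζ≉1 : ¬ (ζ ≈ 1#)) where

      open PrimitiveRoot pp ζ^p≈1 ζ≉1 using (poly-root⇒∣)
      open Polynomials subring

      ζ-root⇒∣ : ∀ {f} → Poly ℤ[η] f → f ζ ≈ 0# → ι (+ p) ∣ f 1# within ℤ[η]
      ζ-root⇒∣ P fζ≈0 = p-unramified (poly-∈ 1∈ P) (poly-root⇒∣ subring P fζ≈0)

      module VanishingSum n (X Y : ℕ → ℕ) (vanish : ∑< n (λ c → η ^ Y c * ζ ^ X c) ≈ 0#) where

        -- Σ η ^ Y c * x ^ X c is a polynomial in x over ℤ[η] with the root ζ, and at 1 the powers
        -- of x disappear.
        columns : ι (+ p) ∣ ∑< n (λ c → η ^ Y c) within ℤ[η]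
        columns = ∣-resp
          (∑-cong n (λ c _ → trans (*-congˡ (1^n≈1 (X c))) (*-identityʳ _)))
          (ζ-root⇒∣ (poly-∑ n {λ c x → η ^ Y c * x ^ X c}
            (λ c _ → mono _ (η^∈ (Y c)) (X c) (λ _ → refl))) vanish)

        -- Subtracting v (1 + x + … + x ^ (p - 1)) from Σ η ^ Y c x ^ X c makes it
        -- vanish at 1 as well; G is its quotient by x - 1.
        moments : ∀ m → ℕΣ.∑< p id ≡ p ℕ.* m → ι (+ p) ∣ ∑< n (λ c → ι (+ X c) * η ^ Y c) within ℤ[η]
        moments m gauss = let v , v∈ , eq = columns in moments′ v v∈ eq
          where
          module _ (v : Carrier) (v∈ : ℤ[η] v) (eq : ∑< n (λ c → η ^ Y c) ≈ ι (+ p) * v) where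
            G : Carrier → Carrier
            G x = ∑< n (λ c → η ^ Y c * bracket (X c) x) - v * ∑< p (λ i → bracket i x)

            bracket-poly : ∀ j → Poly ℤ[η] (bracket j)
            bracket-poly j = poly-∑ j (λ i _ → poly-^ i)

            G-poly : Poly ℤ[η] G
            G-poly = poly-+
              (poly-∑ n {λ c x → η ^ Y c * bracket (X c) x} (λ c _ → poly-* (poly-const (η^∈ (Y c))) (bracket-poly (X c))))
              (poly-neg (poly-* (poly-const v∈) (poly-∑ p {bracket} (λ i _ → bracket-poly i))))

            telescope : ∀ k (f : ℕ → Carrier) (g : ℕ → ℕ) →
              (ζ - 1#) * ∑< k (λ c → f c * bracket (g c) ζ) ≈ ∑< k (λ c → f c * ζ ^ g c) + - 1# * ∑< k f
            telescope k f g = begin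
              (ζ - 1#) * ∑< k (λ c → f c * bracket (g c) ζ)
                ≈⟨ ∑-*ˡ k _ _ ⟩
              ∑< k (λ c → (ζ - 1#) * (f c * bracket (g c) ζ))
                ≈⟨ ∑-cong k (λ c _ → trans (solve 3 (λ z a b → z :* (a :* b) := a :* (z :* b)) refl (ζ - 1#) (f c) (bracket (g c) ζ))
                     (trans (*-congˡ (geometric ζ (g c))) (solve 2 (λ a z → a :* (z :- con (+ 1)) := a :* z :+ (:- con (+ 1)) :* a) refl (f c) (ζ ^ g c)))) ⟩
              ∑< k (λ c → f c * ζ ^ g c + - 1# * f c)
                ≈⟨ ∑-+ k _ _ ⟩
              ∑< k (λ c → f c * ζ ^ g c) + ∑< k (λ c → - 1# * f c)
                ≈⟨ +-congˡ (∑-*ˡ k (- 1#) f) ⟨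
              ∑< k (λ c → f c * ζ ^ g c) + - 1# * ∑< k f ∎

            -- With f x = Σ η ^ Y c * x ^ X c, the product (ζ - 1) * G ζ is f ζ - f 1 + v * p, where
            -- f ζ = 0 and f 1 = p * v.
            G-root : G ζ ≈ 0#
            G-root = *-cancel (begin
              (ζ - 1#) * G ζ
                ≈⟨ solve 4 (λ z a v b → z :* (a :- v :* b) := z :* a :- v :* (z :* b)) refl (ζ - 1#) _ v _ ⟩
              (ζ - 1#) * ∑< n (λ c → η ^ Y c * bracket (X c) ζ) - v * ((ζ - 1#) * ∑< p (λ i → bracket i ζ))
                ≈⟨ +-cong (telescope n (λ c → η ^ Y c) X) (-‿cong (*-congˡ (trans (*-congˡ (∑-cong p (λ i _ → sym (*-identityˡ _)))) (telescope p (λ _ → 1#) id)))) ⟩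
              (∑< n (λ c → η ^ Y c * ζ ^ X c) + - 1# * ∑< n (λ c → η ^ Y c)) - v * (∑< p (λ i → 1# * ζ ^ i) + - 1# * ∑< p (λ _ → 1#))
                ≈⟨ +-cong (+-cong vanish (*-congˡ eq)) (-‿cong (*-congˡ (+-cong
                     (trans (∑-cong p (λ i _ → *-identityˡ _)) (∑-roots p ζ^p≈1 ζ≉1)) (*-congˡ (∑-const p 1#))))) ⟩
              (0# + - 1# * (ι (+ p) * v)) - v * (0# + - 1# * (ι (+ p) * 1#))
                ≈⟨ solve 2 (λ p v → (con (+ 0) :+ (:- con (+ 1)) :* (p :* v)) :- v :* (con (+ 0) :+ (:- con (+ 1)) :* (p :* con (+ 1))) := con (+ 0)) refl (ι (+ p)) v ⟩
              0# ∎) (ζ≉1 ∘ x∙y⁻¹≈ε⇒x≈y ζ 1#)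

            moments′ : ι (+ p) ∣ ∑< n (λ c → ι (+ X c) * η ^ Y c) within ℤ[η]
            -- At 1 every bracket becomes its exponent, and the correction is v * (0 + ... + (p -
            -- 1)) = v * p * m, a multiple of `p`.
            moments′ = ∣-resp (begin
                G 1# + ι (+ p) * (ι (+ m) * v)
                  ≈⟨ +-congʳ (+-cong (∑-cong n (λ c _ → trans (*-congˡ (bracket-1 (X c))) (*-comm _ _)))
                       (-‿cong (*-congˡ (trans (∑-cong p (λ i _ → bracket-1 i)) (trans (sym (ι-∑ p id))
                         (trans (reflexive (≡.cong ι (≡.trans (≡.cong +_ gauss) (ℤ.pos-* p m)))) (ι-* (+ p) (+ m)))))))) ⟩
                ∑< n (λ c → ι (+ X c) * η ^ Y c) - v * (ι (+ p) * ι (+ m)) + ι (+ p) * (ι (+ m) * v)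
                  ≈⟨ solve 4 (λ a v p m → a :- v :* (p :* m) :+ p :* (m :* v) := a) refl _ v (ι (+ p)) (ι (+ m)) ⟩
                ∑< n (λ c → ι (+ X c) * η ^ Y c) ∎)
              (∣-+ (ζ-root⇒∣ G-poly G-root) (∣-* (*∈ (×∈ m) v∈)))

  -- Passing from roots of unity to exponents.

  finite-choice : ∀ n {P : ℕ → ℕ → Set} → (∀ i → ¬ ¬ (∃[ a ] P i a)) →
                  ¬ ¬ (Σ[ a ∈ (ℕ → ℕ) ] (∀ i → i ℕ.< n → P i (a i)))
  finite-choice zero _ k = k ((λ _ → 0) , λ _ ())
  finite-choice (suc n) {P} e k = e 0 λ (a₀ , P₀) → finite-choice n (e ∘ suc) λ (a , Pₙ) →
    k ((λ { zero → a₀ ; (suc i) → a i }) , λ { zero _ → P₀ ; (suc i) (s≤s i<n) → Pₙ i i<n })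

  -- The generator is one of the given roots: any w i other than 1 is primitive because `p` is
  -- prime, and the others are powers of it. Whether such an `i` exists is undecidable, hence the
  -- double negation.
  logarithms : ∀ {p} → Prime p → ∀ n (w : ℕ → Carrier) → (∀ i → w i ^ p ≈ 1#) →
    ¬ ¬ ((∀ i → w i ≈ 1#) ⊎
         ∃[ ζ ] ζ ^ p ≈ 1# × ¬ (ζ ≈ 1#) ×
           (Σ[ a ∈ (ℕ → ℕ) ] (∀ i → i ℕ.< n → w i ≈ ζ ^ a i)))
  logarithms pp n w w^p≈1 k = k (inj₁ λ i → stable λ wᵢ≉1 →
    finite-choice n (λ j → PrimitiveRoot.discrete-log pp (w^p≈1 i) wᵢ≉1 (w^p≈1 j)) λ (a , eq) →
      k (inj₂ (w i , w^p≈1 i , wᵢ≉1 , a , eq)))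

  ∑-roots≈0⇒∣ : ∀ {p} → Prime p → ∀ n (w : ℕ → Carrier) → (∀ i → w i ^ p ≈ 1#) →
                ∑< n w ≈ 0# → p ℕ.∣ n
  ∑-roots≈0⇒∣ {p} pp n w w^p≈1 eq = decidable-stable (p ℕ.∣? n) λ p∤n →
    logarithms pp n w w^p≈1 λ
      { (inj₁ w≈1) → p∤n (≡.subst (p ℕ.∣_) (≡.sym (ℤ.+-injective (ι≈0⇒≡0 (+ n) (begin
          ι (+ n)            ≈⟨ *-identityʳ _ ⟨
          ι (+ n) * 1#       ≈⟨ ∑-const n 1# ⟨
          ∑< n (λ _ → 1#)    ≈⟨ ∑-cong n (λ i _ → w≈1 i) ⟨
          ∑< n w             ≈⟨ eq ⟩
          0#                 ∎)))) (p ℕ.∣0))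
      ; (inj₂ (ζ , ζ^p≈1 , ζ≉1 , a , w≈)) → p∤n (PrimitiveRoot.∑ζ^≈0⇒∣ pp ζ^p≈1 ζ≉1 n a
          (trans (∑-cong n (λ i i<n → sym (w≈ i i<n))) eq)) }

  -- `y` is the inverse of u′ * v′, so if the first parts agree the product is v / v′.
  ratio-root : ∀ q {u v u′ v′ y} → u ≈ u′ → v ^ q ≈ 1# → v′ ^ q ≈ 1# → u′ * v′ * y ≈ 1# →
               (u * v * y) ^ q ≈ 1#
  ratio-root q {u} {v} {u′} {v′} {y} u≈u′ v^q≈1 v′^q≈1 eq = begin
    (u * v * y) ^ q             ≈⟨ expand u v y ⟩
    u ^ q * v ^ q * y ^ q       ≈⟨ *-congʳ (*-cong (^-congˡ q u≈u′) (trans v^q≈1 (sym v′^q≈1))) ⟩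
    u′ ^ q * v′ ^ q * y ^ q     ≈⟨ expand u′ v′ y ⟨
    (u′ * v′ * y) ^ q           ≈⟨ ^-congˡ q eq ⟩
    1# ^ q                      ≈⟨ 1^n≈1 q ⟩
    1#                          ∎
    where
    expand : ∀ a b c → (a * b * c) ^ q ≈ a ^ q * b ^ q * c ^ q
    expand a b c = trans (^-distrib-* (a * b) c q) (*-congʳ (^-distrib-* a b q))

  -- The exponent a + (p - 1) * b stands for a - b; differences of exponents are encoded in this way
  -- throughout.
  inverse-exponent : ∀ {x} p .{{_ : ℕ.NonZero p}} → x ^ p ≈ 1# → ∀ a b →
                     x ^ (a ℕ.+ ℕ.pred p ℕ.* b) * x ^ b ≈ x ^ a
  inverse-exponent {x} p x^p≈1 a b = begin
    x ^ (a ℕ.+ ℕ.pred p ℕ.* b) * x ^ b   ≈⟨ ^-homo-* x (a ℕ.+ ℕ.pred p ℕ.* b) b ⟨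
    x ^ (a ℕ.+ ℕ.pred p ℕ.* b ℕ.+ b)     ≡⟨ ≡.cong (x ^_) (S.solve 3 (λ a b k → a S.:+ k S.:* b S.:+ b S.:= a S.:+ b S.:* (S.con 1 S.:+ k)) ≡.refl a b (ℕ.pred p)) ⟩
    x ^ (a ℕ.+ b ℕ.* suc (ℕ.pred p))     ≡⟨ ≡.cong (λ k → x ^ (a ℕ.+ b ℕ.* k)) (ℕ.suc-pred p) ⟩
    x ^ (a ℕ.+ b ℕ.* p)                  ≈⟨ ^-+* a b x^p≈1 ⟩
    x ^ a                                ∎
    where module S = ℕ-Solver

  inverse-unique : ∀ {x y z} → x * y ≈ 1# → x * z ≈ 1# → y ≈ z
  inverse-unique {x} {y} {z} xy≈1 xz≈1 = begin
    y             ≈⟨ *-identityʳ y ⟨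
    y * 1#        ≈⟨ *-congˡ xz≈1 ⟨
    y * (x * z)   ≈⟨ solve 3 (λ x y z → y :* (x :* z) := x :* y :* z) refl x y z ⟩
    x * y * z     ≈⟨ *-congʳ xy≈1 ⟩
    1# * z        ≈⟨ *-identityˡ z ⟩
    z             ∎

  split-root : ∀ {p q} → Prime p → ¬ p ℕ.∣ q → ∀ {z} → z ^ (p ℕ.* q) ≈ 1# →
               ∃[ u ] ∃[ v ] u ^ p ≈ 1# × v ^ q ≈ 1# × u * v ≈ z
  split-root {p} {q} pp p∤q {z} z^pq≈1 =
    -- From 1 = q * s - e * p, the two parts are z ^ (q * s) and z ^ (- e * p); `l` expresses the
    -- negative exponent modulo p * q.
    let s , e , qs≡1+ep = inverse-mod q pp p∤q
        l = ℕ.pred (p ℕ.* q) ℕ.* (e ℕ.* p)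
    in z ^ (q ℕ.* s) , z ^ l
      , trans (^-assocʳ z (q ℕ.* s) p) (^-∣ z^pq≈1 (ℕ.divides s
          (S.solve 3 (λ p q s → q S.:* s S.:* p S.:= s S.:* (p S.:* q)) ≡.refl p q s)))
      , trans (^-assocʳ z l q) (^-∣ z^pq≈1 (ℕ.divides (ℕ.pred (p ℕ.* q) ℕ.* e)
          (S.solve 4 (λ p q k e → k S.:* (e S.:* p) S.:* q S.:= k S.:* e S.:* (p S.:* q)) ≡.refl p q (ℕ.pred (p ℕ.* q)) e)))
      , (begin
        z ^ (q ℕ.* s) * z ^ l               ≈⟨ *-congʳ (^-congʳ z qs≡1+ep) ⟩
        z ^ (1 ℕ.+ e ℕ.* p) * z ^ l         ≈⟨ solve 3 (λ a b c → a :* b :* c := a :* (c :* b)) refl z (z ^ (e ℕ.* p)) (z ^ l) ⟩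
        z * (z ^ l * z ^ (e ℕ.* p))         ≈⟨ *-congˡ (inverse-exponent (p ℕ.* q) z^pq≈1 0 (e ℕ.* p)) ⟩
        z * 1#                              ≈⟨ *-identityʳ z ⟩
        z                                   ∎)
    where
    module S = ℕ-Solver
    instance
      _ = prime⇒nonZero pp
      q-nonZero : ℕ.NonZero q
      q-nonZero = ℕ.≢-nonZero λ { ≡.refl → p∤q (p ℕ.∣0) }
      pq-nonZero : ℕ.NonZero (p ℕ.* q)
      pq-nonZero = ℕ.m*n≢0 p q

  -- The contradiction, for periodic sequences of roots of unity.

  module _ {p q} (pp : Prime p) (qp : Prime q) (p≢q : p ≢ q)
    (m m′ : ℕ) (p-odd : p ≡ 1 ℕ.+ 2 ℕ.* m) (q-odd : q ≡ 1 ℕ.+ 2 ℕ.* m′) where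

    private
      instance
        p-nonZero = prime⇒nonZero pp
        q-nonZero = prime⇒nonZero qp
        n-nonZero : ℕ.NonZero (p ℕ.+ q)
        n-nonZero = ℕ.>-nonZero (ℕ.≤-trans (ℕ.<⇒≤ (prime>1 pp)) (ℕ.m≤m+n p q))
      n = p ℕ.+ q
      p∤q : ¬ p ℕ.∣ q
      p∤q = prime∤prime qp pp (p≢q ∘ ≡.sym)
      q∤p : ¬ q ℕ.∣ p
      q∤p = prime∤prime pp qp p≢q

    module _ (U V h⁻¹ : ℕ → Carrier) (U-mod : ∀ i → U i ≈ U (i % n)) (V-mod : ∀ i → V i ≈ V (i % n))
      (U^p≈1 : ∀ i → U i ^ p ≈ 1#) (V^q≈1 : ∀ i → V i ^ q ≈ 1#)
      (inverse : ∀ i → U i * V i * h⁻¹ i ≈ 1#)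
      (orthogonal : ∀ k → 0 ℕ.< k → k ℕ.< n → ∑< n (λ c → U c * V c * h⁻¹ (c ℕ.+ k)) ≈ 0#) where

      private
        orthogonal₁ : ∑< n (λ c → U c * V c * h⁻¹ (c ℕ.+ 1)) ≈ 0#
        orthogonal₁ = orthogonal 1 (s≤s z≤n)
          (ℕ.<-≤-trans (prime>1 pp) (ℕ.m≤m+n p q))

      constant-U⇒⊥ : (∀ i j → U i ≈ U j) → ⊥
      constant-U⇒⊥ const = q∤p (ℕ.∣m+n∣m⇒∣n
        (≡.subst (q ℕ.∣_) (ℕ.+-comm p q) (∑-roots≈0⇒∣ qp n _
          (λ c → ratio-root q (const c (c ℕ.+ 1)) (V^q≈1 c) (V^q≈1 (c ℕ.+ 1)) (inverse (c ℕ.+ 1)))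
          orthogonal₁))
        ℕ.∣-refl)

      constant-V⇒⊥ : (∀ i j → V i ≈ V j) → ⊥
      constant-V⇒⊥ const = p∤q (ℕ.∣m+n∣m⇒∣n
        (∑-roots≈0⇒∣ pp n _
          (λ c → trans (^-congˡ p (*-congʳ (*-comm (U c) (V c))))
            (ratio-root p (const c (c ℕ.+ 1)) (U^p≈1 c) (U^p≈1 (c ℕ.+ 1))
              (trans (*-congʳ (*-comm _ _)) (inverse (c ℕ.+ 1)))))
          orthogonal₁)
        ℕ.∣-refl)

      module _ {ζ η} (ζ^p≈1 : ζ ^ p ≈ 1#) (ζ≉1 : ¬ (ζ ≈ 1#)) (η^q≈1 : η ^ q ≈ 1#) (η≉1 : ¬ (η ≈ 1#))
        (a b : ℕ → ℕ) (U≈ : ∀ i → i ℕ.< n → U i ≈ ζ ^ a i) (V≈ : ∀ i → i ℕ.< n → V i ≈ η ^ b i) where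

        private
          a′ b′ : ℕ → ℕ
          a′ i = a (i % n)
          b′ i = b (i % n)

          U≈′ : ∀ i → U i ≈ ζ ^ a′ i
          U≈′ i = trans (U-mod i) (U≈ (i % n) (m%n<n i n))

          V≈′ : ∀ i → V i ≈ η ^ b′ i
          V≈′ i = trans (V-mod i) (V≈ (i % n) (m%n<n i n))

          h⁻¹≈ : ∀ i → h⁻¹ i ≈ ζ ^ (ℕ.pred p ℕ.* a′ i) * η ^ (ℕ.pred q ℕ.* b′ i)
          h⁻¹≈ i = inverse-unique (inverse i) (begin
            U i * V i * (ζ ^ (ℕ.pred p ℕ.* a′ i) * η ^ (ℕ.pred q ℕ.* b′ i))
              ≈⟨ *-congʳ (*-cong (U≈′ i) (V≈′ i)) ⟩
            ζ ^ a′ i * η ^ b′ i * (ζ ^ (ℕ.pred p ℕ.* a′ i) * η ^ (ℕ.pred q ℕ.* b′ i))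
              ≈⟨ solve 4 (λ a b c d → a :* b :* (c :* d) := c :* a :* (d :* b)) refl _ _ _ _ ⟩
            ζ ^ (ℕ.pred p ℕ.* a′ i) * ζ ^ a′ i * (η ^ (ℕ.pred q ℕ.* b′ i) * η ^ b′ i)
              ≈⟨ *-cong (inverse-exponent p ζ^p≈1 0 (a′ i)) (inverse-exponent q η^q≈1 0 (b′ i)) ⟩
            1# * 1#
              ≈⟨ *-identityˡ 1# ⟩
            1# ∎)

          a′-periodic : ∀ i → a′ (i ℕ.+ n) ≡ a′ i
          a′-periodic i = ≡.cong a ([m+n]%n≡m%n i n)

          b′-periodic : ∀ i → b′ (i ℕ.+ n) ≡ b′ i
          b′-periodic i = ≡.cong b ([m+n]%n≡m%n i n)

          -- Modulo `r` the summand is f c - f (c + k), and the sum of `f` over a period does not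
          -- depend on where it starts.
          ∣-difference-sum : ∀ r .{{_ : ℕ.NonZero r}} f k → (∀ i → f (i ℕ.+ n) ≡ f i) →
            r ℕ.∣ ℕΣ.∑< n (λ c → f c ℕ.+ ℕ.pred r ℕ.* f (c ℕ.+ k))
          ∣-difference-sum r f k per = ℕ.divides (ℕΣ.∑< n f) (E.begin
            ℕΣ.∑< n (λ c → f c ℕ.+ ℕ.pred r ℕ.* f (c ℕ.+ k))
              E.≡⟨ ℕΣ.∑-+ n f _ ⟩
            ℕΣ.∑< n f ℕ.+ ℕΣ.∑< n (λ c → ℕ.pred r ℕ.* f (c ℕ.+ k))
              E.≡⟨ ≡.cong (ℕΣ.∑< n f ℕ.+_) (≡.trans (≡.sym (ℕΣ.∑-*ˡ n (ℕ.pred r) (λ c → f (c ℕ.+ k))))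
                   (≡.cong (ℕ.pred r ℕ.*_) (ℕΣ.∑-rotate n k f per))) ⟩
            suc (ℕ.pred r) ℕ.* ℕΣ.∑< n f
              E.≡⟨ ≡.cong (ℕ._* ℕΣ.∑< n f) (ℕ.suc-pred r) ⟩
            r ℕ.* ℕΣ.∑< n f
              E.≡⟨ ℕ.*-comm r _ ⟩
            ℕΣ.∑< n f ℕ.* r E.∎)
            where module E = ≡.≡-Reasoning

        -- If the q-parts differ, the quotient of the two entries lies outside the fibre over 0, and
        -- there its ζ-exponent is a multiple of `p`.
        rows-share-part : ∀ k → 0 ℕ.< k → k ℕ.< n → ∀ c → c ℕ.< n →
                          ¬ (V c ≈ V (c ℕ.+ k)) → U c ≈ U (c ℕ.+ k)
        rows-share-part k 0<k k<n c c<n V≉ = begin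
          U c                               ≈⟨ U≈′ c ⟩
          ζ ^ a′ c                          ≈⟨ inverse-exponent p ζ^p≈1 (a′ c) (a′ (c ℕ.+ k)) ⟨
          ζ ^ X c * ζ ^ a′ (c ℕ.+ k)        ≈⟨ *-congʳ (^-∣ ζ^p≈1 p∣Xc) ⟩
          1# * ζ ^ a′ (c ℕ.+ k)             ≈⟨ *-identityˡ _ ⟩
          ζ ^ a′ (c ℕ.+ k)                  ≈⟨ U≈′ (c ℕ.+ k) ⟨
          U (c ℕ.+ k)                       ∎
          where
          -- Exponents of ζ and η in the quotient of entries `c` and `c + k`. Only the second is
          -- reduced, as its values index the fibres.
          X Ŷ Y : ℕ → ℕ
          X c = a′ c ℕ.+ ℕ.pred p ℕ.* a′ (c ℕ.+ k)
          Ŷ c = b′ c ℕ.+ ℕ.pred q ℕ.* b′ (c ℕ.+ k)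
          Y c = Ŷ c % q

          Y<q : ∀ c → Y c ℕ.< q
          Y<q c = m%n<n (Ŷ c) q

          open CoprimeCyclotomic pp qp p≢q η^q≈1 η≉1

          relation : ∑< n (λ c → η ^ Y c * ζ ^ X c) ≈ 0#
          relation = trans (∑-cong n (λ c _ → begin
            η ^ Y c * ζ ^ X c
              ≈⟨ *-cong (sym (^-% q (Ŷ c) η^q≈1)) refl ⟩
            η ^ Ŷ c * ζ ^ X c
              ≈⟨ *-cong (^-homo-* η (b′ c) _) (^-homo-* ζ (a′ c) _) ⟩
            η ^ b′ c * η ^ (ℕ.pred q ℕ.* b′ (c ℕ.+ k)) * (ζ ^ a′ c * ζ ^ (ℕ.pred p ℕ.* a′ (c ℕ.+ k)))
              ≈⟨ solve 4 (λ a b c d → a :* b :* (c :* d) := c :* a :* (d :* b)) refl _ _ _ _ ⟩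
            ζ ^ a′ c * η ^ b′ c * (ζ ^ (ℕ.pred p ℕ.* a′ (c ℕ.+ k)) * η ^ (ℕ.pred q ℕ.* b′ (c ℕ.+ k)))
              ≈⟨ *-cong (*-cong (U≈′ c) (V≈′ c)) (h⁻¹≈ (c ℕ.+ k)) ⟨
            U c * V c * h⁻¹ (c ℕ.+ k) ∎)) (orthogonal k 0<k k<n)

          module R = VanishingSum ζ^p≈1 ζ≉1 n X Y relation

          Yc≢0 : Y c ≢ 0
          Yc≢0 Yc≡0 = V≉ (begin
            V c                            ≈⟨ V≈′ c ⟩
            η ^ b′ c                       ≈⟨ inverse-exponent q η^q≈1 (b′ c) (b′ (c ℕ.+ k)) ⟨
            η ^ Ŷ c * η ^ b′ (c ℕ.+ k)     ≈⟨ *-congʳ (trans (^-% q (Ŷ c) η^q≈1) (^-congʳ η Yc≡0)) ⟩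
            1# * η ^ b′ (c ℕ.+ k)          ≈⟨ *-identityˡ _ ⟩
            η ^ b′ (c ℕ.+ k)               ≈⟨ V≈′ (c ℕ.+ k) ⟨
            V (c ℕ.+ k)                    ∎)

          p∣Xc : p ℕ.∣ X c
          p∣Xc = Counting.off-column⇒∣ pp qp p∤q q∤p X Y Y<q
            (coefficients-mod n (λ _ → 1) Y (λ c _ → Y<q c)
              (Divisibility.∣-resp subring (∑-cong n (λ c _ → sym (*-identityˡ _))) R.columns))
            (coefficients-mod n X Y (λ c _ → Y<q c)
              (R.moments m (≡.subst (λ k → ℕΣ.∑< k id ≡ k ℕ.* m) (≡.sym p-odd) (Counting.gauss m))))
            (∣-difference-sum p a′ k a′-periodic)
            (Counting.∣∑-% n q Ŷ (∣-difference-sum q b′ k b′-periodic))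
            m′ q-odd c c<n Yc≢0

      -- Any two entries agree in their p-part or in their q-part, so either all
      -- p-parts or all q-parts coincide.
      no-circulant-Hadamard : ⊥
      no-circulant-Hadamard = logarithms pp n U U^p≈1 λ
        { (inj₁ U≈1) → constant-U⇒⊥ (λ i j → trans (U≈1 i) (sym (U≈1 j)))
        ; (inj₂ (ζ , ζ^p≈1 , ζ≉1 , a , U≈)) → logarithms qp n V V^q≈1 λ
          { (inj₁ V≈1) → constant-V⇒⊥ (λ i j → trans (V≈1 i) (sym (V≈1 j)))
          ; (inj₂ (η , η^q≈1 , η≉1 , b , V≈)) →
              rook (rows-share-part ζ^p≈1 ζ≉1 η^q≈1 η≉1 a b U≈ V≈) } }
        where
        rook : (∀ k → 0 ℕ.< k → k ℕ.< n → ∀ c → c ℕ.< n → ¬ (V c ≈ V (c ℕ.+ k)) → U c ≈ U (c ℕ.+ k)) → ⊥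
        rook share = constant-V⇒⊥ λ i j → stable λ Vᵢ≉Vⱼ → constant-U⇒⊥ λ k l →
          trans (all (i % n) (j % n) (m%n<n i n) (m%n<n j n)
                   (λ eq → Vᵢ≉Vⱼ (trans (V-mod i) (trans eq (sym (V-mod j))))) k)
            (sym (all (i % n) (j % n) (m%n<n i n) (m%n<n j n)
                   (λ eq → Vᵢ≉Vⱼ (trans (V-mod i) (trans eq (sym (V-mod j))))) l))
          where
          forward : ∀ {i j} → i ℕ.< j → j ℕ.< n → ¬ (V i ≈ V j) → U i ≈ U j
          forward {i} {j} i<j j<n V≉ = trans
            (share (j ℕ.∸ i) (ℕ.m<n⇒0<n∸m i<j) (ℕ.≤-<-trans (ℕ.m∸n≤m j i) j<n) i (ℕ.<-trans i<j j<n)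
              (λ eq → V≉ (trans eq (reflexive (≡.cong V i+[j-i]≡j)))))
            (reflexive (≡.cong U i+[j-i]≡j))
            where
            i+[j-i]≡j : i ℕ.+ (j ℕ.∸ i) ≡ j
            i+[j-i]≡j = ℕ.m+[n∸m]≡n (ℕ.<⇒≤ i<j)

          pair : ∀ {i j} → i ℕ.< n → j ℕ.< n → ¬ (V i ≈ V j) → U i ≈ U j
          pair {i} {j} i<n j<n V≉ with ℕ.<-cmp i j
          ... | tri< i<j _ _ = forward i<j j<n V≉
          ... | tri≈ _ ≡.refl _ = contradiction refl V≉
          ... | tri> _ _ j<i = sym (forward j<i i<n (V≉ ∘ sym))

          -- If the p-part at `k` differed from that at `i`, the q-parts at `k` and `i` would agree
          -- and thus differ from that at `j`; then `k`, and likewise `i`, would share its p-part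
          -- with `j`.
          all : ∀ i j → i ℕ.< n → j ℕ.< n → ¬ (V i ≈ V j) → ∀ k → U k ≈ U i
          all i j i<n j<n Vᵢ≉Vⱼ k = stable λ Uₖ≉Uᵢ →
            let k<n = m%n<n k n
                V≈Vᵢ = stable λ V≉ → Uₖ≉Uᵢ (trans (U-mod k) (pair k<n i<n V≉))
            in Uₖ≉Uᵢ (trans (U-mod k) (trans
                 (pair k<n j<n (λ V≈Vⱼ → Vᵢ≉Vⱼ (trans (sym V≈Vᵢ) V≈Vⱼ)))
                 (sym (pair i<n j<n Vᵢ≉Vⱼ))))

open import Defs

-- Null sequences of rationals.

module NullSequences where

  open import Data.Rational.Base using (ℚ; 0ℚ; 1ℚ; ½; ∣_∣; _+_; _*_; _-_; -_; _<_; _≤_; 1/_; positive; nonNegative)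
  open ℚ-Solver using (solve; _:=_; _:+_; _:*_; _:-_; :-_)
  open ℚ.≤-Reasoning

  Eventually : (ℕ → Set) → Set
  Eventually P = ∃[ N ] ∀ n → N ℕ.≤ n → P n

  always : ∀ {P} → (∀ n → P n) → Eventually P
  always p = 0 , λ n _ → p n

  map₂ : ∀ {P Q R : ℕ → Set} → (∀ n → P n → Q n → R n) →
         Eventually P → Eventually Q → Eventually R
  map₂ f (M , hM) (N , hN) = M ℕ.⊔ N , λ n n≥ →
    f n (hM n (ℕ.m⊔n≤o⇒m≤o M N n≥)) (hN n (ℕ.m⊔n≤o⇒n≤o M N n≥))

  map₁ : ∀ {P Q : ℕ → Set} → (∀ n → P n → Q n) → Eventually P → Eventually Q
  map₁ f (N , hN) = N , λ n n≥ → f n (hN n n≥)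

  Never : ∀ {P Q : ℕ → Set} → (∀ n → P n → ¬ Q n) → Eventually P → ¬ Eventually Q
  Never f p q = let N , h = map₂ f p q in h N ℕ.≤-refl

  Null : (ℕ → ℚ) → Set
  Null a = ∀ ε → 0ℚ < ε → Eventually (λ n → ∣ a n ∣ < ε)

  half : ∀ {ε} → 0ℚ < ε → 0ℚ < ½ * ε
  half {ε} 0<ε = ℚ.positive⁻¹ (½ * ε) {{ℚ.pos*pos⇒pos ½ ε {{positive 0<ε}}}}

  half+half : ∀ ε → ½ * ε + ½ * ε ≡ ε
  half+half ε = ≡.trans (≡.sym (ℚ.*-distribʳ-+ ε ½ ½)) (ℚ.*-identityˡ ε)

  null-zero : ∀ {a} → (∀ n → a n ≡ 0ℚ) → Null a
  null-zero a≡0 ε 0<ε = always λ n → ≡.subst (λ q → ∣ q ∣ < ε) (≡.sym (a≡0 n)) 0<ε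

  null-resp : ∀ {a b} → (∀ n → a n ≡ b n) → Null a → Null b
  null-resp a≡b null ε 0<ε = map₁ (λ n → ≡.subst (λ q → ∣ q ∣ < ε) (a≡b n)) (null ε 0<ε)

  null-+ : ∀ {a b} → Null a → Null b → Null (λ n → a n + b n)
  null-+ {a} {b} na nb ε 0<ε = map₂ (λ n a< b< → begin-strict
      ∣ a n + b n ∣         ≤⟨ ℚ.∣p+q∣≤∣p∣+∣q∣ (a n) (b n) ⟩
      ∣ a n ∣ + ∣ b n ∣     <⟨ ℚ.+-mono-< a< b< ⟩
      ½ * ε + ½ * ε         ≡⟨ half+half ε ⟩
      ε                     ∎)
    (na (½ * ε) (half 0<ε)) (nb (½ * ε) (half 0<ε))

  null-neg : ∀ {a} → Null a → Null (λ n → - a n)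
  null-neg {a} na ε 0<ε = map₁ (λ n → ≡.subst (_< ε) (≡.sym (ℚ.∣-p∣≡∣p∣ (a n)))) (na ε 0<ε)

  Bounded : (ℕ → ℚ) → Set
  Bounded b = ∃[ B ] 0ℚ < B × Eventually (λ n → ∣ b n ∣ ≤ B)

  null-* : ∀ {a b} → Null a → Bounded b → Null (λ n → a n * b n)
  null-* {a} {b} na (B , 0<B , b≤B) ε 0<ε = map₂ (λ n a< b≤ → begin-strict
      ∣ a n * b n ∣         ≡⟨ ℚ.∣p*q∣≡∣p∣*∣q∣ (a n) (b n) ⟩
      ∣ a n ∣ * ∣ b n ∣     ≤⟨ ℚ.*-monoˡ-≤-nonNeg (∣ a n ∣) {{ℚ.∣-∣-nonNeg (a n)}} b≤ ⟩
      ∣ a n ∣ * B           <⟨ ℚ.*-monoˡ-<-pos B {{B>0}} a< ⟩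
      ε * 1/B * B           ≡⟨ ≡.trans (ℚ.*-assoc ε 1/B B) (≡.trans (≡.cong (ε *_) (ℚ.*-inverseˡ B {{B≢0}})) (ℚ.*-identityʳ ε)) ⟩
      ε                     ∎)
    (na (ε * 1/B) (ℚ.positive⁻¹ (ε * 1/B) {{ℚ.pos*pos⇒pos ε {{positive 0<ε}} 1/B {{ℚ.1/pos⇒pos B {{B>0}}}}}})) b≤B
    where
    B>0 = positive 0<B
    B≢0 = ℚ.pos⇒nonZero B {{B>0}}
    1/B = (1/ B) {{B≢0}}

  p≤∣p∣ : ∀ p → p ≤ ∣ p ∣
  p≤∣p∣ p with ℚ.≤-total 0ℚ p
  ... | inj₁ 0≤p = ℚ.≤-reflexive (≡.sym (ℚ.0≤p⇒∣p∣≡p 0≤p))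
  ... | inj₂ p≤0 = ℚ.≤-trans p≤0 (ℚ.0≤∣p∣ p)

  p*p≡∣p∣*∣p∣ : ∀ p → p * p ≡ ∣ p ∣ * ∣ p ∣
  p*p≡∣p∣*∣p∣ p with ℚ.∣p∣≡p∨∣p∣≡-p p
  ... | inj₁ eq = ≡.sym (≡.cong₂ _*_ eq eq)
  ... | inj₂ eq = ≡.trans (solve 1 (λ p → p :* p := (:- p) :* (:- p)) ≡.refl p) (≡.sym (≡.cong₂ _*_ eq eq))

  0≤p*p : ∀ p → 0ℚ ≤ p * p
  0≤p*p p = ≡.subst (0ℚ ≤_) (≡.sym (p*p≡∣p∣*∣p∣ p))
    (ℚ.nonNegative⁻¹ (∣ p ∣ * ∣ p ∣)
      {{ℚ.nonNeg*nonNeg⇒nonNeg (∣ p ∣) {{ℚ.∣-∣-nonNeg p}} (∣ p ∣) {{ℚ.∣-∣-nonNeg p}}}})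

  -- From a² ≤ a² + b², compared with ε², so that no square root is taken.
  null-squares : ∀ {a b : ℕ → ℚ} → Null (λ n → a n * a n + b n * b n) → Null a
  null-squares {a} {b} null ε 0<ε = map₁ small (null (ε * ε) 0<ε²)
    where
    0<ε² : 0ℚ < ε * ε
    0<ε² = ℚ.positive⁻¹ (ε * ε) {{ℚ.pos*pos⇒pos ε {{positive 0<ε}} ε {{positive 0<ε}}}}
    small : ∀ n → ∣ a n * a n + b n * b n ∣ < ε * ε → ∣ a n ∣ < ε
    small n s with ∣ a n ∣ ℚ.<? ε
    ... | yes a<ε = a<ε
    ... | no a≮ε = contradiction (begin-strict
      ε * ε                       ≤⟨ ℚ.*-monoˡ-≤-nonNeg ε {{nonNegative (ℚ.<⇒≤ 0<ε)}} ε≤a ⟩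
      ε * ∣ a n ∣                 ≤⟨ ℚ.*-monoʳ-≤-nonNeg (∣ a n ∣) {{ℚ.∣-∣-nonNeg (a n)}} ε≤a ⟩
      ∣ a n ∣ * ∣ a n ∣           ≡⟨ p*p≡∣p∣*∣p∣ (a n) ⟨
      a n * a n                   ≡⟨ ℚ.+-identityʳ (a n * a n) ⟨
      a n * a n + 0ℚ              ≤⟨ ℚ.+-monoʳ-≤ (a n * a n) (0≤p*p (b n)) ⟩
      a n * a n + b n * b n       ≤⟨ p≤∣p∣ (a n * a n + b n * b n) ⟩
      ∣ a n * a n + b n * b n ∣   <⟨ s ⟩
      ε * ε                       ∎) (ℚ.<-irrefl ≡.refl)
      where ε≤a = ℚ.≮⇒≥ a≮ε

  Apart : (ℕ → ℚ) → Set
  Apart a = ∃[ d ] 0ℚ < d × Eventually (λ n → d ≤ ∣ a n ∣)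

  null⇒¬apart : ∀ {a} → Null a → ¬ Apart a
  null⇒¬apart null (d , 0<d , far) =
    Never (λ n a<d d≤a → ℚ.<-irrefl ≡.refl (ℚ.<-≤-trans a<d d≤a)) (null d 0<d) far

  null-cancel : ∀ {a b} → Null (λ n → a n * b n) → Apart b → Null a
  null-cancel {a} {b} null (d , 0<d , far) ε 0<ε = map₂ (λ n ab< d≤b →
      ℚ.*-cancelʳ-<-nonNeg d {{nonNegative (ℚ.<⇒≤ 0<d)}} (begin-strict
        ∣ a n ∣ * d           ≤⟨ ℚ.*-monoˡ-≤-nonNeg (∣ a n ∣) {{ℚ.∣-∣-nonNeg (a n)}} d≤b ⟩
        ∣ a n ∣ * ∣ b n ∣     ≡⟨ ℚ.∣p*q∣≡∣p∣*∣q∣ (a n) (b n) ⟨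
        ∣ a n * b n ∣         <⟨ ab< ⟩
        ε * d                 ∎))
    (null (ε * d) (ℚ.positive⁻¹ (ε * d) {{ℚ.pos*pos⇒pos ε {{positive 0<ε}} d {{positive 0<d}}}})) far

  module _ {a} (cauchy : IsCauchy a) where

    bounded : Bounded a
    bounded = let N , hN = cauchy 1ℚ (ℚ.positive⁻¹ 1ℚ) in
      ∣ a N ∣ + 1ℚ , ℚ.+-mono-≤-< (ℚ.0≤∣p∣ (a N)) (ℚ.positive⁻¹ 1ℚ) , N , λ n n≥ → begin
        ∣ a n ∣                       ≡⟨ ≡.cong ∣_∣ (solve 2 (λ x y → x := y :+ (x :- y)) ≡.refl (a n) (a N)) ⟩
        ∣ a N + (a n - a N) ∣         ≤⟨ ℚ.∣p+q∣≤∣p∣+∣q∣ (a N) (a n - a N) ⟩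
        ∣ a N ∣ + ∣ a n - a N ∣       ≤⟨ ℚ.+-monoʳ-≤ ∣ a N ∣ (ℚ.<⇒≤ (hN n N n≥ ℕ.≤-refl)) ⟩
        ∣ a N ∣ + 1ℚ                  ∎

    -- One comparison of rationals decides. Beyond the Cauchy index for ε / 4, |a N| < ε / 2 keeps
    -- all terms below ε, and otherwise they stay at least ε / 4 in absolute value. This is the
    -- source of the stability of equality.
    small-or-apart : ∀ ε → 0ℚ < ε → Eventually (λ n → ∣ a n ∣ < ε) ⊎ Apart a
    small-or-apart ε 0<ε with cauchy (½ * (½ * ε)) (half (half 0<ε))
    ... | N , hN with ∣ a N ∣ ℚ.<? ½ * ε
    ...   | yes aN<h = inj₁ (N , λ n n≥ → begin-strict
      ∣ a n ∣                       ≡⟨ ≡.cong ∣_∣ (solve 2 (λ x y → x := y :+ (x :- y)) ≡.refl (a n) (a N)) ⟩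
      ∣ a N + (a n - a N) ∣         ≤⟨ ℚ.∣p+q∣≤∣p∣+∣q∣ (a N) (a n - a N) ⟩
      ∣ a N ∣ + ∣ a n - a N ∣       <⟨ ℚ.+-mono-< aN<h (hN n N n≥ ℕ.≤-refl) ⟩
      ½ * ε + ½ * (½ * ε)           ≡⟨ ℚ.+-identityʳ _ ⟨
      ½ * ε + ½ * (½ * ε) + 0ℚ      <⟨ ℚ.+-monoʳ-< (½ * ε + ½ * (½ * ε)) (half (half 0<ε)) ⟩
      ½ * ε + ½ * (½ * ε) + ½ * (½ * ε) ≡⟨ ≡.trans (ℚ.+-assoc (½ * ε) _ _) (≡.cong (λ q → ½ * ε + q) (half+half (½ * ε))) ⟩
      ½ * ε + ½ * ε                 ≡⟨ half+half ε ⟩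
      ε                             ∎)
    ...   | no aN≮h = inj₂ (e , half (half 0<ε) , N , λ n n≥ → begin
      e                             ≡⟨ solve 1 (λ e → e := (e :+ e) :- e) ≡.refl e ⟩
      e + e - e                     ≡⟨ ≡.cong (_- e) (half+half (½ * ε)) ⟩
      ½ * ε - e                     ≤⟨ ℚ.+-monoˡ-≤ (- e) (ℚ.≮⇒≥ aN≮h) ⟩
      ∣ a N ∣ - e                   ≡⟨ ≡.cong (λ q → ∣ q ∣ - e) (solve 2 (λ x y → x := y :+ (x :- y)) ≡.refl (a N) (a n)) ⟩
      ∣ a n + (a N - a n) ∣ - e     ≤⟨ ℚ.+-monoˡ-≤ (- e) (ℚ.∣p+q∣≤∣p∣+∣q∣ (a n) (a N - a n)) ⟩
      ∣ a n ∣ + ∣ a N - a n ∣ - e   ≤⟨ ℚ.+-monoˡ-≤ (- e) (ℚ.+-monoʳ-≤ ∣ a n ∣ (ℚ.<⇒≤ (hN N n ℕ.≤-refl n≥))) ⟩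
      ∣ a n ∣ + e - e               ≡⟨ solve 2 (λ x e → x :+ e :- e := x) ≡.refl ∣ a n ∣ e ⟩
      ∣ a n ∣                       ∎)
      where e = ½ * (½ * ε)

    ¬apart⇒null : ¬ Apart a → Null a
    ¬apart⇒null ¬apart ε 0<ε with small-or-apart ε 0<ε
    ... | inj₁ small = small
    ... | inj₂ apart = contradiction apart ¬apart

open NullSequences

-- The ring of real numbers.

module RealField where

  open ℚ-Solver using (solve; _:=_; _:+_; _:*_; _:-_; :-_)

  -- x ≈ℝ y unfolds to a statement from which x and y cannot be inferred.
  record _≋_ (x y : ℝ) : Set where
    constructor ⌊_⌋
    field ⌈_⌉ : x ≈ℝ y

  open _≋_ public

  infix 4 _≋_

  ≋-pointwise : ∀ {x y} → (∀ n → seq x n ≡ seq y n) → x ≋ y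
  ≋-pointwise {x} {y} eq = ⌊ null-zero (λ n →
    ≡.trans (≡.cong (ℚ._- seq y n) (eq n)) (ℚ.+-inverseʳ (seq y n))) ⌋

  ≋-sym : ∀ {x y} → x ≋ y → y ≋ x
  ≋-sym {x} {y} ⌊ x≈y ⌋ = ⌊ null-resp
    (λ n → solve 2 (λ a b → :- (a :- b) := b :- a) ≡.refl (seq x n) (seq y n)) (null-neg x≈y) ⌋

  ≋-trans : ∀ {x y z} → x ≋ y → y ≋ z → x ≋ z
  ≋-trans {x} {y} {z} ⌊ x≈y ⌋ ⌊ y≈z ⌋ = ⌊ null-resp
    (λ n → solve 3 (λ a b c → (a :- b) :+ (b :- c) := a :- c) ≡.refl (seq x n) (seq y n) (seq z n))
    (null-+ x≈y y≈z) ⌋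

  +ℝ-cong : ∀ {x y u v} → x ≋ y → u ≋ v → x +ℝ u ≋ y +ℝ v
  +ℝ-cong {x} {y} {u} {v} ⌊ x≈y ⌋ ⌊ u≈v ⌋ = ⌊ null-resp
    (λ n → solve 4 (λ a b c d → (a :- b) :+ (c :- d) := (a :+ c) :- (b :+ d)) ≡.refl
      (seq x n) (seq y n) (seq u n) (seq v n))
    (null-+ x≈y u≈v) ⌋

  *ℝ-cong : ∀ {x y u v} → x ≋ y → u ≋ v → x *ℝ u ≋ y *ℝ v
  *ℝ-cong {x} {y} {u} {v} ⌊ x≈y ⌋ ⌊ u≈v ⌋ = ⌊ null-resp
    (λ n → solve 4 (λ a b c d → (a :- b) :* c :+ (c :- d) :* b := a :* c :- b :* d) ≡.refl
      (seq x n) (seq y n) (seq u n) (seq v n))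
    (null-+ (null-* x≈y (bounded (cauchy u))) (null-* u≈v (bounded (cauchy y)))) ⌋

  -ℝ-cong : ∀ {x y} → x ≋ y → -ℝ x ≋ -ℝ y
  -ℝ-cong {x} {y} ⌊ x≈y ⌋ = ⌊ null-resp
    (λ n → solve 2 (λ a b → :- (a :- b) := (:- a) :- (:- b)) ≡.refl (seq x n) (seq y n)) (null-neg x≈y) ⌋

  ℝ-commutativeRing : CommutativeRing 0ℓ 0ℓ
  ℝ-commutativeRing = record
    { Carrier = ℝ ; _≈_ = _≋_ ; _+_ = _+ℝ_ ; _*_ = _*ℝ_ ; -_ = -ℝ_ ; 0# = 0ℝ ; 1# = 1ℝ
    ; isCommutativeRing = record
      { isRing = record
        { +-isAbelianGroup = record
          { isGroup = record
            { isMonoid = record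
              { isSemigroup = record
                { isMagma = record
                  { isEquivalence = record
                    { refl = ≋-pointwise (λ _ → ≡.refl)
                    ; sym = ≋-sym
                    ; trans = ≋-trans
                    }
                  ; ∙-cong = +ℝ-cong
                  }
                ; assoc = λ x y z → ≋-pointwise (λ n → ℚ.+-assoc (seq x n) (seq y n) (seq z n))
                }
              ; identity = (λ x → ≋-pointwise (λ n → ℚ.+-identityˡ (seq x n)))
                         , (λ x → ≋-pointwise (λ n → ℚ.+-identityʳ (seq x n)))
              }
            ; inverse = (λ x → ≋-pointwise (λ n → ℚ.+-inverseˡ (seq x n)))
                      , (λ x → ≋-pointwise (λ n → ℚ.+-inverseʳ (seq x n)))
            ; ⁻¹-cong = -ℝ-cong
            }
          ; comm = λ x y → ≋-pointwise (λ n → ℚ.+-comm (seq x n) (seq y n))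
          }
        ; *-cong = *ℝ-cong
        ; *-assoc = λ x y z → ≋-pointwise (λ n → ℚ.*-assoc (seq x n) (seq y n) (seq z n))
        ; *-identity = (λ x → ≋-pointwise (λ n → ℚ.*-identityˡ (seq x n)))
                     , (λ x → ≋-pointwise (λ n → ℚ.*-identityʳ (seq x n)))
        ; distrib = (λ x y z → ≋-pointwise (λ n → ℚ.*-distribˡ-+ (seq x n) (seq y n) (seq z n)))
                  , (λ x y z → ≋-pointwise (λ n → ℚ.*-distribʳ-+ (seq x n) (seq y n) (seq z n)))
        }
      ; *-comm = λ x y → ≋-pointwise (λ n → ℚ.*-comm (seq x n) (seq y n))
      }
    }

  stable : ∀ {x y} → ¬ ¬ (x ≋ y) → x ≋ y
  stable {x} {y} ¬¬x≋y = ⌊ ¬apart⇒null (cauchy (x +ℝ -ℝ y))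
    (λ apart → ¬¬x≋y λ x≋y → null⇒¬apart ⌈ x≋y ⌉ apart) ⌋

  ≋0⇒null : ∀ {x} → x ≋ 0ℝ → Null (seq x)
  ≋0⇒null {x} ⌊ x≈0 ⌋ = null-resp (λ n → ℚ.+-identityʳ (seq x n)) x≈0

  null⇒≋0 : ∀ {x} → Null (seq x) → x ≋ 0ℝ
  null⇒≋0 {x} null = ⌊ null-resp (λ n → ≡.sym (ℚ.+-identityʳ (seq x n))) null ⌋

  -- If `y` were apart from 0, dividing by it would make `x` null; by stability, refuting apartness
  -- is enough.
  *-cancel : ∀ {x y} → x *ℝ y ≋ 0ℝ → ¬ (x ≋ 0ℝ) → y ≋ 0ℝ
  *-cancel {x} {y} xy≋0 x≉0 = null⇒≋0 (¬apart⇒null (cauchy y) λ apart →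
    x≉0 (null⇒≋0 (null-cancel (≋0⇒null xy≋0) apart)))

  sum-of-squares : ∀ {x y} → x *ℝ x +ℝ y *ℝ y ≋ 0ℝ → x ≋ 0ℝ
  sum-of-squares {x} {y} eq = null⇒≋0 (null-squares {seq x} {seq y} (≋0⇒null eq))

-- The complex numbers as a domain of characteristic 0.

module ComplexField where

  open RealField
  open CommutativeRing ℝ-commutativeRing using (trans; sym; refl; +-cong; *-cong; -‿cong; +-comm)
  open Subrings ℝ-commutativeRing using (solve; _:=_; _:+_; _:*_; _:-_; :-_; con)

  _≋ℂ_ : ℂ → ℂ → Set
  z ≋ℂ w = re z ≋ re w × im z ≋ im w

  infix 4 _≋ℂ_

  wrap : ∀ {z w} → z ≈ℂ w → z ≋ℂ w
  wrap (p , q) = ⌊ p ⌋ , ⌊ q ⌋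

  ℂ-commutativeRing : CommutativeRing 0ℓ 0ℓ
  ℂ-commutativeRing = record
    { Carrier = ℂ ; _≈_ = _≋ℂ_ ; _+_ = _+ℂ_ ; _*_ = _*ℂ_ ; -_ = -ℂ_ ; 0# = 0ℂ ; 1# = 1ℂ
    ; isCommutativeRing = record
      { isRing = record
        { +-isAbelianGroup = record
          { isGroup = record
            { isMonoid = record
              { isSemigroup = record
                { isMagma = record
                  { isEquivalence = record
                    { refl = refl , refl
                    ; sym = λ (p , q) → sym p , sym q
                    ; trans = λ (p , q) (p′ , q′) → trans p p′ , trans q q′
                    }
                  ; ∙-cong = λ (p , q) (p′ , q′) → +-cong p p′ , +-cong q q′
                  }
                ; assoc = λ (a +i b) (c +i d) (e +i f) → +-assoc a c e , +-assoc b d f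
                }
              ; identity = (λ (a +i b) → +-identityˡ a , +-identityˡ b)
                         , (λ (a +i b) → +-identityʳ a , +-identityʳ b)
              }
            ; inverse = (λ (a +i b) → -‿inverseˡ a , -‿inverseˡ b)
                      , (λ (a +i b) → -‿inverseʳ a , -‿inverseʳ b)
            ; ⁻¹-cong = λ (p , q) → -‿cong p , -‿cong q
            }
          ; comm = λ (a +i b) (c +i d) → +-comm a c , +-comm b d
          }
        ; *-cong = λ (p , q) (p′ , q′) →
            +-cong (*-cong p p′) (-‿cong (*-cong q q′)) , +-cong (*-cong p q′) (*-cong q p′)
        ; *-assoc = λ (a +i b) (c +i d) (e +i f) →
            solve 6 (λ a b c d e f → (a :* c :- b :* d) :* e :- (a :* d :+ b :* c) :* f
              := a :* (c :* e :- d :* f) :- b :* (c :* f :+ d :* e)) refl a b c d e f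
          , solve 6 (λ a b c d e f → (a :* c :- b :* d) :* f :+ (a :* d :+ b :* c) :* e
              := a :* (c :* f :+ d :* e) :+ b :* (c :* e :- d :* f)) refl a b c d e f
        ; *-identity =
            (λ (a +i b) →
              solve 2 (λ a b → con (+ 1) :* a :- con (+ 0) :* b := a) refl a b
            , solve 2 (λ a b → con (+ 1) :* b :+ con (+ 0) :* a := b) refl a b)
          , (λ (a +i b) →
              solve 2 (λ a b → a :* con (+ 1) :- b :* con (+ 0) := a) refl a b
            , solve 2 (λ a b → a :* con (+ 0) :+ b :* con (+ 1) := b) refl a b)
        ; distrib =
            (λ (a +i b) (c +i d) (e +i f) →
              solve 6 (λ a b c d e f → a :* (c :+ e) :- b :* (d :+ f)
                := (a :* c :- b :* d) :+ (a :* e :- b :* f)) refl a b c d e f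
            , solve 6 (λ a b c d e f → a :* (d :+ f) :+ b :* (c :+ e)
                := (a :* d :+ b :* c) :+ (a :* f :+ b :* e)) refl a b c d e f)
          , (λ (a +i b) (c +i d) (e +i f) →
              solve 6 (λ a b c d e f → (c :+ e) :* a :- (d :+ f) :* b
                := (c :* a :- d :* b) :+ (e :* a :- f :* b)) refl a b c d e f
            , solve 6 (λ a b c d e f → (c :+ e) :* b :+ (d :+ f) :* a
                := (c :* b :+ d :* a) :+ (e :* b :+ f :* a)) refl a b c d e f)
        }
      ; *-comm = λ (a +i b) (c +i d) →
          solve 4 (λ a b c d → a :* c :- b :* d := c :* a :- d :* b) refl a b c d
        , solve 4 (λ a b c d → a :* d :+ b :* c := c :* b :+ d :* a) refl a b c d
      }
    }
    where
    open CommutativeRing ℝ-commutativeRing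
      using (+-assoc; +-identityˡ; +-identityʳ; -‿inverseˡ; -‿inverseʳ)

  norm² : ℂ → ℝ
  norm² z = re z *ℝ re z +ℝ im z *ℝ im z

  norm²≋0⇒≋0 : ∀ {z} → norm² z ≋ 0ℝ → z ≋ℂ 0ℂ
  norm²≋0⇒≋0 {z} eq = sum-of-squares eq
    , sum-of-squares (trans (+-comm _ _) eq)

  -- The two-square identity, by which a vanishing product in ℂ becomes one in ℝ.
  norm²-* : ∀ z w → norm² (z *ℂ w) ≋ norm² z *ℝ norm² w
  norm²-* (a +i b) (c +i d) = solve 4 (λ a b c d →
    (a :* c :- b :* d) :* (a :* c :- b :* d) :+ (a :* d :+ b :* c) :* (a :* d :+ b :* c)
      := (a :* a :+ b :* b) :* (c :* c :+ d :* d)) refl a b c d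

  norm²-cong : ∀ {z w} → z ≋ℂ w → norm² z ≋ norm² w
  norm²-cong (p , q) = +-cong (*-cong p p) (*-cong q q)

  norm²-0 : norm² 0ℂ ≋ 0ℝ
  norm²-0 = solve 0 (con (+ 0) :* con (+ 0) :+ con (+ 0) :* con (+ 0) := con (+ 0)) refl

  _×ℂ_ : ℕ → ℂ → ℂ
  _×ℂ_ = RawMonoidDefs._×_ (CommutativeRing.+-rawMonoid ℂ-commutativeRing)

  0≤re[n×1] : ∀ n k → ℚ.0ℚ ℚ.≤ seq (re (n ×ℂ 1ℂ)) k
  0≤re[n×1] zero k = ℚ.≤-refl
  0≤re[n×1] (suc n) k = ℚ.+-mono-≤ (ℚ.<⇒≤ (ℚ.positive⁻¹ ℚ.1ℚ)) (0≤re[n×1] n k)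

  ℂ-charZeroDomain : Subrings.IsCharZeroDomain ℂ-commutativeRing
  ℂ-charZeroDomain = record
    { stable = λ {z} {w} ¬¬z≈w →
          stable (λ ¬p → ¬¬z≈w λ (p , _) → ¬p p)
        , stable (λ ¬q → ¬¬z≈w λ (_ , q) → ¬q q)
    ; *-cancel = λ {z} {w} zw≈0 z≉0 → norm²≋0⇒≋0 (*-cancel
        (trans (sym (norm²-* z w)) (trans (norm²-cong zw≈0) norm²-0))
        (λ eq → z≉0 (norm²≋0⇒≋0 eq)))
    ; char0 = λ { zero _ → ≡.refl
                -- The real part of a positive multiple of 1 is at least 1, hence apart from 0.
                ; (suc n) (eq , _) → contradiction (≋0⇒null eq)
                    (λ null → null⇒¬apart null (ℚ.1ℚ , ℚ.positive⁻¹ ℚ.1ℚ , always (1≤ n))) }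
    }
    where
    1≤ : ∀ n k → ℚ.1ℚ ℚ.≤ ℚ.∣ seq (re (suc n ×ℂ 1ℂ)) k ∣
    1≤ n k = ℚ.≤-trans
      (≡.subst (ℚ._≤ ℚ.1ℚ ℚ.+ seq (re (n ×ℂ 1ℂ)) k) (ℚ.+-identityʳ ℚ.1ℚ)
        (ℚ.+-monoʳ-≤ ℚ.1ℚ (0≤re[n×1] n k)))
      (p≤∣p∣ (seq (re (suc n ×ℂ 1ℂ)) k))

  -- Conjugates of unimodular entries are their inverses, so inner products of rows become sums of
  -- quotients.
  *-conj : ∀ {z} → ∣ z ∣ℂ≈ 1ℝ → z *ℂ conj z ≋ℂ 1ℂ
  *-conj {a +i b} (_ , 1≈norm²) =
      trans (solve 2 (λ a b → a :* a :- b :* (:- b) := a :* a :+ b :* b) refl a b)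
        (trans (sym ⌊ 1≈norm² ⌋) (solve 0 (con (+ 1) :* con (+ 1) := con (+ 1)) refl))
    , solve 2 (λ a b → a :* (:- b) :+ b :* a := con (+ 0)) refl a b

  conj-cong : ∀ {z w} → z ≋ℂ w → conj z ≋ℂ conj w
  conj-cong (p , q) = p , -‿cong q

open ComplexField

open import Data.Nat using (_+_; _*_; _≤_)
open import Relation.Unary using (Empty)

-- From circulant Hadamard matrices to periodic sequences.

prime⇒odd : ∀ {p} → Prime p → 2 ℕ.< p → ∃[ m ] p ≡ 1 ℕ.+ 2 ℕ.* m
prime⇒odd {p} pp 2<p with p % 2 | m≡m%n+[m/n]*n p 2 | m%n<n p 2
... | 0 | eq | _ with prime⇒irreducible pp (ℕ.divides (p / 2) eq)
...   | inj₂ 2≡p = contradiction 2≡p (ℕ.<⇒≢ 2<p)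
prime⇒odd {p} pp 2<p | 1 | eq | _ =
  p / 2 , ≡.trans eq (≡.cong suc (ℕ.*-comm (p / 2) 2))
prime⇒odd {p} pp 2<p | suc (suc _) | _ | s≤s (s≤s ())

module _ {p q} (pp : Prime p) (qp : Prime q) (p≢q : p ≢ q) (2<p : 2 ℕ.< p) (2<q : 2 ℕ.< q)
  {H : Matrix (p + q)} (circ : C-circ (p + q) (p * q) H) where

  open C-circ circ
  open IsComplexHadamard isComplexHadamard
  open CommutativeRing ℂ-commutativeRing using (trans; sym; refl; +-cong; *-cong; *-congʳ; reflexive; commutativeSemiring; semiring)
  open Sums commutativeSemiring using (∑<)
  open Exp semiring using (_^_)
  open RootsOfUnity ℂ-commutativeRing ℂ-charZeroDomain using (no-circulant-Hadamard; split-root; prime∤prime)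

  private
    n = p ℕ.+ q
    instance
      n-nonZero : ℕ.NonZero n
      n-nonZero = ℕ.>-nonZero (ℕ.<-≤-trans (ℕ.<-trans (s≤s z≤n) 2<p) (ℕ.m≤m+n p q))

    ^ℂ≡^ : ∀ z k → z ^ℂ k ≡ z ^ k
    ^ℂ≡^ z zero = ≡.refl
    ^ℂ≡^ z (suc k) = ≡.cong (z *ℂ_) (^ℂ≡^ z k)

    sumℂ≈∑ : ∀ k (f : Fin k → ℂ) g → (∀ j → f j ≋ℂ g (toℕ j)) → sumℂ f ≋ℂ ∑< k g
    sumℂ≈∑ zero f g f≈g = refl
    sumℂ≈∑ (suc k) f g f≈g = +-cong (f≈g Fin.zero) (sumℂ≈∑ k (f ∘ Fin.suc) (g ∘ suc) (f≈g ∘ Fin.suc))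

    index : ℕ → Fin n
    index i = fromℕ< (m%n<n i n)

    toℕ-index : ∀ i → toℕ (index i) ≡ i % n
    toℕ-index i = Fin.toℕ-fromℕ< (m%n<n i n)

    toℕ-index-< : ∀ {i} → i ℕ.< n → toℕ (index i) ≡ i
    toℕ-index-< {i} i<n = ≡.trans (toℕ-index i) (m<n⇒m%n≡m i<n)

    toℕ-index-0 : toℕ (index 0) ≡ 0
    toℕ-index-0 = toℕ-index-< (ℕ.>-nonZero⁻¹ n)

    index-mod : ∀ i → index i ≡ index (i % n)
    index-mod i = Fin.toℕ-injective (≡.trans (toℕ-index i)
      (≡.sym (≡.trans (toℕ-index (i % n)) (m%n%n≡m%n i n))))

    h : Fin n → ℂ
    h = H (index 0)

    split : ∀ j → ∃[ u ] ∃[ v ] u ^ p ≋ℂ 1ℂ × v ^ q ≋ℂ 1ℂ × u *ℂ v ≋ℂ h j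
    split j = split-root pp (prime∤prime qp pp (p≢q ∘ ≡.sym))
      (trans (reflexive (≡.sym (^ℂ≡^ (h j) (p ℕ.* q)))) (wrap (rootsOfUnity (index 0) j)))

    U V : Fin n → ℂ
    U j = proj₁ (split j)
    V j = proj₁ (proj₂ (split j))

    UV≈h : ∀ j → U j *ℂ V j ≋ℂ h j
    UV≈h j = proj₂ (proj₂ (proj₂ (proj₂ (split j))))

    -- Column minus row is j - (n - k), congruent to j + k; the row `n ∸ k` is chosen to make the
    -- shift a forward one.
    shift : ∀ k → 0 ℕ.< k → k ℕ.< n → ∀ j → H (index (n ℕ.∸ k)) j ≋ℂ h (index (toℕ j ℕ.+ k))
    shift k 0<k k<n j = wrap (isCirculant (index (n ℕ.∸ k)) j (index 0) (index (toℕ j ℕ.+ k))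
      (ℤ.∣⇒∣ᵤ (ℤ.divides (+ t ℤ.- + 1) (begin
        (+ c ℤ.- + toℕ (index (n ℕ.∸ k))) ℤ.- (+ toℕ (index (c ℕ.+ k)) ℤ.- + toℕ (index 0))
          ≡⟨ ≡.cong₂ (λ a b → (+ c ℤ.- + a) ℤ.- b)
               (toℕ-index-< (ℕ.∸-monoʳ-< {n} {k} {0} 0<k (ℕ.<⇒≤ k<n)))
               (≡.cong₂ (λ a b → + a ℤ.- + b) (toℕ-index (c ℕ.+ k)) toℕ-index-0) ⟩
        (+ c ℤ.- + (n ℕ.∸ k)) ℤ.- (+ r ℤ.- + 0)
          ≡⟨ solve 4 (λ c d r k → (c :- d) :- (r :- con (+ 0)) := (c :+ k) :- (r :+ (d :+ k))) ≡.refl (+ c) (+ (n ℕ.∸ k)) (+ r) (+ k) ⟩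
        + (c ℕ.+ k) ℤ.- (+ r ℤ.+ + (n ℕ.∸ k ℕ.+ k))
          ≡⟨ ≡.cong₂ (λ a b → + a ℤ.- (+ r ℤ.+ + b)) (m≡m%n+[m/n]*n (c ℕ.+ k) n) (ℕ.m∸n+n≡m (ℕ.<⇒≤ k<n)) ⟩
        + (r ℕ.+ t ℕ.* n) ℤ.- (+ r ℤ.+ + n)
          ≡⟨ ≡.cong (λ a → (+ r ℤ.+ a) ℤ.- (+ r ℤ.+ + n)) (ℤ.pos-* t n) ⟩
        (+ r ℤ.+ + t ℤ.* + n) ℤ.- (+ r ℤ.+ + n)
          ≡⟨ solve 3 (λ r t n → (r :+ t :* n) :- (r :+ n) := (t :- con (+ 1)) :* n) ≡.refl (+ r) (+ t) (+ n) ⟩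
        (+ t ℤ.- + 1) ℤ.* + n ∎))))
      where
      open ≡.≡-Reasoning
      open ℤ-Solver
      c = toℕ j
      r = (c ℕ.+ k) % n
      t = (c ℕ.+ k) / n

    row≢0 : ∀ k → 0 ℕ.< k → k ℕ.< n → index 0 ≢ index (n ℕ.∸ k)
    row≢0 k 0<k k<n eq = ℕ.<⇒≢ (ℕ.m<n⇒0<n∸m k<n) (≡.trans
      (≡.sym toℕ-index-0)
      (≡.trans (≡.cong toℕ eq) (toℕ-index-< (ℕ.∸-monoʳ-< {n} {k} {0} 0<k (ℕ.<⇒≤ k<n)))))

    index-toℕ : ∀ j → j ≡ index (toℕ j)
    index-toℕ j = Fin.toℕ-injective (≡.sym (toℕ-index-< (Fin.toℕ<n j)))

    orthogonality : ∀ k → 0 ℕ.< k → k ℕ.< n →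
      ∑< n (λ c → U (index c) *ℂ V (index c) *ℂ conj (h (index (c ℕ.+ k)))) ≋ℂ 0ℂ
    orthogonality k 0<k k<n = trans
      (sym (sumℂ≈∑ n _ _ λ j → *-cong
        (trans (reflexive (≡.cong h (index-toℕ j))) (sym (UV≈h (index (toℕ j)))))
        (conj-cong (shift k 0<k k<n j))))
      (wrap (orthogonal (index 0) (index (n ℕ.∸ k)) (row≢0 k 0<k k<n)))

  circulant-Hadamard⇒⊥ : ⊥
  circulant-Hadamard⇒⊥ = no-circulant-Hadamard pp qp p≢q
    (proj₁ (prime⇒odd pp 2<p)) (proj₁ (prime⇒odd qp 2<q))
    (proj₂ (prime⇒odd pp 2<p)) (proj₂ (prime⇒odd qp 2<q))
    (U ∘ index) (V ∘ index) (conj ∘ h ∘ index)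
    (λ i → reflexive (≡.cong U (index-mod i))) (λ i → reflexive (≡.cong V (index-mod i)))
    (λ i → proj₁ (proj₂ (proj₂ (split (index i)))))
    (λ i → proj₁ (proj₂ (proj₂ (proj₂ (split (index i))))))
    (λ i → trans (*-congʳ (UV≈h (index i))) (*-conj (unimodular (index 0) (index i))))
    orthogonality

theorem1p3 : (p q : ℕ) → Prime p → Prime q → 5 ≤ p → 5 ≤ q → p ≢ q →
    Empty (C-circ (p + q) (p * q))
theorem1p3 p q pp qp 5≤p 5≤q p≢q H circ = circulant-Hadamard⇒⊥ pp qp p≢q
  (ℕ.≤-trans (s≤s (s≤s (s≤s z≤n))) 5≤p) (ℕ.≤-trans (s≤s (s≤s (s≤s z≤n))) 5≤q) circ
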